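{- Let $n\ge 1$ and let $u\le w$ in the Bruhat order on $\Sigma_n$. Then \[ \mathfrak{S}_{w/u}(x)\ =\ \sum_{v\in\Sigma_n} c^w_{u,v}\,\mathfrak{S}_{w_0v}(x)\,. \]
   Context: $\Sigma_n$ is the symmetric group on $\{1,\dots,n\}$, $w_0=n\,(n-1)\cdots 2\,1$ is its longest element, and $\mathfrak{S}_w(x)$ denotes the (Lascoux–Schützenberger) Schubert polynomial of $w$. For $u,v,w\in\Sigma_n$, $c^w_{u,v}$ is the coefficient of $\mathfrak{S}_w(x)$ in the expansion $\mathfrak{S}_u(x)\mathfrak{S}_v(x)=\sum_w c^w_{u,v}\mathfrak{S}_w(x)$. The cohomology ring of the flag manifold is $H^*\mathrm{F}\ell_n=\mathbb{Z}[x_1,\dots,x_n]/\langle e_1,\dots,e_n\rangle$ ($e_i$ the elementary symmetric polynomials in $x_1,\dots,x_n$), and $\sigma_w$ is the class of $\mathfrak{S}_w(x)$ (the Schubert class). Using the degree reverse lexicographic term order with $x_1<x_2<\dots<x_n$, every element of $H^*\mathrm{F}\ell_n$ has a unique normal form polynomial representative. The skew Schubert polynomial $\mathfrak{S}_{w/u}(x)$ is defined as the normal form representative of the class $\sigma_u\cdot\sigma_{w_0w}$. (Schubert polynomials $\mathfrak{S}_w$, $w\in\Sigma_n$, are themselves normal form representatives of $\sigma_w$.) -}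

module Defs where

open import Data.Bool using (Bool; true; false; if_then_else_; _∧_; not)
open import Data.Nat as ℕ using (ℕ; zero; suc; _∸_; _<_; _<ᵇ_; _≡ᵇ_)
open import Data.Nat.Properties using () renaming (_≟_ to _≟ℕ_)
open import Data.Integer as ℤ using (ℤ; +_; -[1+_])
open import Data.Fin using (Fin; toℕ)
open import Data.Vec as Vec using (Vec; []; _∷_)
open import Data.Vec.Properties using (≡-dec)
open import Data.List as List using (List; []; _∷_; _++_; map; concatMap; upTo; filterᵇ; allFin; foldr; length)
open import Data.Bool.ListAction using (any)
open import Data.Maybe using (Maybe; just; nothing)
open import Data.Product using (_×_; _,_; ∃; ∃-syntax; Σ)
open import Data.Sum using (_⊎_)
open import Data.Empty using (⊥)
open import Relation.Nullary using (¬_; does)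
open import Relation.Binary.PropositionalEquality using (_≡_; _≢_)
open import Relation.Binary.Construct.Closure.ReflexiveTransitive using (Star)
open import Data.List.Membership.Propositional using (_∈_)

-- Polynomials in x_1,…,x_n over ℤ, as formal sums of terms
-- (coefficient , exponent vector).  Equality is equality of all
-- coefficients.

Mono : ℕ → Set
Mono n = Vec ℕ n

Poly : ℕ → Set
Poly n = List (ℤ × Mono n)

coeff : ∀ {n} → Poly n → Mono n → ℤ
coeff []            m = + 0
coeff ((c , m′) ∷ p) m =
  if does (≡-dec _≟ℕ_ m′ m) then c ℤ.+ coeff p m else coeff p m

infix 4 _≈_
_≈_ : ∀ {n} → Poly n → Poly n → Set
p ≈ q = ∀ m → coeff p m ≡ coeff q m

0P : ∀ {n} → Poly n
0P = []

infixl 6 _⊕_ _⊝_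
infixl 7 _⊗_ _·_

_⊕_ : ∀ {n} → Poly n → Poly n → Poly n
p ⊕ q = p ++ q

_·_ : ∀ {n} → ℤ → Poly n → Poly n
c · p = map (λ { (a , m) → (c ℤ.* a , m) }) p

_⊝_ : ∀ {n} → Poly n → Poly n → Poly n
p ⊝ q = p ⊕ (ℤ.- (+ 1)) · q

_⊗_ : ∀ {n} → Poly n → Poly n → Poly n
p ⊗ q = concatMap (λ { (a , m) → map (λ { (b , m′) → (a ℤ.* b , Vec.zipWith ℕ._+_ m m′) }) q }) p

ΣP : ∀ {n} → List (Poly n) → Poly n
ΣP = foldr _⊕_ 0P

-- Divided difference ∂_i (0-indexed: acting on variables x_{i+1}, x_{i+2}),
-- written out on monomials:  ∂_i (x_i^a x_{i+1}^b)
--   = Σ_{j<a-b} x_i^{b+j} x_{i+1}^{a-1-j}     if a > b,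
--   = - Σ_{j<b-a} x_i^{a+j} x_{i+1}^{b-1-j}   if a < b,   0 if a = b.

ddMono : ∀ {k} → ℕ → Vec ℕ k → Poly k
ddMono zero (a ∷ b ∷ rest) =
  map (λ j → (+ 1 , (b ℕ.+ j) ∷ (a ∸ 1 ∸ j) ∷ rest)) (upTo (a ∸ b))
  ++ map (λ j → (-[1+ 0 ] , (a ℕ.+ j) ∷ (b ∸ 1 ∸ j) ∷ rest)) (upTo (b ∸ a))
ddMono (suc i) (a ∷ rest) = map (λ { (c , m) → (c , a ∷ m) }) (ddMono i rest)
ddMono _ _ = []

∂ : ∀ {n} → ℕ → Poly n → Poly n
∂ i p = concatMap (λ { (c , m) → c · ddMono i m }) p

-- Permutations of {1,…,n} in one-line notation, shifted to values
-- 0,…,n-1 and positions 0,…,n-1 (lists of naturals).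

nth : List ℕ → ℕ → ℕ
nth []       _       = 0
nth (x ∷ _)  zero    = x
nth (_ ∷ xs) (suc i) = nth xs i

swapAt : ℕ → ℕ → List ℕ → List ℕ
swapAt i j w = map f (upTo (length w))
  where
  f : ℕ → ℕ
  f k = if k ≡ᵇ i then nth w j else if k ≡ᵇ j then nth w i else nth w k

words : ℕ → ℕ → List (List ℕ)
words n zero    = [] ∷ []
words n (suc k) = concatMap (λ a → map (a ∷_) (words n k)) (upTo n)

distinct : List ℕ → Bool
distinct []       = true
distinct (x ∷ xs) = not (any (λ y → x ≡ᵇ y) xs) ∧ distinct xs

perms : ℕ → List (List ℕ)
perms n = filterᵇ distinct (words n n)

IsPerm : ℕ → List ℕ → Set
IsPerm n w = w ∈ perms n

len : List ℕ → ℕ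
len []       = 0
len (x ∷ xs) = length (filterᵇ (λ y → y <ᵇ x) xs) ℕ.+ len xs

w₀ : ℕ → List ℕ
w₀ n = map (λ a → n ∸ 1 ∸ a) (upTo n)

w₀· : ℕ → List ℕ → List ℕ
w₀· n v = map (λ a → n ∸ 1 ∸ a) v

ι : ℕ → ℕ → List ℕ → List ℕ
ι n N w = w ++ map (n ℕ.+_) (upTo (N ∸ n))

BruhatStep : ℕ → List ℕ → List ℕ → Set
BruhatStep n u w = ∃[ i ] ∃[ j ] (i < j × j < n × w ≡ swapAt i j u × len u < len w)

_≤[_]B_ : List ℕ → ℕ → List ℕ → Set
u ≤[ n ]B w = Star (BruhatStep n) u w

-- Schubert polynomials (Lascoux–Schützenberger):
-- 𝔖_{w₀} = x_1^{n-1} x_2^{n-2} ⋯ x_{n-1},  and 𝔖_w = ∂_i 𝔖_{w s_i}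
-- whenever w(i) < w(i+1).  We take the first such i (fuel n*n suffices).

firstAscent : List ℕ → Maybe ℕ
firstAscent (a ∷ b ∷ rest) =
  if a <ᵇ b then just 0 else Data.Maybe.map suc (firstAscent (b ∷ rest))
  where import Data.Maybe
firstAscent _ = nothing

staircase : (n : ℕ) → Mono n
staircase n = Vec.tabulate (λ (k : Fin n) → n ∸ 1 ∸ toℕ k)

schubAux : ℕ → (n : ℕ) → List ℕ → Poly n
schubAux zero    n w = 0P
schubAux (suc f) n w with firstAscent w
... | nothing = (+ 1 , staircase n) ∷ []
... | just i  = ∂ i (schubAux f n (swapAt i (suc i) w))

𝔖 : (n : ℕ) → List ℕ → Poly n
𝔖 n w = schubAux (n ℕ.* n) n w

-- H* Fℓ_n = ℤ[x_1..x_n]/⟨e_1..e_n⟩ and degrevlex normal forms (x_1<⋯<x_n)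

zeroOne : (n : ℕ) → List (Mono n)
zeroOne zero    = [] ∷ []
zeroOne (suc n) = map (0 ∷_) (zeroOne n) ++ map (1 ∷_) (zeroOne n)

e : (n : ℕ) → ℕ → Poly n
e n k = map (λ (m : Mono n) → (+ 1 , m)) (filterᵇ (λ (m : Mono n) → Vec.sum m ≡ᵇ k) (zeroOne n))

InIdeal : ∀ {n} → Poly n → Set
InIdeal {n} f = Σ (Fin n → Poly n) λ q → (f ≈ ΣP (map (λ (i : Fin n) → q i ⊗ e n (suc (toℕ i))) (allFin n)))

FirstGt : ∀ {n} → Mono n → Mono n → Set
FirstGt []       []       = ⊥
FirstGt (x ∷ xs) (y ∷ ys) = y < x ⊎ (x ≡ y × FirstGt xs ys)

-- degree reverse lexicographic order with x_1 < x_2 < ⋯ < x_n :  a ≺ b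
infix 4 _≺_
_≺_ : ∀ {n} → Mono n → Mono n → Set
a ≺ b = Vec.sum a < Vec.sum b ⊎ (Vec.sum a ≡ Vec.sum b × FirstGt a b)

IsLeadingMonomial : ∀ {n} → Poly n → Mono n → Set
IsLeadingMonomial f m = coeff f m ≢ + 0 × (∀ m′ → m ≺ m′ → coeff f m′ ≡ + 0)

_∣M_ : ∀ {n} → Mono n → Mono n → Set
a ∣M b = ∃[ c ] (b ≡ Vec.zipWith ℕ._+_ a c)

InInitialIdeal : ∀ {n} → Mono n → Set
InInitialIdeal {n} m = ∃[ f ] ∃[ m₀ ] (InIdeal f × IsLeadingMonomial f m₀ × m₀ ∣M m)

IsNormalForm : ∀ {n} → Poly n → Poly n → Set
IsNormalForm f g = InIdeal (f ⊝ g) × (∀ m → coeff g m ≢ + 0 → ¬ InInitialIdeal m)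

IsSkewSchubert : (n : ℕ) → List ℕ → List ℕ → Poly n → Set
IsSkewSchubert n w u g = IsNormalForm (𝔖 n u ⊗ 𝔖 n (w₀· n w)) g

-- c : Σ_n → Σ_N → ℤ are the structure constants c^{w'}_{u,v} for u fixed:
-- 𝔖_u 𝔖_v = Σ_{w' ∈ Σ_N} c^{w'}_{u,v} 𝔖_{w'}  (computed in Σ_N ⊇ Σ_n)
IsLRExpansion : (n N : ℕ) → List ℕ → (List ℕ → List ℕ → ℤ) → Set
IsLRExpansion n N u c = ∀ v → IsPerm n v →
  𝔖 N (ι n N u) ⊗ 𝔖 N (ι n N v) ≈ ΣP (map (λ w′ → c v w′ · 𝔖 N w′) (perms N))

{-# OPTIONS --safe #-}

-- Divided differences act on the coinvariant ring, since the elementary symmetric polynomials lie in their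
-- kernels.  For x ∈ Σ_n let Λ_x be the constant term of ∂ along a reduced word of x; it kills the ideal
-- I = ⟨e₁,…,e_n⟩ and is dual to the Schubert basis, Λ_x(𝔖_y) = δ_{xy}.  The Schubert polynomials span
-- ℤ[x₁,…,x_n] modulo I: their span contains 1 = 𝔖_id, is stable under every ∂ᵢ, and is stable under
-- multiplication by x_j, because x_j 𝔖_{w₀} ∈ I and the Leibniz rule carries this down from w₀.  Hence an
-- element is in I as soon as every Λ_x kills it.  Since ∂ᵢ is self-adjoint for the form (f, g) ↦ Λ_{w₀}(fg),
-- Λ_x(f) = Λ_{w₀}(f 𝔖_{w₀x}); so Λ_x(𝔖_u 𝔖_{w₀w}) = Λ_w(𝔖_u 𝔖_{w₀x}) = c^w_{u,w₀x}, which is also Λ_x of the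
-- claimed sum.
--
-- Schubert polynomials only involve monomials dividing x^δ, δ = (n−1,…,1,0).  For such a monomial x^a an
-- explicit word in the ∂ᵢ gives a functional that kills I, is 1 on x^a and 0 on every smaller monomial; so
-- x^a is not the leading monomial of an element of I.
module Submission where

open import Defs
open import Data.Bool using (Bool; true; false; if_then_else_; T; T?)
open import Data.Bool.ListAction using (any)
open import Data.Empty using (⊥; ⊥-elim)
open import Data.Fin as Fin using (Fin; toℕ)
import Data.Fin.Properties as FinP
open import Data.Integer as ℤ using (ℤ; 0ℤ; 1ℤ; -1ℤ)
import Data.Integer.Properties as ℤP
import Data.Integer.Tactic.RingSolver as ℤSolver
open import Data.List as List
  using (List; []; _∷_; _++_; map; concatMap; upTo; downFrom; applyUpTo; length; filterᵇ; allFin)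
import Data.List.Properties as LP
open import Data.List.Membership.Propositional using (_∈_)
import Data.List.Membership.Propositional.Properties as ∈P
open import Data.List.Relation.Unary.All as All using (All; []; _∷_)
import Data.List.Relation.Unary.All.Properties as AllP
open import Data.List.Relation.Unary.AllPairs using (AllPairs; []; _∷_)
open import Data.List.Relation.Unary.Any using (here; there)
open import Data.List.Relation.Unary.Linked using (Linked; []; [-]; _∷_)
open import Data.List.Relation.Unary.Linked.Properties using (Linked⇒AllPairs)
open import Data.List.Relation.Unary.Unique.Propositional using (Unique)
import Data.List.Relation.Unary.Unique.Propositional.Properties as UniqueP
open import Data.Maybe using (just; nothing)
open import Data.Nat as ℕ
  using (ℕ; zero; suc; _∸_; _≤_; _<_; _>_; _≤′_; ≤′-refl; ≤′-step; z≤n; s≤s; _≡ᵇ_; _<ᵇ_)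
import Data.Nat.Properties as ℕP
import Data.Nat.Tactic.RingSolver as ℕSolver
open import Data.Product using (_×_; _,_; ∃; ∃-syntax; proj₁; proj₂)
open import Data.Sum using (_⊎_; inj₁; inj₂)
open import Data.Unit using (⊤)
open import Data.Vec as Vec using (Vec; []; _∷_; _∷ʳ_)
import Data.Vec.Properties as VecP
open import Function using (_∘_; id)
open import Relation.Binary.Bundles using (Setoid)
open import Relation.Binary.Definitions using (tri<; tri≈; tri>)
open import Relation.Binary.PropositionalEquality
  using (_≡_; _≢_; refl; sym; trans; cong; cong₂; subst; module ≡-Reasoning)
import Relation.Binary.Reasoning.Setoid as SetoidReasoning
open import Relation.Nullary using (¬_; does; yes; no; Dec)

-- Polynomials and linear operators

-- Two features of the definitions shape the proof. Polynomials are lists of terms compared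
-- coefficientwise, so operators given term by term must first be shown to respect equality; a
-- general statement about termwise functionals does this once for all of them. And 𝔖_w is defined
-- through the first ascent of w only, while the argument needs 𝔖_w = ∂ᵢ𝔖_{wsᵢ} at every ascent i.
-- This rests on the commutation and braid relations of the ∂ᵢ, all of which come from the single
-- rule ∂ᵢ x_k = κ + x_{sᵢ(k)} ∂ᵢ by induction over multiplication by variables, starting at the
-- polynomial 1, which every ∂ᵢ kills. The numbers c come from an expansion in Σ_N with N ≥ n,
-- whereas the quotient ring has n variables. The bridge is a reduced word of w in Σ_n: it is also a
-- reduced word of the image of w in Σ_N, and its operators do not touch the added variables.
-- Schubert polynomials are unchanged by adding a fixed point, so Λ_w takes the same value on both
-- products.

_≟M_ : ∀ {n} (a b : Mono n) → Dec (a ≡ b)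
_≟M_ = VecP.≡-dec ℕP._≟_

-- _≈_ unfolds to a function type, from which its arguments cannot be inferred; this wrapper is used instead.
infix 4 _≋_
record _≋_ {n} (p q : Poly n) : Set where
  constructor mk
  field at : p ≈ q
open _≋_

≋-refl : ∀ {n} {p : Poly n} → p ≋ p
≋-refl = mk λ _ → refl

≋-sym : ∀ {n} {p q : Poly n} → p ≋ q → q ≋ p
≋-sym h = mk λ m → sym (at h m)

≋-trans : ∀ {n} {p q r : Poly n} → p ≋ q → q ≋ r → p ≋ r
≋-trans h k = mk λ m → trans (at h m) (at k m)

≡⇒≋ : ∀ {n} {p q : Poly n} → p ≡ q → p ≋ q
≡⇒≋ refl = ≋-refl

PolySetoid : ℕ → Setoid _ _
PolySetoid n = record
  { Carrier = Poly n ; _≈_ = _≋_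
  ; isEquivalence = record { refl = ≋-refl ; sym = ≋-sym ; trans = ≋-trans } }

module ≋-Reasoning {n} = SetoidReasoning (PolySetoid n)

mono : ∀ {n} → Mono n → Poly n
mono m = (1ℤ , m) ∷ []

𝟏 : ∀ {n} → Mono n
𝟏 = Vec.replicate _ 0

δ : ∀ {n} → Mono n → Mono n → ℤ
δ m m′ = if does (m ≟M m′) then 1ℤ else 0ℤ

-- The coefficients of `∂ i p`, `p ⊗ q` and `mapM g p` all have this form, so compatibility with
-- equality of polynomials is settled once, in `lin-cong`.
lin : ∀ {n} → (Mono n → ℤ) → Poly n → ℤ
lin φ []            = 0ℤ
lin φ ((c , m) ∷ p) = c ℤ.* φ m ℤ.+ lin φ p

coeff-∷ : ∀ {n} c (m′ : Mono n) p m → coeff ((c , m′) ∷ p) m ≡ c ℤ.* δ m′ m ℤ.+ coeff p m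
coeff-∷ c m′ p m with does (m′ ≟M m)
... | true  = cong (ℤ._+ coeff p m) (sym (ℤP.*-identityʳ c))
... | false = trans (sym (ℤP.+-identityˡ _)) (cong (ℤ._+ coeff p m) (sym (ℤP.*-zeroʳ c)))

coeff-lin : ∀ {n} (p : Poly n) m → coeff p m ≡ lin (λ m′ → δ m′ m) p
coeff-lin []             m = refl
coeff-lin ((c , m′) ∷ p) m = trans (coeff-∷ c m′ p m) (cong (ℤ._+_ (c ℤ.* δ m′ m)) (coeff-lin p m))

lin-++ : ∀ {n} φ (p q : Poly n) → lin φ (p ++ q) ≡ lin φ p ℤ.+ lin φ q
lin-++ φ []            q = sym (ℤP.+-identityˡ _)
lin-++ φ ((c , m) ∷ p) q = trans (cong (ℤ._+_ (c ℤ.* φ m)) (lin-++ φ p q)) (sym (ℤP.+-assoc (c ℤ.* φ m) _ _))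

lin-· : ∀ {n} φ c (p : Poly n) → lin φ (c · p) ≡ c ℤ.* lin φ p
lin-· φ c []            = sym (ℤP.*-zeroʳ c)
lin-· φ c ((a , m) ∷ p) = trans (cong (ℤ._+_ (c ℤ.* a ℤ.* φ m)) (lin-· φ c p)) (lemma c a (φ m) (lin φ p))
  where
  lemma : ∀ c a x y → c ℤ.* a ℤ.* x ℤ.+ c ℤ.* y ≡ c ℤ.* (a ℤ.* x ℤ.+ y)
  lemma = ℤSolver.solve-∀

coeff-⊕ : ∀ {n} (p q : Poly n) m → coeff (p ⊕ q) m ≡ coeff p m ℤ.+ coeff q m
coeff-⊕ p q m rewrite coeff-lin (p ⊕ q) m | coeff-lin p m | coeff-lin q m = lin-++ _ p q

coeff-· : ∀ {n} c (p : Poly n) m → coeff (c · p) m ≡ c ℤ.* coeff p m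
coeff-· c p m rewrite coeff-lin (c · p) m | coeff-lin p m = lin-· _ c p

lin-+φ : ∀ {n} φ ψ (p : Poly n) → lin (λ m → φ m ℤ.+ ψ m) p ≡ lin φ p ℤ.+ lin ψ p
lin-+φ φ ψ []            = refl
lin-+φ φ ψ ((c , m) ∷ p) = trans (cong (ℤ._+_ (c ℤ.* (φ m ℤ.+ ψ m))) (lin-+φ φ ψ p)) (lemma c (φ m) (ψ m) _ _)
  where
  lemma : ∀ c x y u v → c ℤ.* (x ℤ.+ y) ℤ.+ (u ℤ.+ v) ≡ (c ℤ.* x ℤ.+ u) ℤ.+ (c ℤ.* y ℤ.+ v)
  lemma = ℤSolver.solve-∀

lin-*φ : ∀ {n} a φ (p : Poly n) → lin (λ m → a ℤ.* φ m) p ≡ a ℤ.* lin φ p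
lin-*φ a φ []            = sym (ℤP.*-zeroʳ a)
lin-*φ a φ ((c , m) ∷ p) = trans (cong (ℤ._+_ (c ℤ.* (a ℤ.* φ m))) (lin-*φ a φ p)) (lemma c a (φ m) _)
  where
  lemma : ∀ c a x u → c ℤ.* (a ℤ.* x) ℤ.+ a ℤ.* u ≡ a ℤ.* (c ℤ.* x ℤ.+ u)
  lemma = ℤSolver.solve-∀

lin-cong-φ : ∀ {n} {φ ψ : Mono n → ℤ} → (∀ m → φ m ≡ ψ m) → ∀ p → lin φ p ≡ lin ψ p
lin-cong-φ h []            = refl
lin-cong-φ h ((c , m) ∷ p) = cong₂ (λ x y → c ℤ.* x ℤ.+ y) (h m) (lin-cong-φ h p)

lin-0φ : ∀ {n} (p : Poly n) → lin (λ _ → 0ℤ) p ≡ 0ℤ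
lin-0φ []            = refl
lin-0φ ((c , m) ∷ p) = trans (cong₂ ℤ._+_ (ℤP.*-zeroʳ c) (lin-0φ p)) refl

lin-swap : ∀ {n k} (φ : Mono n → Mono k → ℤ) p q →
  lin (λ a → lin (φ a) q) p ≡ lin (λ b → lin (λ a → φ a b) p) q
lin-swap φ []            q = sym (lin-0φ q)
lin-swap φ ((c , m) ∷ p) q = begin
  c ℤ.* lin (φ m) q ℤ.+ lin (λ a → lin (φ a) q) p
    ≡⟨ cong₂ ℤ._+_ (sym (lin-*φ c (φ m) q)) (lin-swap φ p q) ⟩
  lin (λ b → c ℤ.* φ m b) q ℤ.+ lin (λ b → lin (λ a → φ a b) p) q
    ≡⟨ sym (lin-+φ _ _ q) ⟩
  lin (λ b → c ℤ.* φ m b ℤ.+ lin (λ a → φ a b) p) q ∎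
  where open ≡-Reasoning

-- Gathering all terms with one exponent at a time lets a recursion on lists use hypotheses that
-- speak of coefficients only.
del : ∀ {n} → Mono n → Poly n → Poly n
del m []             = []
del m ((c , m′) ∷ p) = if does (m′ ≟M m) then del m p else (c , m′) ∷ del m p

lin-del : ∀ {n} φ m (p : Poly n) → lin φ p ≡ coeff p m ℤ.* φ m ℤ.+ lin φ (del m p)
lin-del φ m [] = refl
lin-del φ m ((c , m′) ∷ p) with m′ ≟M m
... | yes refl = trans (cong (ℤ._+_ (c ℤ.* φ m)) (lin-del φ m p)) (lemma c (φ m) (coeff p m) _)
  where
  lemma : ∀ c x a u → c ℤ.* x ℤ.+ (a ℤ.* x ℤ.+ u) ≡ (c ℤ.+ a) ℤ.* x ℤ.+ u
  lemma = ℤSolver.solve-∀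
... | no _ = trans (cong (ℤ._+_ (c ℤ.* φ m′)) (lin-del φ m p)) (lemma (c ℤ.* φ m′) (coeff p m ℤ.* φ m) _)
  where
  lemma : ∀ a b u → a ℤ.+ (b ℤ.+ u) ≡ b ℤ.+ (a ℤ.+ u)
  lemma = ℤSolver.solve-∀

coeff-del : ∀ {n} m m′ (p : Poly n) → coeff (del m p) m′ ≡ 0ℤ ⊎ coeff (del m p) m′ ≡ coeff p m′
coeff-del m m′ p with m ≟M m′
... | yes refl = inj₁ (go p)
  where
  go : ∀ p → coeff (del m p) m ≡ 0ℤ
  go [] = refl
  go ((c , m″) ∷ p) with m″ ≟M m in eq
  ... | yes refl = go p
  ... | no  _    rewrite eq = go p
... | no m≢m′ = inj₂ (go p)
  where
  go : ∀ p → coeff (del m p) m′ ≡ coeff p m′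
  go [] = refl
  go ((c , m″) ∷ p) with m″ ≟M m
  ... | no  _    rewrite go p = refl
  ... | yes refl with m ≟M m′
  ...   | yes e = ⊥-elim (m≢m′ e)
  ...   | no  _ = go p

length-del : ∀ {n} m (p : Poly n) → length (del m p) ≤ length p
length-del m [] = z≤n
length-del m ((c , m′) ∷ p) with does (m′ ≟M m)
... | true  = ℕP.m≤n⇒m≤1+n (length-del m p)
... | false = s≤s (length-del m p)

-- Once the exponent of the head is gathered, the remainder is shorter and each of its coefficients
-- is zero or unchanged, so the hypothesis persists. The choice left open for each `m` covers both
-- uses: equal polynomials, where the coefficients of the difference vanish, and leading monomials,
-- where larger monomials have coefficient zero and the functional vanishes on the others.
lin-vanish : ∀ {n} φ (p : Poly n) → (∀ m → coeff p m ≡ 0ℤ ⊎ φ m ≡ 0ℤ) → lin φ p ≡ 0ℤ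
lin-vanish {n} φ p = go (length p) p ℕP.≤-refl
  where
  zero* : ∀ m p → coeff p m ≡ 0ℤ ⊎ φ m ≡ 0ℤ → coeff p m ℤ.* φ m ≡ 0ℤ
  zero* m p (inj₁ e) rewrite e = refl
  zero* m p (inj₂ e) rewrite e = ℤP.*-zeroʳ (coeff p m)
  go : ∀ k (p : Poly n) → length p ≤ k → (∀ m → coeff p m ≡ 0ℤ ⊎ φ m ≡ 0ℤ) → lin φ p ≡ 0ℤ
  go k [] _ _ = refl
  go (suc k) p@((c , m) ∷ p′) (s≤s l) h = begin
    lin φ p                                     ≡⟨ lin-del φ m p ⟩
    coeff p m ℤ.* φ m ℤ.+ lin φ (del m p)       ≡⟨ cong₂ ℤ._+_ (zero* m p (h m)) (go k (del m p) shorter h′) ⟩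
    0ℤ ∎
    where
    open ≡-Reasoning
    shorter : length (del m p) ≤ k
    shorter with m ≟M m
    ... | yes _ = ℕP.≤-trans (length-del m p′) l
    ... | no ne = ⊥-elim (ne refl)
    h′ : ∀ m′ → coeff (del m p) m′ ≡ 0ℤ ⊎ φ m′ ≡ 0ℤ
    h′ m′ with coeff-del m m′ p
    ... | inj₁ e = inj₁ e
    ... | inj₂ e with h m′
    ...   | inj₁ e′ = inj₁ (trans e e′)
    ...   | inj₂ e′ = inj₂ e′

lin-cong : ∀ {n} φ {p q : Poly n} → p ≋ q → lin φ p ≡ lin φ q
lin-cong φ {p} {q} h = ℤP.i-j≡0⇒i≡j _ _ (begin
  lin φ p ℤ.- lin φ q           ≡⟨ cong (ℤ._+_ (lin φ p)) (sym (ℤP.-1*i≡-i (lin φ q))) ⟩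
  lin φ p ℤ.+ -1ℤ ℤ.* lin φ q   ≡⟨ cong (ℤ._+_ (lin φ p)) (sym (lin-· φ -1ℤ q)) ⟩
  lin φ p ℤ.+ lin φ (-1ℤ · q)   ≡⟨ sym (lin-++ φ p _) ⟩
  lin φ (p ⊝ q)                 ≡⟨ lin-vanish φ (p ⊝ q) (λ m → inj₁ (vanish m)) ⟩
  0ℤ ∎)
  where
  open ≡-Reasoning
  vanish : ∀ m → coeff (p ⊝ q) m ≡ 0ℤ
  vanish m rewrite coeff-⊕ p (-1ℤ · q) m | coeff-· -1ℤ q m | at h m | ℤP.-1*i≡-i (coeff q m) = ℤP.+-inverseʳ (coeff q m)

⊕-cong : ∀ {n} {p p′ q q′ : Poly n} → p ≋ p′ → q ≋ q′ → p ⊕ q ≋ p′ ⊕ q′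
⊕-cong {p = p} {p′} {q} {q′} h k = mk λ m →
  trans (coeff-⊕ p q m) (trans (cong₂ ℤ._+_ (at h m) (at k m)) (sym (coeff-⊕ p′ q′ m)))

·-cong : ∀ {n} c {p p′ : Poly n} → p ≋ p′ → c · p ≋ c · p′
·-cong c {p} {p′} h = mk λ m →
  trans (coeff-· c p m) (trans (cong (c ℤ.*_) (at h m)) (sym (coeff-· c p′ m)))

·-congˡ : ∀ {n} {c d} (p : Poly n) → c ≡ d → c · p ≋ d · p
·-congˡ p refl = ≋-refl

⊝-cong : ∀ {n} {p p′ q q′ : Poly n} → p ≋ p′ → q ≋ q′ → p ⊝ q ≋ p′ ⊝ q′
⊝-cong h k = ⊕-cong h (·-cong -1ℤ k)

coeff-⊝ : ∀ {n} (p q : Poly n) m → coeff (p ⊝ q) m ≡ coeff p m ℤ.- coeff q m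
coeff-⊝ p q m = trans (coeff-⊕ p (-1ℤ · q) m)
  (cong (ℤ._+_ (coeff p m)) (trans (coeff-· -1ℤ q m) (ℤP.-1*i≡-i (coeff q m))))

0· : ∀ {n} (p : Poly n) → 0ℤ · p ≋ []
0· p = mk λ m → coeff-· 0ℤ p m

1· : ∀ {n} (p : Poly n) → 1ℤ · p ≋ p
1· p = mk λ m → trans (coeff-· 1ℤ p m) (ℤP.*-identityˡ _)

·-assoc : ∀ {n} a b (p : Poly n) → a · (b · p) ≋ (a ℤ.* b) · p
·-assoc a b p = mk λ m → trans (coeff-· a (b · p) m)
  (trans (cong (a ℤ.*_) (coeff-· b p m)) (trans (sym (ℤP.*-assoc a b _)) (sym (coeff-· (a ℤ.* b) p m))))

⊕-identityʳ : ∀ {n} (p : Poly n) → p ⊕ [] ≋ p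
⊕-identityʳ p = mk λ m → trans (coeff-⊕ p [] m) (ℤP.+-identityʳ _)

⊕-comm : ∀ {n} (p q : Poly n) → p ⊕ q ≋ q ⊕ p
⊕-comm p q = mk λ m → trans (coeff-⊕ p q m) (trans (ℤP.+-comm (coeff p m) _) (sym (coeff-⊕ q p m)))

-- Linear operators, determined by their values on monomials

record Linear {n k} (F : Poly n → Poly k) : Set where
  field
    ≋-cong : ∀ {p q} → p ≋ q → F p ≋ F q
    ⊕-homo : ∀ p q → F (p ⊕ q) ≋ F p ⊕ F q
    ·-homo : ∀ c p → F (c · p) ≋ c · F p

  0-homo : F [] ≋ []
  0-homo = ≋-trans (·-homo 0ℤ []) (0· (F []))

  ⊝-homo : ∀ p q → F (p ⊝ q) ≋ F p ⊝ F q
  ⊝-homo p q = ≋-trans (⊕-homo p (-1ℤ · q)) (⊕-cong ≋-refl (·-homo -1ℤ q))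
open Linear

lin-linear : ∀ {n k} {F : Poly n → Poly k} (φ : Mono k → Mono n → ℤ) →
  (∀ p m → coeff (F p) m ≡ lin (φ m) p) → Linear F
lin-linear {F = F} φ h = record
  { ≋-cong = λ {p} {q} e → mk λ m → trans (h p m) (trans (lin-cong (φ m) e) (sym (h q m)))
  ; ⊕-homo = λ p q → mk λ m → trans (h (p ⊕ q) m) (trans (lin-++ (φ m) p q)
      (trans (cong₂ ℤ._+_ (sym (h p m)) (sym (h q m))) (sym (coeff-⊕ (F p) (F q) m))))
  ; ·-homo = λ c p → mk λ m → trans (h (c · p) m) (trans (lin-· (φ m) c p)
      (trans (cong (c ℤ.*_) (sym (h p m))) (sym (coeff-· c (F p) m))))
  }

id-linear : ∀ {n} → Linear {n} id
id-linear = record { ≋-cong = id ; ⊕-homo = λ _ _ → ≋-refl ; ·-homo = λ _ _ → ≋-refl }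

∘-linear : ∀ {n k l} {F : Poly k → Poly l} {G : Poly n → Poly k} → Linear F → Linear G → Linear (F ∘ G)
∘-linear f g = record
  { ≋-cong = λ e → ≋-cong f (≋-cong g e)
  ; ⊕-homo = λ p q → ≋-trans (≋-cong f (⊕-homo g p q)) (⊕-homo f _ _)
  ; ·-homo = λ c p → ≋-trans (≋-cong f (·-homo g c p)) (·-homo f c _)
  }

⊕-linear : ∀ {n k} {F G : Poly n → Poly k} → Linear F → Linear G → Linear (λ p → F p ⊕ G p)
⊕-linear {F = F} {G} f g = record
  { ≋-cong = λ e → ⊕-cong (≋-cong f e) (≋-cong g e)
  ; ⊕-homo = λ p q → ≋-trans (⊕-cong (⊕-homo f p q) (⊕-homo g p q)) (mk λ m → lemma m (F p) (F q) (G p) (G q))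
  ; ·-homo = λ c p → ≋-trans (⊕-cong (·-homo f c p) (·-homo g c p)) (mk λ m → lemma′ m c (F p) (G p))
  }
  where
  lemma : ∀ m a b c d → coeff ((a ⊕ b) ⊕ (c ⊕ d)) m ≡ coeff ((a ⊕ c) ⊕ (b ⊕ d)) m
  lemma m a b c d rewrite coeff-⊕ (a ⊕ b) (c ⊕ d) m | coeff-⊕ (a ⊕ c) (b ⊕ d) m | coeff-⊕ a b m | coeff-⊕ c d m
    | coeff-⊕ a c m | coeff-⊕ b d m = solve (coeff a m) (coeff b m) (coeff c m) (coeff d m)
    where
    solve : ∀ a b c d → (a ℤ.+ b) ℤ.+ (c ℤ.+ d) ≡ (a ℤ.+ c) ℤ.+ (b ℤ.+ d)
    solve = ℤSolver.solve-∀
  lemma′ : ∀ m c a b → coeff (c · a ⊕ c · b) m ≡ coeff (c · (a ⊕ b)) m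
  lemma′ m c a b rewrite coeff-⊕ (c · a) (c · b) m | coeff-· c (a ⊕ b) m | coeff-· c a m | coeff-· c b m | coeff-⊕ a b m
    = sym (ℤP.*-distribˡ-+ c (coeff a m) (coeff b m))

·-linear : ∀ {n} c → Linear {n} (c ·_)
·-linear c = record
  { ≋-cong = ·-cong c
  ; ⊕-homo = λ p q → mk λ m → trans (coeff-· c (p ⊕ q) m) (trans (cong (c ℤ.*_) (coeff-⊕ p q m))
      (trans (ℤP.*-distribˡ-+ c (coeff p m) (coeff q m))
      (trans (cong₂ ℤ._+_ (sym (coeff-· c p m)) (sym (coeff-· c q m))) (sym (coeff-⊕ (c · p) (c · q) m)))))
  ; ·-homo = λ d p → mk λ m → trans (coeff-· c (d · p) m) (trans (cong (c ℤ.*_) (coeff-· d p m))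
      (trans (lemma c d (coeff p m)) (trans (cong (d ℤ.*_) (sym (coeff-· c p m))) (sym (coeff-· d (c · p) m)))))
  }
  where
  lemma : ∀ c d x → c ℤ.* (d ℤ.* x) ≡ d ℤ.* (c ℤ.* x)
  lemma = ℤSolver.solve-∀

⊝-linear : ∀ {n k} {F G : Poly n → Poly k} → Linear F → Linear G → Linear (λ p → F p ⊝ G p)
⊝-linear f g = ⊕-linear f (∘-linear (·-linear -1ℤ) g)

linear-ext : ∀ {n k} {F G : Poly n → Poly k} → Linear F → Linear G →
  (∀ m → F (mono m) ≋ G (mono m)) → ∀ p → F p ≋ G p
linear-ext f g h []            = ≋-trans (0-homo f) (≋-sym (0-homo g))
linear-ext {F = F} {G} f g h ((c , m) ∷ p) = begin
  F ((c , m) ∷ p)              ≈⟨ ≋-cong f split ⟩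
  F (c · mono m ⊕ p)           ≈⟨ ⊕-homo f (c · mono m) p ⟩
  F (c · mono m) ⊕ F p         ≈⟨ ⊕-cong (·-homo f c (mono m)) (linear-ext f g h p) ⟩
  c · F (mono m) ⊕ G p         ≈⟨ ⊕-cong (·-cong c (h m)) ≋-refl ⟩
  c · G (mono m) ⊕ G p         ≈⟨ ⊕-cong (·-homo g c (mono m)) ≋-refl ⟨
  G (c · mono m) ⊕ G p         ≈⟨ ⊕-homo g (c · mono m) p ⟨
  G (c · mono m ⊕ p)           ≈⟨ ≋-cong g split ⟨
  G ((c , m) ∷ p) ∎
  where
  open ≋-Reasoning
  split : ∀ {c m p} → (c , m) ∷ p ≋ c · mono m ⊕ p
  split {c} {m} {p} = ≡⇒≋ (cong (λ a → (a , m) ∷ p) (sym (ℤP.*-identityʳ c)))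

mapM : ∀ {n k} → (Mono n → Mono k) → Poly n → Poly k
mapM g = map (λ { (c , m) → c , g m })

lin-mapM : ∀ {n k} φ (g : Mono n → Mono k) p → lin φ (mapM g p) ≡ lin (φ ∘ g) p
lin-mapM φ g []            = refl
lin-mapM φ g ((c , m) ∷ p) = cong (ℤ._+_ (c ℤ.* φ (g m))) (lin-mapM φ g p)

mapM-linear : ∀ {n k} (g : Mono n → Mono k) → Linear (mapM g)
mapM-linear g = lin-linear (λ m a → δ (g a) m) λ p m → trans (coeff-lin (mapM g p) m) (lin-mapM _ g p)

mapM-∘ : ∀ {n k l} (g : Mono k → Mono l) (h : Mono n → Mono k) p → mapM g (mapM h p) ≡ mapM (g ∘ h) p
mapM-∘ g h []      = refl
mapM-∘ g h (x ∷ p) = cong (_ ∷_) (mapM-∘ g h p)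

mapM-cong : ∀ {n k} {g h : Mono n → Mono k} → (∀ m → g m ≡ h m) → ∀ p → mapM g p ≡ mapM h p
mapM-cong e []            = refl
mapM-cong e ((c , m) ∷ p) = cong₂ (λ a b → (c , a) ∷ b) (e m) (mapM-cong e p)

mapM-· : ∀ {n k} (g : Mono n → Mono k) c p → mapM g (c · p) ≡ c · mapM g p
mapM-· g c []      = refl
mapM-· g c (x ∷ p) = cong (_ ∷_) (mapM-· g c p)

coeff-∂ : ∀ {n} i (p : Poly n) m → coeff (∂ i p) m ≡ lin (λ a → coeff (ddMono i a) m) p
coeff-∂ i []            m = refl
coeff-∂ i ((c , a) ∷ p) m = trans (coeff-⊕ (c · ddMono i a) (∂ i p) m)
  (cong₂ ℤ._+_ (coeff-· c (ddMono i a) m) (coeff-∂ i p m))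

∂-linear : ∀ {n} i → Linear {n} (∂ i)
∂-linear i = lin-linear _ (coeff-∂ i)

∂-mono : ∀ {n} i (m : Mono n) → ∂ i (mono m) ≋ ddMono i m
∂-mono i m = ≋-trans (⊕-identityʳ _) (1· (ddMono i m))

coeff-⊗ : ∀ {n} (p q : Poly n) m → coeff (p ⊗ q) m ≡ lin (λ a → lin (λ b → δ (Vec.zipWith ℕ._+_ a b) m) q) p
coeff-⊗ []            q m = refl
coeff-⊗ ((c , a) ∷ p) q m = trans (coeff-⊕ (map _ q) (p ⊗ q) m) (cong₂ ℤ._+_ (row (λ _ _ → refl) q) (coeff-⊗ p q m))
  where
  row : ∀ {f} → (∀ b m′ → f (b , m′) ≡ (c ℤ.* b , Vec.zipWith ℕ._+_ a m′)) → ∀ q →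
    coeff (map f q) m ≡ c ℤ.* lin (λ b → δ (Vec.zipWith ℕ._+_ a b) m) q
  row h []             = sym (ℤP.*-zeroʳ c)
  row {f} h ((b , m′) ∷ q) rewrite h b m′ = trans (coeff-∷ (c ℤ.* b) (Vec.zipWith ℕ._+_ a m′) (map f q) m)
    (trans (cong (ℤ._+_ (c ℤ.* b ℤ.* δ (Vec.zipWith ℕ._+_ a m′) m)) (row h q)) (lemma c b _ _))
    where
    lemma : ∀ c b x y → c ℤ.* b ℤ.* x ℤ.+ c ℤ.* y ≡ c ℤ.* (b ℤ.* x ℤ.+ y)
    lemma = ℤSolver.solve-∀

zipWith-+-comm : ∀ {n} (a b : Mono n) → Vec.zipWith ℕ._+_ a b ≡ Vec.zipWith ℕ._+_ b a
zipWith-+-comm []      []      = refl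
zipWith-+-comm (x ∷ a) (y ∷ b) = cong₂ _∷_ (ℕP.+-comm x y) (zipWith-+-comm a b)

⊗-comm : ∀ {n} (p q : Poly n) → p ⊗ q ≋ q ⊗ p
⊗-comm p q = mk λ m → trans (coeff-⊗ p q m) (trans (lin-swap _ p q)
  (trans (lin-cong-φ (λ b → lin-cong-φ (λ a → cong (λ v → δ v m) (zipWith-+-comm a b)) p) q) (sym (coeff-⊗ q p m))))

⊗-linearˡ : ∀ {n} (q : Poly n) → Linear (_⊗ q)
⊗-linearˡ q = lin-linear _ λ p m → coeff-⊗ p q m

⊗-linearʳ : ∀ {n} (p : Poly n) → Linear (p ⊗_)
⊗-linearʳ p = lin-linear _ λ q m → trans (coeff-⊗ p q m) (lin-swap _ p q)

-- Multiplication by a variable, and induction over it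

inc : ∀ {n} → ℕ → Mono n → Mono n
inc j       []      = []
inc zero    (a ∷ m) = suc a ∷ m
inc (suc j) (a ∷ m) = a ∷ inc j m

X : ∀ {n} → ℕ → Poly n → Poly n
X j = mapM (inc j)

X-linear : ∀ {n} j → Linear {n} (X j)
X-linear j = mapM-linear (inc j)

mono-ind : ∀ {n} (P : Mono n → Set) → P 𝟏 → (∀ j m → j < n → P m → P (inc j m)) → ∀ m → P m
mono-ind {zero}  P b s []      = b
mono-ind {suc n} P b s (a ∷ m) = powers a
  where
  powers : ∀ a → P (a ∷ m)
  powers zero    = mono-ind (P ∘ (0 ∷_)) b (λ j m j<n → s (suc j) (0 ∷ m) (s≤s j<n)) m
  powers (suc a) = s 0 (a ∷ m) (s≤s z≤n) (powers a)

-- Every monomial arises from 1 by multiplying with variables, so an identity of operators reduces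
-- to its value at 1 and to how both sides pass a variable. The relations between divided
-- differences are proved in this way.
linear-ind : ∀ {n k} {F G : Poly n → Poly k} → Linear F → Linear G → F (mono 𝟏) ≋ G (mono 𝟏) →
  (∀ j p → j < n → F p ≋ G p → F (X j p) ≋ G (X j p)) → ∀ p → F p ≋ G p
linear-ind f g b s = linear-ext f g (mono-ind _ b (λ j m → s j (mono m)))

zipWith-+-inc : ∀ {n} j (a b : Mono n) → Vec.zipWith ℕ._+_ (inc j a) b ≡ inc j (Vec.zipWith ℕ._+_ a b)
zipWith-+-inc j       []      []      = refl
zipWith-+-inc zero    (x ∷ a) (y ∷ b) = refl
zipWith-+-inc (suc j) (x ∷ a) (y ∷ b) = cong ((x ℕ.+ y) ∷_) (zipWith-+-inc j a b)

zipWith-+-𝟏 : ∀ {n} (a : Mono n) → Vec.zipWith ℕ._+_ 𝟏 a ≡ a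
zipWith-+-𝟏 []      = refl
zipWith-+-𝟏 (x ∷ a) = cong (x ∷_) (zipWith-+-𝟏 a)

X-⊗ : ∀ {n} j (p q : Poly n) → X j p ⊗ q ≋ X j (p ⊗ q)
X-⊗ j p q = linear-ext (∘-linear (⊗-linearˡ q) (X-linear j)) (∘-linear (X-linear j) (⊗-linearˡ q)) (λ m → ≡⇒≋ (row m q)) p
  where
  row : ∀ m q → mono (inc j m) ⊗ q ≡ X j (mono m ⊗ q)
  row m []            = refl
  row m ((c , a) ∷ q) = cong₂ _∷_ (cong ((1ℤ ℤ.* c) ,_) (zipWith-+-inc j m a)) (row m q)

1-⊗ : ∀ {n} (q : Poly n) → mono 𝟏 ⊗ q ≋ q
1-⊗ q = ≡⇒≋ (row q)
  where
  row : ∀ q → mono 𝟏 ⊗ q ≡ q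
  row []            = refl
  row ((c , a) ∷ q) = cong₂ _∷_ (cong₂ _,_ (ℤP.*-identityˡ c) (zipWith-+-𝟏 a)) (row q)

-- Commutativity and associativity in one identity. As operators in `p` both sides commute with
-- `X j`, and at `p` = 1 the identity is `⊗-comm`.
⊗-right-comm : ∀ {n} (p q r : Poly n) → (p ⊗ q) ⊗ r ≋ (p ⊗ r) ⊗ q
⊗-right-comm p q r = linear-ind
  (∘-linear (⊗-linearˡ r) (⊗-linearˡ q)) (∘-linear (⊗-linearˡ q) (⊗-linearˡ r))
  (begin
    (mono 𝟏 ⊗ q) ⊗ r ≈⟨ ≋-cong (⊗-linearˡ r) (1-⊗ q) ⟩
    q ⊗ r            ≈⟨ ⊗-comm q r ⟩
    r ⊗ q            ≈⟨ ≋-cong (⊗-linearˡ q) (1-⊗ r) ⟨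
    (mono 𝟏 ⊗ r) ⊗ q ∎)
  (λ j p _ ih → begin
    (X j p ⊗ q) ⊗ r   ≈⟨ pull j p q r ⟩
    X j ((p ⊗ q) ⊗ r) ≈⟨ ≋-cong (X-linear j) ih ⟩
    X j ((p ⊗ r) ⊗ q) ≈⟨ pull j p r q ⟨
    (X j p ⊗ r) ⊗ q   ∎) p
  where
  open ≋-Reasoning
  pull : ∀ j p q r → (X j p ⊗ q) ⊗ r ≋ X j ((p ⊗ q) ⊗ r)
  pull j p q r = ≋-trans (≋-cong (⊗-linearˡ r) (X-⊗ j p q)) (X-⊗ j (p ⊗ q) r)

-- Divided differences

σ : ℕ → ℕ → ℕ
σ zero    zero          = 1
σ zero    (suc zero)    = 0
σ zero    (suc (suc k)) = suc (suc k)
σ (suc i) zero          = zero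
σ (suc i) (suc k)       = suc (σ i k)

κ : ℕ → ℕ → ℤ
κ zero    zero          = 1ℤ
κ zero    (suc zero)    = -1ℤ
κ zero    (suc (suc k)) = 0ℤ
κ (suc i) zero          = 0ℤ
κ (suc i) (suc k)       = κ i k

-- The monomial x₁^p x₂^q x^r times the complete homogeneous polynomial of degree k - 1 in x₁ and
-- x₂.
geo : ∀ {n} → Mono n → ℕ → ℕ → ℕ → Poly (suc (suc n))
geo r zero    p q = []
geo r (suc k) p q = (1ℤ , p ∷ (q ℕ.+ k) ∷ r) ∷ geo r k (suc p) q

geo-X₀ : ∀ {n} (r : Mono n) k p q → geo r k (suc p) q ≡ X 0 (geo r k p q)
geo-X₀ r zero    p q = refl
geo-X₀ r (suc k) p q = cong₂ _∷_ refl (geo-X₀ r k (suc p) q)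

geo-X₁ : ∀ {n} (r : Mono n) k p q → geo r k p (suc q) ≡ X 1 (geo r k p q)
geo-X₁ r zero    p q = refl
geo-X₁ r (suc k) p q = cong₂ _∷_ refl (geo-X₁ r k (suc p) q)

geo-suc₀ : ∀ {n} (r : Mono n) k p q → geo r (suc k) p q ≋ mono (p ∷ q ℕ.+ k ∷ r) ⊕ X 0 (geo r k p q)
geo-suc₀ r k p q = ≡⇒≋ (cong₂ _∷_ refl (geo-X₀ r k p q))

⊕-left-comm : ∀ {n} (p q r : Poly n) → p ⊕ (q ⊕ r) ≋ q ⊕ (p ⊕ r)
⊕-left-comm p q r = mk λ m → lemma m
  where
  solve : ∀ a b c → a ℤ.+ (b ℤ.+ c) ≡ b ℤ.+ (a ℤ.+ c)
  solve = ℤSolver.solve-∀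
  lemma : ∀ m → coeff (p ⊕ (q ⊕ r)) m ≡ coeff (q ⊕ (p ⊕ r)) m
  lemma m rewrite coeff-⊕ p (q ⊕ r) m | coeff-⊕ q r m | coeff-⊕ q (p ⊕ r) m | coeff-⊕ p r m =
    solve (coeff p m) (coeff q m) (coeff r m)

-- The recursion of `geo` splits off the term of least degree in x₁; this splits off the one at the
-- other end, so that what remains is a multiple of x₂ instead of x₁.
geo-suc₁ : ∀ {n} (r : Mono n) k p q → geo r (suc k) p q ≋ mono (p ℕ.+ k ∷ q ∷ r) ⊕ X 1 (geo r k p q)
geo-suc₁ r zero    p q rewrite ℕP.+-identityʳ p | ℕP.+-identityʳ q = ≋-refl
geo-suc₁ r (suc k) p q rewrite ℕP.+-suc p k | ℕP.+-suc q k =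
  ≋-trans (⊕-cong {p = mono _} ≋-refl (geo-suc₁ r k (suc p) q))
          (⊕-left-comm (mono (p ∷ suc (q ℕ.+ k) ∷ r)) (mono (suc (p ℕ.+ k) ∷ q ∷ r)) (X 1 (geo r k (suc p) q)))

geo-applyUpTo : ∀ {n} (r : Mono n) s k p q (f : ℕ → ℤ × Mono (suc (suc n))) →
  (∀ j → j < k → f j ≡ (s ℤ.* 1ℤ , (p ℕ.+ j) ∷ (q ℕ.+ (k ∸ suc j)) ∷ r)) → applyUpTo f k ≡ s · geo r k p q
geo-applyUpTo r s zero    p q f h = refl
geo-applyUpTo r s (suc k) p q f h = cong₂ _∷_
  (trans (h 0 (s≤s z≤n)) (cong (λ a → s ℤ.* 1ℤ , a ∷ (q ℕ.+ k) ∷ r) (ℕP.+-identityʳ p)))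
  (geo-applyUpTo r s k (suc p) q (f ∘ suc)
    (λ j j<k → trans (h (suc j) (s≤s j<k)) (cong (λ a → s ℤ.* 1ℤ , a ∷ (q ℕ.+ (k ∸ suc j)) ∷ r) (ℕP.+-suc p j))))

private
  dd-exponent : ∀ b k j → j < k → (b ℕ.+ k) ∸ 1 ∸ j ≡ b ℕ.+ (k ∸ suc j)
  dd-exponent b k j j<k = trans (ℕP.∸-+-assoc (b ℕ.+ k) 1 j) (ℕP.+-∸-assoc b j<k)

  dd-half : ∀ {n} (r : Mono n) s b k → map (λ j → (s ℤ.* 1ℤ , (b ℕ.+ j) ∷ (b ℕ.+ k ∸ 1 ∸ j) ∷ r)) (upTo k) ≡ s · geo r k b b
  dd-half r s b k = trans (LP.map-applyUpTo id _ k)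
    (geo-applyUpTo r s k b b _ (λ j j<k → cong (λ a → s ℤ.* 1ℤ , (b ℕ.+ j) ∷ a ∷ r) (dd-exponent b k j j<k)))

ddMono-≥ : ∀ {n} (r : Mono n) b k → ddMono 0 (b ℕ.+ k ∷ b ∷ r) ≋ geo r k b b
ddMono-≥ r b k rewrite ℕP.m+n∸m≡n b k | ℕP.m≤n⇒m∸n≡0 (ℕP.m≤m+n b k) =
  ≋-trans (⊕-identityʳ _) (≋-trans (≡⇒≋ (dd-half r 1ℤ b k)) (1· _))

ddMono-≤ : ∀ {n} (r : Mono n) a k → ddMono 0 (a ∷ a ℕ.+ k ∷ r) ≋ -1ℤ · geo r k a a
ddMono-≤ r a k rewrite ℕP.m+n∸m≡n a k | ℕP.m≤n⇒m∸n≡0 (ℕP.m≤m+n a k) = ≡⇒≋ (dd-half r -1ℤ a k)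

ddMono-suc : ∀ {n} i a (m : Mono n) → ddMono (suc i) (a ∷ m) ≡ mapM (a ∷_) (ddMono i m)
ddMono-suc i a m = LP.map-cong (λ _ → refl) (ddMono i m)

-- Writing the larger exponent as the smaller one plus a difference lets the truncated subtractions
-- in `ddMono` compute.
data Cmp : ℕ → ℕ → Set where
  ge : ∀ b k → Cmp (b ℕ.+ k) b
  lt : ∀ a k → Cmp a (suc a ℕ.+ k)

cmp : ∀ a b → Cmp a b
cmp a b with ℕP.≤-<-connex b a
... | inj₁ b≤a with ℕP.m≤n⇒∃[o]m+o≡n b≤a
...   | k , refl = ge b k
cmp a b | inj₂ a<b with ℕP.m≤n⇒∃[o]m+o≡n a<b
...   | k , refl = lt a k

private
  cancelˡ : ∀ {n} s (p q : Poly n) → q ≋ s · p ⊕ (ℤ.- s · p ⊕ q)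
  cancelˡ s p q = mk λ m → lemma m
    where
    solve : ∀ s a b → b ≡ s ℤ.* a ℤ.+ (ℤ.- s ℤ.* a ℤ.+ b)
    solve = ℤSolver.solve-∀
    lemma : ∀ m → coeff q m ≡ coeff (s · p ⊕ (ℤ.- s · p ⊕ q)) m
    lemma m rewrite coeff-⊕ (s · p) (ℤ.- s · p ⊕ q) m | coeff-⊕ (ℤ.- s · p) q m | coeff-· s p m | coeff-· (ℤ.- s) p m
      = solve s (coeff p m) (coeff q m)

  rule₀₀ : ∀ {n} a b (r : Mono n) → ddMono 0 (suc a ∷ b ∷ r) ≋ 1ℤ · mono (a ∷ b ∷ r) ⊕ X 1 (ddMono 0 (a ∷ b ∷ r))
  rule₀₀ a b r with cmp a b
  ... | ge b k = begin
    ddMono 0 (suc (b ℕ.+ k) ∷ b ∷ r)               ≡⟨ cong (λ c → ddMono 0 (c ∷ b ∷ r)) (sym (ℕP.+-suc b k)) ⟩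
    ddMono 0 (b ℕ.+ suc k ∷ b ∷ r)                 ≈⟨ ddMono-≥ r b (suc k) ⟩
    geo r (suc k) b b                              ≈⟨ geo-suc₁ r k b b ⟩
    mono (b ℕ.+ k ∷ b ∷ r) ⊕ X 1 (geo r k b b)
      ≈⟨ ⊕-cong (≋-sym (1· _)) (≋-cong (X-linear 1) (≋-sym (ddMono-≥ r b k))) ⟩
    1ℤ · mono (b ℕ.+ k ∷ b ∷ r) ⊕ X 1 (ddMono 0 (b ℕ.+ k ∷ b ∷ r)) ∎
    where open ≋-Reasoning
  ... | lt a k = begin
    ddMono 0 (suc a ∷ suc a ℕ.+ k ∷ r)             ≈⟨ ddMono-≤ r (suc a) k ⟩
    -- `top` is x₂ times the first term of `geo r (suc k) a a`; adding and subtracting it completes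
    -- the shorter sum to that one.
    -1ℤ · geo r k (suc a) (suc a)                  ≈⟨ cancelˡ 1ℤ (mono top) _ ⟩
    1ℤ · mono top ⊕ (-1ℤ · mono top ⊕ -1ℤ · geo r k (suc a) (suc a))
      ≡⟨ cong (λ g → 1ℤ · mono top ⊕ (-1ℤ · mono top ⊕ -1ℤ · g)) (geo-X₁ r k (suc a) a) ⟩
    1ℤ · mono top ⊕ X 1 (-1ℤ · mono (a ∷ a ℕ.+ k ∷ r)) ⊕ -1ℤ · X 1 (geo r k (suc a) a)
      ≡⟨ cong (λ g → 1ℤ · mono top ⊕ X 1 (-1ℤ · mono (a ∷ a ℕ.+ k ∷ r)) ⊕ g) (sym (mapM-· (inc 1) -1ℤ (geo r k (suc a) a))) ⟩
    1ℤ · mono top ⊕ X 1 (-1ℤ · geo r (suc k) a a)  ≈⟨ ⊕-cong {p = 1ℤ · mono top} ≋-refl (≋-cong (X-linear 1) same) ⟩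
    1ℤ · mono top ⊕ X 1 (ddMono 0 (a ∷ suc a ℕ.+ k ∷ r)) ∎
    where
    open ≋-Reasoning
    top = a ∷ suc a ℕ.+ k ∷ r
    same : -1ℤ · geo r (suc k) a a ≋ ddMono 0 (a ∷ suc a ℕ.+ k ∷ r)
    same = ≋-trans (≋-sym (ddMono-≤ r a (suc k))) (≡⇒≋ (cong (λ c → ddMono 0 (a ∷ c ∷ r)) (ℕP.+-suc a k)))

  rule₀₁ : ∀ {n} a b (r : Mono n) → ddMono 0 (a ∷ suc b ∷ r) ≋ -1ℤ · mono (a ∷ b ∷ r) ⊕ X 0 (ddMono 0 (a ∷ b ∷ r))
  rule₀₁ a b r with ℕP.≤-<-connex a b
  ... | inj₁ a≤b with ℕP.m≤n⇒∃[o]m+o≡n a≤b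
  ...   | k , refl = begin
    ddMono 0 (a ∷ suc (a ℕ.+ k) ∷ r)               ≡⟨ cong (λ c → ddMono 0 (a ∷ c ∷ r)) (sym (ℕP.+-suc a k)) ⟩
    ddMono 0 (a ∷ a ℕ.+ suc k ∷ r)                 ≈⟨ ddMono-≤ r a (suc k) ⟩
    -1ℤ · geo r (suc k) a a
      ≡⟨ cong (λ g → -1ℤ · mono (a ∷ a ℕ.+ k ∷ r) ⊕ -1ℤ · g) (geo-X₀ r k a a) ⟩
    -1ℤ · mono (a ∷ a ℕ.+ k ∷ r) ⊕ -1ℤ · X 0 (geo r k a a)
      ≡⟨ cong (-1ℤ · mono (a ∷ a ℕ.+ k ∷ r) ⊕_) (sym (mapM-· (inc 0) -1ℤ (geo r k a a))) ⟩
    -1ℤ · mono (a ∷ a ℕ.+ k ∷ r) ⊕ X 0 (-1ℤ · geo r k a a)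
      ≈⟨ ⊕-cong {p = -1ℤ · mono (a ∷ a ℕ.+ k ∷ r)} ≋-refl (≋-cong (X-linear 0) (≋-sym (ddMono-≤ r a k))) ⟩
    -1ℤ · mono (a ∷ a ℕ.+ k ∷ r) ⊕ X 0 (ddMono 0 (a ∷ a ℕ.+ k ∷ r)) ∎
    where open ≋-Reasoning
  rule₀₁ a b r | inj₂ b<a with ℕP.m≤n⇒∃[o]m+o≡n b<a
  ...   | k , refl = begin
    ddMono 0 (suc b ℕ.+ k ∷ suc b ∷ r)             ≈⟨ ddMono-≥ r (suc b) k ⟩
    geo r k (suc b) (suc b)                        ≡⟨ geo-X₀ r k b (suc b) ⟩
    X 0 (geo r k b (suc b))                        ≡⟨ cong (X 0) (geo-X₁ r k b b) ⟩
    X 0 (X 1 (geo r k b b))                        ≈⟨ cancelˡ -1ℤ (mono top) _ ⟩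
    -1ℤ · mono top ⊕ (1ℤ · mono top ⊕ X 0 (X 1 (geo r k b b)))
      ≈⟨ ⊕-cong {p = -1ℤ · mono top} ≋-refl (≋-cong (X-linear 0) (≋-sym (geo-suc₁ r k b b))) ⟩
    -1ℤ · mono top ⊕ X 0 (geo r (suc k) b b)       ≈⟨ ⊕-cong {p = -1ℤ · mono top} ≋-refl (≋-cong (X-linear 0) same) ⟩
    -1ℤ · mono top ⊕ X 0 (ddMono 0 (suc b ℕ.+ k ∷ b ∷ r)) ∎
    where
    open ≋-Reasoning
    top = suc b ℕ.+ k ∷ b ∷ r
    same : geo r (suc k) b b ≋ ddMono 0 (suc b ℕ.+ k ∷ b ∷ r)
    same = ≋-trans (≋-sym (ddMono-≥ r b (suc k))) (≡⇒≋ (cong (λ c → ddMono 0 (c ∷ b ∷ r)) (ℕP.+-suc b k)))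

  0·⊕ : ∀ {n} (p : Poly n) {q q′ : Poly n} → q ≋ q′ → q ≋ 0ℤ · p ⊕ q′
  0·⊕ p h = ≋-trans h (⊕-cong (≋-sym (0· p)) ≋-refl)

  rule₀₂ : ∀ {n} k a b (r : Mono n) → ddMono 0 (a ∷ b ∷ inc k r) ≡ X (suc (suc k)) (ddMono 0 (a ∷ b ∷ r))
  rule₀₂ k a b r = sym (trans (LP.map-++ _ (map _ (upTo (a ∸ b))) (map _ (upTo (b ∸ a))))
    (cong₂ _++_ (sym (LP.map-∘ (upTo (a ∸ b)))) (sym (LP.map-∘ (upTo (b ∸ a))))))

  dd-rule : ∀ {n} i → suc i < n → ∀ k (m : Mono n) → ddMono i (inc k m) ≋ κ i k · mono m ⊕ X (σ i k) (ddMono i m)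
  dd-rule zero (s≤s (s≤s _)) zero          (a ∷ b ∷ r) = rule₀₀ a b r
  dd-rule zero (s≤s (s≤s _)) (suc zero)    (a ∷ b ∷ r) = rule₀₁ a b r
  dd-rule zero (s≤s (s≤s _)) (suc (suc k)) (a ∷ b ∷ r) = 0·⊕ (mono (a ∷ b ∷ r)) (≡⇒≋ (rule₀₂ k a b r))
  dd-rule (suc i) (s≤s _) zero (a ∷ m) = 0·⊕ (mono (a ∷ m)) (≡⇒≋ (begin
    ddMono (suc i) (suc a ∷ m)            ≡⟨ ddMono-suc i (suc a) m ⟩
    mapM (suc a ∷_) (ddMono i m)          ≡⟨ mapM-∘ (inc 0) (a ∷_) (ddMono i m) ⟨
    X 0 (mapM (a ∷_) (ddMono i m))        ≡⟨ cong (X 0) (ddMono-suc i a m) ⟨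
    X 0 (ddMono (suc i) (a ∷ m)) ∎))
    where open ≡-Reasoning
  dd-rule (suc i) (s≤s i<n) (suc k) (a ∷ m) = begin
    ddMono (suc i) (a ∷ inc k m)                                              ≡⟨ ddMono-suc i a (inc k m) ⟩
    mapM (a ∷_) (ddMono i (inc k m))
      ≈⟨ ≋-cong (mapM-linear (a ∷_)) (dd-rule i i<n k m) ⟩
    mapM (a ∷_) (κ i k · mono m ⊕ X (σ i k) (ddMono i m))
      ≡⟨ cong ((κ i k · mono (a ∷ m)) ⊕_) (trans (mapM-∘ (a ∷_) (inc (σ i k)) (ddMono i m))
           (sym (mapM-∘ (inc (suc (σ i k))) (a ∷_) (ddMono i m)))) ⟩
    κ i k · mono (a ∷ m) ⊕ X (suc (σ i k)) (mapM (a ∷_) (ddMono i m))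
      ≡⟨ cong (λ g → κ i k · mono (a ∷ m) ⊕ X (suc (σ i k)) g) (ddMono-suc i a m) ⟨
    κ i k · mono (a ∷ m) ⊕ X (suc (σ i k)) (ddMono (suc i) (a ∷ m)) ∎
    where open ≋-Reasoning

-- The nilHecke relations in a uniform shape: κ i k is ∂ᵢ x_k and σ i is the transposition sᵢ.
∂-X : ∀ {n} i → suc i < n → ∀ k (p : Poly n) → ∂ i (X k p) ≋ κ i k · p ⊕ X (σ i k) (∂ i p)
∂-X i i<n k = linear-ext (∘-linear (∂-linear i) (X-linear k))
  (⊕-linear (·-linear (κ i k)) (∘-linear (X-linear (σ i k)) (∂-linear i)))
  λ m → ≋-trans (∂-mono i (inc k m)) (≋-trans (dd-rule i i<n k m)
    (⊕-cong {p = κ i k · mono m} ≋-refl (≋-cong (X-linear (σ i k)) (≋-sym (∂-mono i m)))))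

σ-involutive : ∀ i k → σ i (σ i k) ≡ k
σ-involutive zero    zero          = refl
σ-involutive zero    (suc zero)    = refl
σ-involutive zero    (suc (suc k)) = refl
σ-involutive (suc i) zero          = refl
σ-involutive (suc i) (suc k)       = cong suc (σ-involutive i k)

κ-σ : ∀ i k → κ i (σ i k) ≡ ℤ.- κ i k
κ-σ zero    zero          = refl
κ-σ zero    (suc zero)    = refl
κ-σ zero    (suc (suc k)) = refl
κ-σ (suc i) zero          = refl
κ-σ (suc i) (suc k)       = κ-σ i k

σ-< : ∀ {n} i k → suc i < n → k < n → σ i k < n
σ-< zero    zero          h       _       = h
σ-< zero    (suc zero)    (s≤s h) _       = s≤s z≤n
σ-< zero    (suc (suc k)) _       h       = h
σ-< (suc i) zero          _       h       = h
σ-< (suc i) (suc k)       (s≤s h) (s≤s l) = s≤s (σ-< i k h l)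

ddMono-out : ∀ {n} i (m : Mono n) → ¬ suc i < n → ddMono i m ≡ []
ddMono-out zero    []          _ = refl
ddMono-out zero    (a ∷ [])    _ = refl
ddMono-out zero    (a ∷ b ∷ m) h = ⊥-elim (h (s≤s (s≤s z≤n)))
ddMono-out (suc i) []          _ = refl
ddMono-out (suc i) (a ∷ m)     h = cong (map _) (ddMono-out i m (h ∘ s≤s))

∂-out : ∀ {n} i (p : Poly n) → ¬ suc i < n → ∂ i p ≡ []
∂-out i []            h = refl
∂-out i ((c , m) ∷ p) h rewrite ddMono-out i m h = ∂-out i p h

-- Such a monomial is invariant under sᵢ. Hence ∂ᵢ kills it, and takes its product with x_i back to
-- it; every explicit value of a divided difference on a dominant monomial comes from this.
data Level : ∀ {n} → ℕ → Mono n → Set where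
  here  : ∀ {n a} {r : Mono n} → Level 0 (a ∷ a ∷ r)
  there : ∀ {n i a} {m : Mono n} → Level i m → Level (suc i) (a ∷ m)

∂-level : ∀ {n i} {m : Mono n} → Level i m → ∂ i (mono m) ≋ []
∂-level {i = i} {m} l = ≋-trans (∂-mono i m) (≡⇒≋ (dd l))
  where
  dd : ∀ {n i} {m : Mono n} → Level i m → ddMono i m ≡ []
  dd (here {a = a}) rewrite ℕP.n∸n≡0 a = refl
  dd (there l) = cong (map _) (dd l)

∂-X-level : ∀ {n i} {m : Mono n} → suc i < n → Level i m → ∂ i (mono (inc i m)) ≋ mono m
∂-X-level {i = i} {m} i<n l = begin
  ∂ i (X i (mono m))                           ≈⟨ ∂-X i i<n i (mono m) ⟩
  κ i i · mono m ⊕ X (σ i i) (∂ i (mono m))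
    ≈⟨ ⊕-cong {p = κ i i · mono m} (·-congˡ (mono m) (κ-diag i)) (≋-cong (X-linear (σ i i)) (∂-level l)) ⟩
  1ℤ · mono m ⊕ X (σ i i) []                   ≈⟨ ⊕-identityʳ _ ⟩
  1ℤ · mono m                                  ≈⟨ 1· _ ⟩
  mono m ∎
  where
  open ≋-Reasoning
  κ-diag : ∀ i → κ i i ≡ 1ℤ
  κ-diag zero    = refl
  κ-diag (suc i) = κ-diag i

Level-𝟏 : ∀ {n} i → suc i < n → Level {n} i 𝟏
Level-𝟏 zero    (s≤s (s≤s _)) = here
Level-𝟏 (suc i) (s≤s h)       = there (Level-𝟏 i h)

∂-1 : ∀ {n} i → ∂ i (mono {n} 𝟏) ≋ []
∂-1 {n} i with suc i ℕP.<? n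
... | yes h = ∂-level (Level-𝟏 i h)
... | no  h = ≡⇒≋ (∂-out i (mono 𝟏) h)

X-≡ : ∀ {n} {j k} (p : Poly n) → j ≡ k → X j p ≋ X k p
X-≡ p refl = ≋-refl

X-zero : ∀ {n} j {p : Poly n} → p ≋ [] → X j p ≋ []
X-zero j = ≋-cong (X-linear j)

-- The condition ∂ᵢg = 0 says that g is symmetric in the two variables, so the Leibniz rule has one
-- term only. Induction over multiplication by variables on the left factor expresses this through
-- `X` and `∂` alone.
∂-⊗ : ∀ {n} i {g : Poly n} → ∂ i g ≋ [] → ∀ p → ∂ i (p ⊗ g) ≋ ∂ i p ⊗ g
∂-⊗ {n} i {g} ∂g p with suc i ℕP.<? n
... | no  h = ≋-trans (≡⇒≋ (∂-out i (p ⊗ g) h)) (≡⇒≋ (sym (cong (_⊗ g) (∂-out i p h))))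
... | yes h = linear-ind (∘-linear (∂-linear i) (⊗-linearˡ g)) (∘-linear (⊗-linearˡ g) (∂-linear i))
  (begin
    ∂ i (mono 𝟏 ⊗ g)  ≈⟨ ≋-cong (∂-linear i) (1-⊗ g) ⟩
    ∂ i g             ≈⟨ ∂g ⟩
    []                ≈⟨ ≋-cong (⊗-linearˡ g) (∂-1 i) ⟨
    ∂ i (mono 𝟏) ⊗ g  ∎)
  (λ k p _ ih → begin
    ∂ i (X k p ⊗ g)                               ≈⟨ ≋-cong (∂-linear i) (X-⊗ k p g) ⟩
    ∂ i (X k (p ⊗ g))                             ≈⟨ ∂-X i h k (p ⊗ g) ⟩
    κ i k · (p ⊗ g) ⊕ X (σ i k) (∂ i (p ⊗ g))     ≈⟨ ⊕-cong (≋-sym (·-homo (⊗-linearˡ g) (κ i k) p))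
                                                       (≋-trans (≋-cong (X-linear (σ i k)) ih) (≋-sym (X-⊗ (σ i k) (∂ i p) g))) ⟩
    (κ i k · p) ⊗ g ⊕ X (σ i k) (∂ i p) ⊗ g       ≈⟨ ⊕-homo (⊗-linearˡ g) (κ i k · p) (X (σ i k) (∂ i p)) ⟨
    (κ i k · p ⊕ X (σ i k) (∂ i p)) ⊗ g           ≈⟨ ≋-cong (⊗-linearˡ g) (∂-X i h k p) ⟨
    ∂ i (X k p) ⊗ g                               ∎) p
  where open ≋-Reasoning

-- Passing x_k through both operators produces κ ∂ᵢp twice, with opposite signs by `κ-σ`.
∂-∂ : ∀ {n} i (p : Poly n) → ∂ i (∂ i p) ≋ []
∂-∂ {n} i p with suc i ℕP.<? n
... | no  h = ≡⇒≋ (∂-out i (∂ i p) h)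
... | yes h = linear-ind (∘-linear (∂-linear i) (∂-linear i)) zero-linear (≋-cong (∂-linear i) (∂-1 i))
  (λ k p _ ih → begin
    ∂ i (∂ i (X k p))                                          ≈⟨ ≋-cong (∂-linear i) (∂-X i h k p) ⟩
    ∂ i (κ i k · p ⊕ X (σ i k) (∂ i p))                        ≈⟨ ⊕-homo (∂-linear i) (κ i k · p) _ ⟩
    ∂ i (κ i k · p) ⊕ ∂ i (X (σ i k) (∂ i p))
      ≈⟨ ⊕-cong (·-homo (∂-linear i) (κ i k) p) (∂-X i h (σ i k) (∂ i p)) ⟩
    κ i k · ∂ i p ⊕ (κ i (σ i k) · ∂ i p ⊕ X (σ i (σ i k)) (∂ i (∂ i p)))
      ≈⟨ ⊕-cong {p = κ i k · ∂ i p} ≋-refl (⊕-cong (·-congˡ (∂ i p) (κ-σ i k)) (X-zero (σ i (σ i k)) ih)) ⟩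
    κ i k · ∂ i p ⊕ (ℤ.- κ i k · ∂ i p ⊕ [])                   ≈⟨ cancelˡ (κ i k) (∂ i p) [] ⟨
    []                                                         ∎) p
  where
  open ≋-Reasoning
  zero-linear : ∀ {n k} → Linear {n} {k} (λ _ → [])
  zero-linear = record { ≋-cong = λ _ → ≋-refl ; ⊕-homo = λ _ _ → ≋-refl ; ·-homo = λ _ _ → ≋-refl }

private
  ∂₂-X : ∀ {n} i j → suc i < n → suc j < n → ∀ k (p : Poly n) →
    ∂ i (∂ j (X k p)) ≋ κ j k · ∂ i p ⊕ (κ i (σ j k) · ∂ j p ⊕ X (σ i (σ j k)) (∂ i (∂ j p)))
  ∂₂-X i j hi hj k p = begin
    ∂ i (∂ j (X k p))                            ≈⟨ ≋-cong (∂-linear i) (∂-X j hj k p) ⟩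
    ∂ i (κ j k · p ⊕ X (σ j k) (∂ j p))          ≈⟨ ⊕-homo (∂-linear i) (κ j k · p) _ ⟩
    ∂ i (κ j k · p) ⊕ ∂ i (X (σ j k) (∂ j p))
      ≈⟨ ⊕-cong (·-homo (∂-linear i) (κ j k) p) (∂-X i hi (σ j k) (∂ j p)) ⟩
    κ j k · ∂ i p ⊕ (κ i (σ j k) · ∂ j p ⊕ X (σ i (σ j k)) (∂ i (∂ j p))) ∎
    where open ≋-Reasoning

  -- Three operators would give three correction terms; the middle one contains ∂ᵢ∂ᵢ and vanishes,
  -- which leaves a shape that the two sides of the braid relation can share.
  ∂₃-X : ∀ {n} i j → suc i < n → suc j < n → ∀ k (p : Poly n) →
    ∂ i (∂ j (∂ i (X k p))) ≋
      κ i k · ∂ i (∂ j p) ⊕ (κ i (σ j (σ i k)) · ∂ j (∂ i p) ⊕ X (σ i (σ j (σ i k))) (∂ i (∂ j (∂ i p))))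
  ∂₃-X i j hi hj k p = begin
    ∂ i (∂ j (∂ i (X k p)))
      ≈⟨ ≋-cong (∂-linear i) (∂₂-X j i hj hi k p) ⟩
    ∂ i (κ i k · ∂ j p ⊕ (κ j (σ i k) · ∂ i p ⊕ X l (∂ j (∂ i p))))
      ≈⟨ ≋-trans (⊕-homo (∂-linear i) (κ i k · ∂ j p) _)
           (⊕-cong (·-homo (∂-linear i) (κ i k) (∂ j p)) (⊕-homo (∂-linear i) (κ j (σ i k) · ∂ i p) _)) ⟩
    κ i k · ∂ i (∂ j p) ⊕ (∂ i (κ j (σ i k) · ∂ i p) ⊕ ∂ i (X l (∂ j (∂ i p))))
      ≈⟨ ⊕-cong {p = κ i k · ∂ i (∂ j p)} ≋-refl (⊕-cong
           (≋-trans (·-homo (∂-linear i) (κ j (σ i k)) (∂ i p)) (·-cong (κ j (σ i k)) (∂-∂ i p)))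
           (∂-X i hi l (∂ j (∂ i p)))) ⟩
    κ i k · ∂ i (∂ j p) ⊕ (κ i l · ∂ j (∂ i p) ⊕ X (σ i l) (∂ i (∂ j (∂ i p)))) ∎
    where
    open ≋-Reasoning
    l = σ j (σ i k)

  σ-comm : ∀ i d k → let j = suc (suc (i ℕ.+ d)) in σ i (σ j k) ≡ σ j (σ i k)
  σ-comm zero    d zero          = refl
  σ-comm zero    d (suc zero)    = refl
  σ-comm zero    d (suc (suc k)) = refl
  σ-comm (suc i) d zero          = refl
  σ-comm (suc i) d (suc k)       = cong suc (σ-comm i d k)

  κ-comm₁ : ∀ i d k → let j = suc (suc (i ℕ.+ d)) in κ i (σ j k) ≡ κ i k
  κ-comm₁ zero    d zero          = refl
  κ-comm₁ zero    d (suc zero)    = refl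
  κ-comm₁ zero    d (suc (suc k)) = refl
  κ-comm₁ (suc i) d zero          = refl
  κ-comm₁ (suc i) d (suc k)       = κ-comm₁ i d k

  κ-comm₂ : ∀ i d k → let j = suc (suc (i ℕ.+ d)) in κ j (σ i k) ≡ κ j k
  κ-comm₂ zero    d zero          = refl
  κ-comm₂ zero    d (suc zero)    = refl
  κ-comm₂ zero    d (suc (suc k)) = refl
  κ-comm₂ (suc i) d zero          = refl
  κ-comm₂ (suc i) d (suc k)       = κ-comm₂ i d k

  σ-braid : ∀ i k → σ i (σ (suc i) (σ i k)) ≡ σ (suc i) (σ i (σ (suc i) k))
  σ-braid zero    zero                = refl
  σ-braid zero    (suc zero)          = refl
  σ-braid zero    (suc (suc zero))    = refl
  σ-braid zero    (suc (suc (suc k))) = refl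
  σ-braid (suc i) zero                = refl
  σ-braid (suc i) (suc k)             = cong suc (σ-braid i k)

  κ-braid₁ : ∀ i k → κ (suc i) (σ i (σ (suc i) k)) ≡ κ i k
  κ-braid₁ zero    zero                = refl
  κ-braid₁ zero    (suc zero)          = refl
  κ-braid₁ zero    (suc (suc zero))    = refl
  κ-braid₁ zero    (suc (suc (suc k))) = refl
  κ-braid₁ (suc i) zero                = refl
  κ-braid₁ (suc i) (suc k)             = κ-braid₁ i k

  κ-braid₂ : ∀ i k → κ i (σ (suc i) (σ i k)) ≡ κ (suc i) k
  κ-braid₂ zero    zero                = refl
  κ-braid₂ zero    (suc zero)          = refl
  κ-braid₂ zero    (suc (suc zero))    = refl
  κ-braid₂ zero    (suc (suc (suc k))) = refl
  κ-braid₂ (suc i) zero                = refl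
  κ-braid₂ (suc i) (suc k)             = κ-braid₂ i k

  swap-terms : ∀ {n} {a a′ b b′ : ℤ} {c c′ : ℕ} {p q r r′ : Poly n} → a ≡ a′ → b ≡ b′ → c ≡ c′ → r ≋ r′ →
    a · p ⊕ (b · q ⊕ X c r) ≋ b′ · q ⊕ (a′ · p ⊕ X c′ r′)
  swap-terms {a = a} {b = b} {c = c} {p = p} {q} {r} refl refl refl h =
    ≋-trans (⊕-left-comm (a · p) (b · q) (X c r)) (⊕-cong {p = b · q} ≋-refl (⊕-cong {p = a · p} ≋-refl (≋-cong (X-linear c) h)))

∂-comm : ∀ {n} i d → let j = suc (suc (i ℕ.+ d)) in suc j < n → ∀ (p : Poly n) → ∂ i (∂ j p) ≋ ∂ j (∂ i p)
∂-comm {n} i d hj = linear-ind (∘-linear (∂-linear i) (∂-linear j)) (∘-linear (∂-linear j) (∂-linear i))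
  (≋-trans (≋-cong (∂-linear i) (∂-1 j)) (≋-sym (≋-cong (∂-linear j) (∂-1 i))))
  (λ k p _ ih → ≋-trans (∂₂-X i j hi hj k p) (≋-trans
    (swap-terms {p = ∂ i p} {∂ j p} (sym (κ-comm₂ i d k)) (κ-comm₁ i d k) (σ-comm i d k) ih)
    (≋-sym (∂₂-X j i hj hi k p))))
  where
  j = suc (suc (i ℕ.+ d))
  hi : suc i < n
  hi = ℕP.≤-<-trans (s≤s (ℕP.≤-trans (ℕP.m≤m+n i d) (ℕP.≤-trans (ℕP.n≤1+n _) (ℕP.n≤1+n _)))) hj

-- Both sides kill 1. When x_k is passed through, it ends up as the same variable by `σ-braid`, and
-- the two correction terms of one side are those of the other in exchanged order by `κ-braid₁` and
-- `κ-braid₂`.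
∂-braid : ∀ {n} i → suc (suc i) < n → ∀ (p : Poly n) → ∂ i (∂ (suc i) (∂ i p)) ≋ ∂ (suc i) (∂ i (∂ (suc i) p))
∂-braid {n} i hj = linear-ind
  (∘-linear (∂-linear i) (∘-linear (∂-linear j) (∂-linear i)))
  (∘-linear (∂-linear j) (∘-linear (∂-linear i) (∂-linear j)))
  (≋-trans (≋-cong (∘-linear (∂-linear i) (∂-linear j)) (∂-1 i)) (≋-sym (≋-cong (∘-linear (∂-linear j) (∂-linear i)) (∂-1 j))))
  (λ k p _ ih → ≋-trans (∂₃-X i j hi hj k p) (≋-trans
    (swap-terms {p = ∂ i (∂ j p)} {∂ j (∂ i p)} (sym (κ-braid₁ i k)) (κ-braid₂ i k) (σ-braid i k) ih)
    (≋-sym (∂₃-X j i hj hi k p))))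
  where
  j = suc i
  hi : suc i < n
  hi = ℕP.<-trans (ℕP.n<1+n _) hj

-- The ideal of the coinvariant ring

coeff-ΣP-zero : ∀ {A : Set} {n} (F : A → Poly n) xs m → All (λ x → coeff (F x) m ≡ 0ℤ) xs → coeff (ΣP (map F xs)) m ≡ 0ℤ
coeff-ΣP-zero F []       m []       = refl
coeff-ΣP-zero F (x ∷ xs) m (h ∷ hs) =
  trans (coeff-⊕ (F x) _ m) (cong₂ ℤ._+_ h (coeff-ΣP-zero F xs m hs))

coeff-ΣP-single : ∀ {A : Set} {n} (F : A → Poly n) {xs} {x} m → Unique xs → x ∈ xs →
  (∀ y → y ∈ xs → y ≢ x → coeff (F y) m ≡ 0ℤ) → coeff (ΣP (map F xs)) m ≡ coeff (F x) m
coeff-ΣP-single F {x ∷ xs} m (x∉ ∷ u) (here refl) h =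
  trans (coeff-⊕ (F x) _ m) (trans (cong (ℤ._+_ (coeff (F x) m))
    (coeff-ΣP-zero F xs m (All.tabulate λ y∈ → h _ (there y∈) (λ e → All.lookup x∉ y∈ (sym e))))) (ℤP.+-identityʳ _))
coeff-ΣP-single F {y ∷ xs} m (y∉ ∷ u) (there x∈) h =
  trans (coeff-⊕ (F y) _ m) (trans (cong₂ ℤ._+_ (h y (here refl) (All.lookup y∉ x∈))
    (coeff-ΣP-single F m u x∈ (λ z z∈ → h z (there z∈)))) (ℤP.+-identityˡ _))

ΣP-cong : ∀ {A : Set} {n} {F G : A → Poly n} xs → (∀ x → x ∈ xs → F x ≋ G x) → ΣP (map F xs) ≋ ΣP (map G xs)
ΣP-cong []       h = ≋-refl
ΣP-cong (x ∷ xs) h = ⊕-cong (h x (here refl)) (ΣP-cong xs (λ y y∈ → h y (there y∈)))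

linear-ΣP : ∀ {A : Set} {n k} {L : Poly n → Poly k} → Linear L → (F : A → Poly n) → ∀ xs →
  L (ΣP (map F xs)) ≋ ΣP (map (L ∘ F) xs)
linear-ΣP l F []       = 0-homo l
linear-ΣP l F (x ∷ xs) = ≋-trans (⊕-homo l (F x) _) (⊕-cong ≋-refl (linear-ΣP l F xs))

ΣP-linear : ∀ {A : Set} {n k} {L : A → Poly n → Poly k} → (∀ x → Linear (L x)) → ∀ xs → Linear (λ p → ΣP (map (λ x → L x p) xs))
ΣP-linear l []       = record { ≋-cong = λ _ → ≋-refl ; ⊕-homo = λ _ _ → ≋-refl ; ·-homo = λ _ _ → ≋-refl }
ΣP-linear l (x ∷ xs) = ⊕-linear (l x) (ΣP-linear l xs)

coeff-absent : ∀ {n} {p : Poly n} {m} → All (λ t → proj₂ t ≢ m) p → coeff p m ≡ 0ℤ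
coeff-absent [] = refl
coeff-absent {p = (c , m′) ∷ p} {m} (h ∷ hs) with m′ ≟M m
... | yes e = ⊥-elim (h e)
... | no _  = coeff-absent hs

comb : ∀ {n} → (Fin n → Poly n) → Poly n
comb {n} a = ΣP (map (λ i → a i ⊗ e n (suc (toℕ i))) (allFin n))

record Ideal {n} (p : Poly n) : Set where
  constructor mkIdeal
  field
    cofactor  : Fin n → Poly n
    expansion : p ≋ comb cofactor

toInIdeal : ∀ {n} {p : Poly n} → Ideal p → InIdeal p
toInIdeal (mkIdeal a h) = a , at h

fromInIdeal : ∀ {n} (p : Poly n) → InIdeal p → Ideal p
fromInIdeal p (a , h) = mkIdeal a (mk h)

ideal-resp : ∀ {n} {p q : Poly n} → p ≋ q → Ideal p → Ideal q
ideal-resp h (mkIdeal a k) = mkIdeal a (≋-trans (≋-sym h) k)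

-- An operator that is linear over the generators can be applied to the cofactors. Multiplications
-- are of this kind, and so are divided differences, because the generators are symmetric.
ideal-map : ∀ {n} {L : Poly n → Poly n} → Linear L → (∀ k q → L (q ⊗ e n (suc k)) ≋ L q ⊗ e n (suc k)) →
  ∀ {p} → Ideal p → Ideal (L p)
ideal-map {n} {L} l h (mkIdeal a k) = mkIdeal (L ∘ a) (≋-trans (≋-cong l k) (≋-trans
  (linear-ΣP l (λ i → a i ⊗ e n (suc (toℕ i))) (allFin n)) (ΣP-cong (allFin n) (λ i _ → h (toℕ i) (a i)))))

ideal-0 : ∀ {n} → Ideal {n} []
ideal-0 {n} = mkIdeal (λ _ → []) (mk λ m → sym (coeff-ΣP-zero {n = n} (λ _ → []) (allFin n) m (All.universal (λ _ → refl) _)))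

ideal-⊕ : ∀ {n} {p q : Poly n} → Ideal p → Ideal q → Ideal (p ⊕ q)
ideal-⊕ {n} (mkIdeal a h) (mkIdeal b k) = mkIdeal (λ i → a i ⊕ b i) (≋-trans (⊕-cong h k) (≋-sym (go (allFin n))))
  where
  G : Fin n → Poly n
  G i = e n (suc (toℕ i))
  open ≋-Reasoning
  interchange : ∀ (p q r s : Poly n) → (p ⊕ q) ⊕ (r ⊕ s) ≋ (p ⊕ r) ⊕ (q ⊕ s)
  interchange p q r s = begin
    (p ⊕ q) ⊕ (r ⊕ s)  ≡⟨ LP.++-assoc p q (r ⊕ s) ⟩
    p ⊕ (q ⊕ (r ⊕ s))  ≈⟨ ⊕-cong {p = p} ≋-refl (⊕-left-comm q r s) ⟩
    p ⊕ (r ⊕ (q ⊕ s))  ≡⟨ LP.++-assoc p r (q ⊕ s) ⟨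
    (p ⊕ r) ⊕ (q ⊕ s)  ∎
  go : ∀ xs → ΣP (map (λ i → (a i ⊕ b i) ⊗ G i) xs) ≋ ΣP (map (λ i → a i ⊗ G i) xs) ⊕ ΣP (map (λ i → b i ⊗ G i) xs)
  go []       = ≋-refl
  go (x ∷ xs) = ≋-trans (⊕-cong (⊕-homo (⊗-linearˡ (G x)) (a x) (b x)) (go xs))
    (interchange (a x ⊗ G x) (b x ⊗ G x) _ _)

ideal-X : ∀ {n} j {p : Poly n} → Ideal p → Ideal (X j p)
ideal-X {n} j = ideal-map (X-linear j) λ k q → ≋-sym (X-⊗ j q (e n (suc k)))

ideal-· : ∀ {n} c {p : Poly n} → Ideal p → Ideal (c · p)
ideal-· {n} c = ideal-map (·-linear c) λ k q → ≋-sym (·-homo (⊗-linearˡ (e n (suc k))) c q)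

ideal-⊝ : ∀ {n} {p q : Poly n} → Ideal p → Ideal q → Ideal (p ⊝ q)
ideal-⊝ h k = ideal-⊕ h (ideal-· -1ℤ k)

ideal-e : ∀ {n} k → k < n → Ideal (e n (suc k))
ideal-e {n} k k<n = mkIdeal a (≋-sym (mk λ m → trans
    (coeff-ΣP-single (λ i → a i ⊗ e n (suc (toℕ i))) m (UniqueP.allFin⁺ n) (∈P.∈-allFin i₀) (λ i _ ne → off i m ne))
    (trans (on m) (cong (λ l → coeff (e n (suc l)) m) (FinP.toℕ-fromℕ< k<n)))))
  where
  i₀ : Fin n
  i₀ = Fin.fromℕ< k<n
  a : Fin n → Poly n
  a i with i Fin.≟ i₀
  ... | yes _ = mono 𝟏
  ... | no  _ = []
  off : ∀ i m → i ≢ i₀ → coeff (a i ⊗ e n (suc (toℕ i))) m ≡ 0ℤ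
  off i m ne with i Fin.≟ i₀
  ... | yes eq = ⊥-elim (ne eq)
  ... | no _   = refl
  on : ∀ m → coeff (a i₀ ⊗ e n (suc (toℕ i₀))) m ≡ coeff (e n (suc (toℕ i₀))) m
  on m with i₀ Fin.≟ i₀
  ... | yes _ = at (1-⊗ (e n (suc (toℕ i₀)))) m
  ... | no ne = ⊥-elim (ne refl)

-- A predicate in place of the degree makes the recursion on n uniform; e n k is definitionally E n (_≡ᵇ k).
E : ∀ n → (ℕ → Bool) → Poly n
E n P = map (1ℤ ,_) (filterᵇ (P ∘ Vec.sum) (zeroOne n))

filterᵇ-map : ∀ {A B : Set} (P : B → Bool) (f : A → B) xs → filterᵇ P (map f xs) ≡ map f (filterᵇ (P ∘ f) xs)
filterᵇ-map P f []       = refl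
filterᵇ-map P f (x ∷ xs) with P (f x)
... | true  = cong₂ _∷_ refl (filterᵇ-map P f xs)
... | false = filterᵇ-map P f xs

-- Splitting by the exponent of x₁; for a single degree this is e_k(x₁,x₂,...) = e_k(x₂,...) + x₁
-- e_{k-1}(x₂,...).
E-suc : ∀ n P → E (suc n) P ≡ mapM (0 ∷_) (E n P) ⊕ mapM (1 ∷_) (E n (P ∘ suc))
E-suc n P = begin
  map (1ℤ ,_) (filterᵇ Q (map (0 ∷_) Z ++ map (1 ∷_) Z))
    ≡⟨ cong (map (1ℤ ,_)) (LP.filter-++ (T? ∘ Q) (map (0 ∷_) Z) (map (1 ∷_) Z)) ⟩
  map (1ℤ ,_) (filterᵇ Q (map (0 ∷_) Z) ++ filterᵇ Q (map (1 ∷_) Z))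
    ≡⟨ LP.map-++ (1ℤ ,_) (filterᵇ Q (map (0 ∷_) Z)) _ ⟩
  map (1ℤ ,_) (filterᵇ Q (map (0 ∷_) Z)) ++ map (1ℤ ,_) (filterᵇ Q (map (1 ∷_) Z))
    ≡⟨ cong₂ _++_ (half 0) (half 1) ⟩
  mapM (0 ∷_) (E n P) ⊕ mapM (1 ∷_) (E n (P ∘ suc)) ∎
  where
  open ≡-Reasoning
  Z = zeroOne n
  Q : Mono (suc n) → Bool
  Q = P ∘ Vec.sum
  half : ∀ a → map (1ℤ ,_) (filterᵇ Q (map (a ∷_) Z)) ≡ mapM (a ∷_) (E n (P ∘ (a ℕ.+_)))
  half a = trans (cong (map (1ℤ ,_)) (filterᵇ-map Q (a ∷_) Z))
    (trans (sym (LP.map-∘ (filterᵇ (Q ∘ (a ∷_)) Z))) (LP.map-∘ (filterᵇ (Q ∘ (a ∷_)) Z)))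

E-empty : ∀ n P → (∀ k → k ≤ n → P k ≡ false) → E n P ≡ []
E-empty zero    P h rewrite h 0 z≤n = refl
E-empty (suc n) P h = trans (E-suc n P) (cong₂ (λ p q → mapM (0 ∷_) p ⊕ mapM (1 ∷_) q)
  (E-empty n P (λ k k≤n → h k (ℕP.m≤n⇒m≤1+n k≤n))) (E-empty n (P ∘ suc) (λ k k≤n → h (suc k) (s≤s k≤n))))

E-zero : ∀ n → E n (_≡ᵇ 0) ≡ mono 𝟏
E-zero zero    = refl
E-zero (suc n) = trans (E-suc n (_≡ᵇ 0)) (cong₂ (λ p q → mapM (0 ∷_) p ⊕ mapM (1 ∷_) q)
  (E-zero n) (E-empty n _ (λ _ _ → refl)))

E-All : ∀ n P → All (λ t → T (P (Vec.sum (proj₂ t)))) (E n P)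
E-All n P = AllP.map⁺ (AllP.all-filter (T? ∘ (P ∘ Vec.sum)) (zeroOne n))

∂-mapM-∷ : ∀ {n} i a (p : Poly n) → ∂ (suc i) (mapM (a ∷_) p) ≋ mapM (a ∷_) (∂ i p)
∂-mapM-∷ i a = linear-ext (∘-linear (∂-linear (suc i)) (mapM-linear (a ∷_))) (∘-linear (mapM-linear (a ∷_)) (∂-linear i))
  λ m → ≋-trans (∂-mono (suc i) (a ∷ m)) (≋-trans (≡⇒≋ (ddMono-suc i a m)) (≋-cong (mapM-linear (a ∷_)) (≋-sym (∂-mono i m))))

-- Sort the squarefree monomials by their exponents in the two variables. Those with equal exponents
-- are killed; the patterns 10 and 01 have the same cofactor `B` because only the total degree is
-- prescribed, and their images are opposite.
∂-E : ∀ {n} i P → ∂ i (E n P) ≋ []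
∂-E {n} i P with suc i ℕP.<? n
... | no h  = ≡⇒≋ (∂-out i (E n P) h)
... | yes h = go n i P h
  where
  open ≋-Reasoning
  cancel : ∀ {n} (p : Poly n) → p ⊕ (-1ℤ · p) ≋ []
  cancel p = mk λ m → trans (coeff-⊝ p p m) (ℤP.+-inverseʳ (coeff p m))
  equal-exps : ∀ {n} a (p : Poly n) → ∂ 0 (mapM (a ∷_) (mapM (a ∷_) p)) ≋ []
  equal-exps a p = ≋-trans (linear-ext (∘-linear (∂-linear 0) (∘-linear (mapM-linear (a ∷_)) (mapM-linear (a ∷_))))
    (∘-linear (·-linear 0ℤ) (∘-linear (mapM-linear (a ∷_)) (mapM-linear (a ∷_))))
    (λ m → ≋-trans (∂-level (here {a = a} {m})) (≋-sym (0· (mono (a ∷ a ∷ m))))) p) (0· _)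
  one-zero : ∀ {n} (p : Poly n) → ∂ 0 (mapM (1 ∷_) (mapM (0 ∷_) p)) ≋ mapM (0 ∷_) (mapM (0 ∷_) p)
  one-zero = linear-ext (∘-linear (∂-linear 0) (∘-linear (mapM-linear (1 ∷_)) (mapM-linear (0 ∷_))))
    (∘-linear (mapM-linear (0 ∷_)) (mapM-linear (0 ∷_))) (λ m → ∂-X-level (s≤s (s≤s z≤n)) here)
  zero-one : ∀ {n} (p : Poly n) → ∂ 0 (mapM (0 ∷_) (mapM (1 ∷_) p)) ≋ -1ℤ · mapM (0 ∷_) (mapM (0 ∷_) p)
  zero-one = linear-ext (∘-linear (∂-linear 0) (∘-linear (mapM-linear (0 ∷_)) (mapM-linear (1 ∷_))))
    (∘-linear (·-linear -1ℤ) (∘-linear (mapM-linear (0 ∷_)) (mapM-linear (0 ∷_)))) (λ m → ∂-mono 0 (0 ∷ 1 ∷ m))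
  go : ∀ n i P → suc i < n → ∂ i (E n P) ≋ []
  go (suc (suc n)) zero P _ = begin
    ∂ 0 (E (suc (suc n)) P)
      ≡⟨ cong (∂ 0) (trans (E-suc (suc n) P) (cong₂ (λ p q → mapM (0 ∷_) p ⊕ mapM (1 ∷_) q) (E-suc n P) (E-suc n (P ∘ suc)))) ⟩
    ∂ 0 (mapM (0 ∷_) (mapM (0 ∷_) A ⊕ mapM (1 ∷_) B) ⊕ mapM (1 ∷_) (mapM (0 ∷_) B ⊕ mapM (1 ∷_) C))
      ≈⟨ ⊕-homo (∂-linear 0) (mapM (0 ∷_) (mapM (0 ∷_) A ⊕ mapM (1 ∷_) B)) _ ⟩
    ∂ 0 (mapM (0 ∷_) (mapM (0 ∷_) A ⊕ mapM (1 ∷_) B)) ⊕ ∂ 0 (mapM (1 ∷_) (mapM (0 ∷_) B ⊕ mapM (1 ∷_) C))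
      ≈⟨ ⊕-cong (⊕-homo (∘-linear (∂-linear 0) (mapM-linear (0 ∷_))) (mapM (0 ∷_) A) _)
                (⊕-homo (∘-linear (∂-linear 0) (mapM-linear (1 ∷_))) (mapM (0 ∷_) B) _) ⟩
    (∂ 0 (mapM (0 ∷_) (mapM (0 ∷_) A)) ⊕ ∂ 0 (mapM (0 ∷_) (mapM (1 ∷_) B)))
      ⊕ (∂ 0 (mapM (1 ∷_) (mapM (0 ∷_) B)) ⊕ ∂ 0 (mapM (1 ∷_) (mapM (1 ∷_) C)))
      ≈⟨ ⊕-cong (⊕-cong (equal-exps 0 A) (zero-one B)) (⊕-cong (one-zero B) (equal-exps 1 C)) ⟩
    -1ℤ · D ⊕ (D ⊕ [])   ≈⟨ ⊕-cong {p = -1ℤ · D} ≋-refl (⊕-identityʳ D) ⟩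
    -1ℤ · D ⊕ D          ≈⟨ ⊕-comm (-1ℤ · D) D ⟩
    D ⊕ -1ℤ · D          ≈⟨ cancel D ⟩
    [] ∎
    where
    A = E n P
    B = E n (P ∘ suc)
    C = E n (P ∘ suc ∘ suc)
    D = mapM (0 ∷_) (mapM (0 ∷_) B)
  go (suc n) (suc i) P (s≤s h) = begin
    ∂ (suc i) (E (suc n) P)                            ≡⟨ cong (∂ (suc i)) (E-suc n P) ⟩
    ∂ (suc i) (mapM (0 ∷_) A ⊕ mapM (1 ∷_) B)          ≈⟨ ⊕-homo (∂-linear (suc i)) (mapM (0 ∷_) A) _ ⟩
    ∂ (suc i) (mapM (0 ∷_) A) ⊕ ∂ (suc i) (mapM (1 ∷_) B)
      ≈⟨ ⊕-cong (≋-trans (∂-mapM-∷ i 0 A) (≋-cong (mapM-linear (0 ∷_)) (go n i P h)))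
                (≋-trans (∂-mapM-∷ i 1 B) (≋-cong (mapM-linear (1 ∷_)) (go n i (P ∘ suc) h))) ⟩
    [] ∎
    where
    A = E n P
    B = E n (P ∘ suc)

ideal-∂ : ∀ {n} i {p : Poly n} → Ideal p → Ideal (∂ i p)
ideal-∂ {n} i = ideal-map (∂-linear i) λ k q → ∂-⊗ i (∂-E i (_≡ᵇ suc k)) q

constant : ∀ {n} → Poly n → ℤ
constant p = coeff p 𝟏

sum-𝟏 : ∀ n → Vec.sum (𝟏 {n}) ≡ 0
sum-𝟏 zero    = refl
sum-𝟏 (suc n) = sum-𝟏 n

sum-zipWith-+ : ∀ {n} (a b : Mono n) → Vec.sum (Vec.zipWith ℕ._+_ a b) ≡ Vec.sum a ℕ.+ Vec.sum b
sum-zipWith-+ []      []      = refl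
sum-zipWith-+ (x ∷ a) (y ∷ b) = trans (cong ((x ℕ.+ y) ℕ.+_) (sum-zipWith-+ a b)) (interchange x y (Vec.sum a) (Vec.sum b))
  where
  interchange : ∀ x y u v → (x ℕ.+ y) ℕ.+ (u ℕ.+ v) ≡ (x ℕ.+ u) ℕ.+ (y ℕ.+ v)
  interchange x y u v = trans (ℕP.+-assoc x y _) (trans (cong (x ℕ.+_) (trans (sym (ℕP.+-assoc y u v))
    (trans (cong (ℕ._+ v) (ℕP.+-comm y u)) (ℕP.+-assoc u y v)))) (sym (ℕP.+-assoc x u _)))

lin-absent : ∀ {n} φ {p : Poly n} → All (λ t → φ (proj₂ t) ≡ 0ℤ) p → lin φ p ≡ 0ℤ
lin-absent φ [] = refl
lin-absent φ {(c , m) ∷ p} (h ∷ hs) rewrite h | ℤP.*-zeroʳ c = trans (ℤP.+-identityˡ _) (lin-absent φ hs)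

-- The generators have positive degree, so no term of a multiple of one of them is a constant.
constant-ideal : ∀ {n} {p : Poly n} → Ideal p → constant p ≡ 0ℤ
constant-ideal {n} (mkIdeal a h) = trans (at h 𝟏) (coeff-ΣP-zero (λ i → a i ⊗ e n (suc (toℕ i))) (allFin n) 𝟏
  (All.universal (λ i → trans (coeff-⊗ (a i) _ 𝟏) (trans (lin-cong-φ (row (toℕ i)) (a i)) (lin-0φ (a i)))) _))
  where
  row : ∀ k b → lin (λ m → δ (Vec.zipWith ℕ._+_ b m) 𝟏) (e n (suc k)) ≡ 0ℤ
  row k b = lin-absent _ (All.map (λ {t} → off (proj₂ t)) (E-All n (_≡ᵇ suc k)))
    where
    off : ∀ m → T (Vec.sum m ≡ᵇ suc k) → δ (Vec.zipWith ℕ._+_ b m) 𝟏 ≡ 0ℤ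
    off m t with Vec.zipWith ℕ._+_ b m ≟M 𝟏
    ... | no _   = refl
    ... | yes eq with trans (sym (sum-zipWith-+ b m)) (trans (cong Vec.sum eq) (sum-𝟏 n))
    ...   | s rewrite ℕP.≡ᵇ⇒≡ (Vec.sum m) (suc k) t | ℕP.+-suc (Vec.sum b) k with s
    ...     | ()

stair : ∀ n → Mono n
stair zero    = []
stair (suc n) = n ∷ stair n

-- The e_k for x₂,…,x_n satisfy r_{k+1} = e_{k+1} − x₁ r_k, hence r_k ≡ ±x₁ᵏ; and r_n = 0.
ideal-x₁^k : ∀ n k → k ≤ suc n → ∃[ s ] (s ℤ.* s ≡ 1ℤ × Ideal (mapM (0 ∷_) (E n (_≡ᵇ k)) ⊕ s · mono (k ∷ 𝟏 {n})))
ideal-x₁^k n zero _ = -1ℤ , refl , ideal-resp (≋-sym base) ideal-0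
  where
  base : mapM (0 ∷_) (E n (_≡ᵇ 0)) ⊕ -1ℤ · mono 𝟏 ≋ []
  base rewrite E-zero n = mk λ m → trans (coeff-⊝ (mono 𝟏) (mono 𝟏) m) (ℤP.+-inverseʳ (coeff (mono 𝟏) m))
ideal-x₁^k n (suc k) k<n with ideal-x₁^k n k (ℕP.<⇒≤ k<n)
... | s , s² , h = ℤ.- s , trans (neg² s) s² , ideal-resp step (ideal-⊝ (ideal-e k k<n) (ideal-X 0 h))
  where
  neg² : ∀ s → ℤ.- s ℤ.* ℤ.- s ≡ s ℤ.* s
  neg² = ℤSolver.solve-∀
  r : ℕ → Poly (suc n)
  r k = mapM (0 ∷_) (E n (_≡ᵇ k))
  M x₁r : Poly (suc n)
  M = mono (suc k ∷ 𝟏)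
  x₁r = mapM (1 ∷_) (E n (_≡ᵇ k))
  solve : ∀ a b s c → (a ℤ.+ b) ℤ.- (b ℤ.+ s ℤ.* c) ≡ a ℤ.+ ℤ.- s ℤ.* c
  solve = ℤSolver.solve-∀
  step′ : ∀ m → coeff ((r (suc k) ⊕ x₁r) ⊝ (x₁r ⊕ s · M)) m ≡ coeff (r (suc k) ⊕ ℤ.- s · M) m
  step′ m rewrite coeff-⊝ (r (suc k) ⊕ x₁r) (x₁r ⊕ s · M) m | coeff-⊕ (r (suc k)) x₁r m | coeff-⊕ x₁r (s · M) m
    | coeff-⊕ (r (suc k)) (ℤ.- s · M) m | coeff-· s M m | coeff-· (ℤ.- s) M m =
    solve (coeff (r (suc k)) m) (coeff x₁r m) s (coeff M m)
  step : e (suc n) (suc k) ⊝ X 0 (r k ⊕ s · mono (k ∷ 𝟏)) ≋ r (suc k) ⊕ ℤ.- s · M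
  step = ≋-trans (⊝-cong (≡⇒≋ (E-suc n (_≡ᵇ suc k)))
    (≋-trans (⊕-homo (X-linear 0) (r k) _)
      (⊕-cong {q = X 0 (s · mono (k ∷ 𝟏))} (≡⇒≋ (mapM-∘ (inc 0) (0 ∷_) _)) ≋-refl))) (mk step′)

E-top : ∀ n → E n (_≡ᵇ suc n) ≡ []
E-top n = E-empty n (_≡ᵇ suc n) too-small
  where
  too-small : ∀ k → k ≤ n → (k ≡ᵇ suc n) ≡ false
  too-small k k≤n with k ≡ᵇ suc n in eq
  ... | false = refl
  ... | true  = ⊥-elim (ℕP.<-irrefl (ℕP.≡ᵇ⇒≡ k (suc n) (subst T (sym eq) _)) (s≤s k≤n))

-- In degree one above the number of remaining variables the elementary polynomial is empty, which
-- leaves s times a power of x₁ in the ideal; a second factor s removes the sign, as s² = 1.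
ideal-x₁^n : ∀ n → Ideal (mono (suc n ∷ 𝟏 {n}))
ideal-x₁^n n with ideal-x₁^k n (suc n) ℕP.≤-refl
... | s , s² , h rewrite E-top n =
  ideal-resp (≋-trans (·-assoc s s (mono (suc n ∷ 𝟏))) (≋-trans (·-congˡ (mono (suc n ∷ 𝟏)) s²) (1· _))) (ideal-· s h)

-- For the first variable the product is divisible by x₁ⁿ. To go from variable j to the next one,
-- multiply x_j x^δ by x_{j+1}: the monomial x_{j+1} x^δ has equal exponents at j and j + 1, so ∂ⱼ
-- of x_j x_{j+1} x^δ is x_{j+1} x^δ, and ∂ⱼ preserves the ideal.
ideal-X-stair : ∀ {n} j → j < n → Ideal (X j (mono (stair n)))
ideal-X-stair {suc n} zero _ = mono-ind (λ m → Ideal (mono (suc n ∷ m))) (ideal-x₁^n n) (λ j m _ → ideal-X (suc j)) (stair n)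
ideal-X-stair {n} (suc j) j<n = ideal-resp
  (≋-trans (≡⇒≋ (cong (∂ j ∘ mono) (inc-comm j (suc j) (stair n)))) (∂-X-level j<n (level j n j<n)))
  (ideal-∂ j (ideal-X (suc j) (ideal-X-stair j (ℕP.<-trans (ℕP.n<1+n j) j<n))))
  where
  inc-comm : ∀ {n} i j (m : Mono n) → inc j (inc i m) ≡ inc i (inc j m)
  inc-comm i       j       []      = refl
  inc-comm zero    zero    (a ∷ m) = refl
  inc-comm zero    (suc j) (a ∷ m) = refl
  inc-comm (suc i) zero    (a ∷ m) = refl
  inc-comm (suc i) (suc j) (a ∷ m) = cong (a ∷_) (inc-comm i j m)
  level : ∀ j n → suc j < n → Level j (inc (suc j) (stair n))
  level zero    (suc (suc n)) _       = here
  level zero    (suc zero) (s≤s ())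
  level (suc j) (suc n)       (s≤s h) = there (level j n h)

-- Ascents, descents and Schubert polynomials

sw : ℕ → List ℕ → List ℕ
sw i       []          = []
sw zero    (a ∷ [])    = a ∷ []
sw zero    (a ∷ b ∷ w) = b ∷ a ∷ w
sw (suc i) (a ∷ w)     = a ∷ sw i w

data Adjacent (R : ℕ → ℕ → Set) : ℕ → List ℕ → Set where
  here  : ∀ {a b w} → R a b → Adjacent R 0 (a ∷ b ∷ w)
  there : ∀ {i a w} → Adjacent R i w → Adjacent R (suc i) (a ∷ w)

Asc Desc : ℕ → List ℕ → Set
Asc  = Adjacent _<_
Desc = Adjacent _>_

adjacent-< : ∀ {R i w} → Adjacent R i w → suc i < length w
adjacent-< (here _)  = s≤s (s≤s z≤n)
adjacent-< (there h) = s≤s (adjacent-< h)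

length-sw : ∀ i w → length (sw i w) ≡ length w
length-sw i       []          = refl
length-sw zero    (a ∷ [])    = refl
length-sw zero    (a ∷ b ∷ w) = refl
length-sw (suc i) (a ∷ w)     = cong suc (length-sw i w)

sw-involutive : ∀ i w → sw i (sw i w) ≡ w
sw-involutive i       []          = refl
sw-involutive zero    (a ∷ [])    = refl
sw-involutive zero    (a ∷ b ∷ w) = refl
sw-involutive (suc i) (a ∷ w)     = cong (a ∷_) (sw-involutive i w)

asc-sw : ∀ {i w} → Desc i w → Asc i (sw i w)
asc-sw (here h)  = here h
asc-sw (there h) = there (asc-sw h)

desc-sw : ∀ {i w} → Asc i w → Desc i (sw i w)
desc-sw (here h)  = here h
desc-sw (there h) = there (desc-sw h)

asc-desc : ∀ {i w} → Asc i w → Desc i w → ⊥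
asc-desc (here h)  (here k)  = ℕP.<-asym h k
asc-desc (there h) (there k) = asc-desc h k

applyUpTo-cong : ∀ {A : Set} {f g : ℕ → A} n → (∀ k → k < n → f k ≡ g k) → applyUpTo f n ≡ applyUpTo g n
applyUpTo-cong zero    h = refl
applyUpTo-cong (suc n) h = cong₂ _∷_ (h 0 (s≤s z≤n)) (applyUpTo-cong n (λ k k<n → h (suc k) (s≤s k<n)))

applyUpTo-nth : ∀ w → applyUpTo (nth w) (length w) ≡ w
applyUpTo-nth []      = refl
applyUpTo-nth (a ∷ w) = cong (a ∷_) (applyUpTo-nth w)

swapAt-sw : ∀ i w → suc i < length w → swapAt i (suc i) w ≡ sw i w
swapAt-sw i w h = begin
  swapAt i (suc i) w                        ≡⟨ LP.map-applyUpTo id _ (length w) ⟩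
  applyUpTo _ (length w)                    ≡⟨ applyUpTo-cong (length w) (λ k _ → entry i w k h) ⟩
  applyUpTo (nth (sw i w)) (length w)       ≡⟨ cong (applyUpTo (nth (sw i w))) (length-sw i w) ⟨
  applyUpTo (nth (sw i w)) (length (sw i w)) ≡⟨ applyUpTo-nth (sw i w) ⟩
  sw i w ∎
  where
  open ≡-Reasoning
  entry : ∀ i w k → suc i < length w →
    (if k ≡ᵇ i then nth w (suc i) else if k ≡ᵇ suc i then nth w i else nth w k) ≡ nth (sw i w) k
  entry zero (a ∷ b ∷ w) zero          _ = refl
  entry zero (a ∷ b ∷ w) (suc zero)    _ = refl
  entry zero (a ∷ b ∷ w) (suc (suc k)) _ = refl
  entry zero (a ∷ []) k (s≤s ())
  entry (suc i) (a ∷ w) zero    _       = refl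
  entry (suc i) (a ∷ w) (suc k) (s≤s h) = entry i w k h

sw-swapAt : ∀ {R i w} → Adjacent R i w → swapAt i (suc i) w ≡ sw i w
sw-swapAt {i = i} {w} h = swapAt-sw i w (adjacent-< h)

smaller : ℕ → List ℕ → ℕ
smaller x xs = length (filterᵇ (_<ᵇ x) xs)

<ᵇ-true : ∀ {a b} → a < b → (a <ᵇ b) ≡ true
<ᵇ-true {a} {b} h with a <ᵇ b | ℕP.<⇒<ᵇ h
... | true | _ = refl

<ᵇ-false : ∀ {a b} → b ≤ a → (a <ᵇ b) ≡ false
<ᵇ-false {a} {b} h with a <ᵇ b in eq
... | false = refl
... | true  = ⊥-elim (ℕP.<⇒≱ (ℕP.<ᵇ⇒< a b (subst T (sym eq) _)) h)

smaller-yes : ∀ {x y} xs → y < x → smaller x (y ∷ xs) ≡ suc (smaller x xs)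
smaller-yes xs h rewrite <ᵇ-true h = refl

smaller-no : ∀ {x y} xs → x ≤ y → smaller x (y ∷ xs) ≡ smaller x xs
smaller-no xs h rewrite <ᵇ-false h = refl

smaller-∷ : ∀ x y xs → smaller x (y ∷ xs) ≡ (if y <ᵇ x then 1 else 0) ℕ.+ smaller x xs
smaller-∷ x y xs with y <ᵇ x
... | true  = refl
... | false = refl

smaller-sw : ∀ x i w → smaller x (sw i w) ≡ smaller x w
smaller-sw x i       []          = refl
smaller-sw x zero    (a ∷ [])    = refl
smaller-sw x zero    (a ∷ b ∷ w) rewrite smaller-∷ x b (a ∷ w) | smaller-∷ x a w | smaller-∷ x a (b ∷ w) | smaller-∷ x b w
  with a <ᵇ x | b <ᵇ x
... | true  | true  = refl
... | true  | false = refl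
... | false | true  = refl
... | false | false = refl
smaller-sw x (suc i) (a ∷ w) rewrite smaller-∷ x a (sw i w) | smaller-∷ x a w = cong (_ ℕ.+_) (smaller-sw x i w)

len-sw : ∀ {i w} → Asc i w → len (sw i w) ≡ suc (len w)
len-sw {w = a ∷ b ∷ w} (here a<b) = begin
  smaller b (a ∷ w) ℕ.+ (smaller a w ℕ.+ len w)      ≡⟨ cong (ℕ._+ (smaller a w ℕ.+ len w)) (smaller-yes w a<b) ⟩
  suc (smaller b w ℕ.+ (smaller a w ℕ.+ len w))
    ≡⟨ cong suc (sym (ℕP.+-assoc (smaller b w) (smaller a w) (len w))) ⟩
  suc (smaller b w ℕ.+ smaller a w ℕ.+ len w)
    ≡⟨ cong (λ z → suc (z ℕ.+ len w)) (ℕP.+-comm (smaller b w) (smaller a w)) ⟩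
  suc (smaller a w ℕ.+ smaller b w ℕ.+ len w)        ≡⟨ cong suc (ℕP.+-assoc (smaller a w) (smaller b w) (len w)) ⟩
  suc (smaller a w ℕ.+ (smaller b w ℕ.+ len w))
    ≡⟨ cong (λ z → suc (z ℕ.+ (smaller b w ℕ.+ len w))) (sym (smaller-no w (ℕP.<⇒≤ a<b))) ⟩
  suc (smaller a (b ∷ w) ℕ.+ (smaller b w ℕ.+ len w)) ∎
  where open ≡-Reasoning
len-sw {suc i} {a ∷ w} (there h) = trans (cong₂ ℕ._+_ (smaller-sw a i w) (len-sw h)) (ℕP.+-suc (smaller a w) (len w))

len-desc : ∀ {i w} → Desc i w → len w ≡ suc (len (sw i w))
len-desc {i} {w} h = trans (cong len (sym (sw-involutive i w))) (len-sw (asc-sw h))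

-- For a nonempty word this gives `len w < n * n`, which is why the fuel `n * n` in `𝔖` suffices.
len-bound : ∀ w → len w ℕ.+ length w ≤ length w ℕ.* length w
len-bound []      = z≤n
len-bound (x ∷ w) = begin
  smaller x w ℕ.+ len w ℕ.+ suc l    ≤⟨ ℕP.+-monoˡ-≤ (suc l) (ℕP.+-monoˡ-≤ (len w) (LP.length-filter (T? ∘ (_<ᵇ x)) w)) ⟩
  l ℕ.+ len w ℕ.+ suc l              ≡⟨ ℕP.+-suc (l ℕ.+ len w) l ⟩
  suc (l ℕ.+ len w ℕ.+ l)            ≡⟨ cong suc (ℕP.+-assoc l (len w) l) ⟩
  suc (l ℕ.+ (len w ℕ.+ l))          ≤⟨ s≤s (ℕP.+-monoʳ-≤ l (len-bound w)) ⟩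
  suc (l ℕ.+ l ℕ.* l)                ≤⟨ s≤s (ℕP.+-monoʳ-≤ l (ℕP.*-monoʳ-≤ l (ℕP.n≤1+n l))) ⟩
  suc (l ℕ.+ l ℕ.* suc l)            ∎
  where
  open ℕP.≤-Reasoning
  l = length w

len<n² : ∀ {n} w → 1 ≤ n → length w ≡ n → len w < n ℕ.* n
len<n² {n} w 1≤n refl = ℕP.≤-trans (ℕP.≤-trans (ℕP.≤-reflexive (ℕP.+-comm 1 (len w))) (ℕP.+-monoʳ-≤ (len w) 1≤n)) (len-bound w)

firstAscent-just : ∀ w {i} → firstAscent w ≡ just i → Asc i w
firstAscent-just (a ∷ b ∷ w) eq with a <ᵇ b in a<b
firstAscent-just (a ∷ b ∷ w) refl | true = here (ℕP.<ᵇ⇒< a b (subst T (sym a<b) _))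
firstAscent-just (a ∷ b ∷ w) eq | false with firstAscent (b ∷ w) in eq′
firstAscent-just (a ∷ b ∷ w) refl | false | just i = there (firstAscent-just (b ∷ w) eq′)

firstAscent-min : ∀ w {i j} → firstAscent w ≡ just i → Asc j w → i ≤ j
firstAscent-min (a ∷ b ∷ w) eq h with a <ᵇ b in a<b
firstAscent-min (a ∷ b ∷ w) refl h | true = z≤n
firstAscent-min (a ∷ b ∷ w) eq h | false with firstAscent (b ∷ w) in eq′
firstAscent-min (a ∷ b ∷ w) refl (here k)  | false | just i = ⊥-elim (subst T (trans (sym (<ᵇ-true k)) a<b) _)
firstAscent-min (a ∷ b ∷ w) refl (there h) | false | just i = s≤s (firstAscent-min (b ∷ w) eq′ h)

firstAscent-nothing : ∀ w → firstAscent w ≡ nothing → ∀ {i} → ¬ Asc i w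
firstAscent-nothing (a ∷ b ∷ w) eq h with a <ᵇ b in a<b
firstAscent-nothing (a ∷ b ∷ w) () h | true
firstAscent-nothing (a ∷ b ∷ w) eq h | false with firstAscent (b ∷ w) in eq′
firstAscent-nothing (a ∷ b ∷ w) refl (here k)  | false | nothing = subst T (trans (sym (<ᵇ-true k)) a<b) _
firstAscent-nothing (a ∷ b ∷ w) refl (there h) | false | nothing = firstAscent-nothing (b ∷ w) eq′ h
firstAscent-nothing (a ∷ []) eq (there ())

no-asc⇒nothing : ∀ w → (∀ i → ¬ Asc i w) → firstAscent w ≡ nothing
no-asc⇒nothing w h with firstAscent w in eq
... | nothing = refl
... | just i  = ⊥-elim (h i (firstAscent-just w eq))

staircase-stair : ∀ n → staircase n ≡ stair n
staircase-stair zero    = refl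
staircase-stair (suc n) = cong (n ∷_) (trans (VecP.tabulate-cong (λ k → sym (ℕP.∸-+-assoc n 1 (toℕ k)))) (staircase-stair n))

private
  fuel-step : ∀ {N f l} → N ≤ suc f ℕ.+ l → N ≤ f ℕ.+ suc l
  fuel-step {f = f} {l} h = ℕP.≤-trans h (ℕP.≤-reflexive (sym (ℕP.+-suc f l)))

-- A step spends one unit of fuel and lengthens the permutation by one, so the bound on `f + len w`
-- is kept; together with `len<n²` it excludes the default value at zero fuel.
schubAux-fuel : ∀ {n} f f′ w → 1 ≤ n → length w ≡ n → n ℕ.* n ≤ f ℕ.+ len w → n ℕ.* n ≤ f′ ℕ.+ len w →
  schubAux f n w ≡ schubAux f′ n w
schubAux-fuel zero    f′      w p l h h′ = ⊥-elim (ℕP.<⇒≱ (len<n² w p l) h)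
schubAux-fuel (suc f) zero    w p l h h′ = ⊥-elim (ℕP.<⇒≱ (len<n² w p l) h′)
schubAux-fuel (suc f) (suc f′) w p l h h′ with firstAscent w in eq
... | nothing = refl
... | just i rewrite sw-swapAt (firstAscent-just w eq) =
  cong (∂ i) (schubAux-fuel f f′ (sw i w) p (trans (length-sw i w) l) (next h) (next h′))
  where
  next : ∀ {N f} → N ≤ suc f ℕ.+ len w → N ≤ f ℕ.+ len (sw i w)
  next h rewrite len-sw (firstAscent-just w eq) = fuel-step h

𝔖-first : ∀ {n} w {i} → 1 ≤ n → length w ≡ n → firstAscent w ≡ just i → 𝔖 n w ≡ ∂ i (𝔖 n (sw i w))
𝔖-first {suc n} w {i} p l eq rewrite eq | sw-swapAt (firstAscent-just w eq) =
  cong (∂ i) (schubAux-fuel (n ℕ.+ n ℕ.* suc n) (suc n ℕ.* suc n) (sw i w) p (trans (length-sw i w) l)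
    (subst (λ z → suc (n ℕ.+ n ℕ.* suc n) ≤ n ℕ.+ n ℕ.* suc n ℕ.+ z) (sym (len-sw (firstAscent-just w eq)))
      (ℕP.≤-trans (s≤s (ℕP.m≤m+n _ (len w))) (ℕP.≤-reflexive (sym (ℕP.+-suc (n ℕ.+ n ℕ.* suc n) (len w))))))
    (ℕP.m≤m+n _ _))

𝔖-top : ∀ {n} w → 1 ≤ n → firstAscent w ≡ nothing → 𝔖 n w ≡ mono (stair n)
𝔖-top {suc n} w p eq rewrite eq = cong mono (staircase-stair (suc n))

sw-comm : ∀ i d w → let j = suc (suc (i ℕ.+ d)) in sw i (sw j w) ≡ sw j (sw i w)
sw-comm i       d []              = refl
sw-comm zero    d (a ∷ [])        = refl
sw-comm zero    d (a ∷ b ∷ w)     = refl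
sw-comm (suc i) d (a ∷ w)         = cong (a ∷_) (sw-comm i d w)

asc-far : ∀ {i d w} → let j = suc (suc (i ℕ.+ d)) in Asc i w → Asc j w → Asc j (sw i w) × Asc i (sw j w)
asc-far {zero} (here h) (there (there k)) = there (there k) , here h
asc-far {suc i} (there h) (there k) with asc-far h k
... | h′ , k′ = there h′ , there k′

-- The two paths from `w` that sort three neighbouring increasing entries into decreasing order,
-- with every step an ascent, and their common end.
data Braid (i : ℕ) (w : List ℕ) : Set where
  braid : Asc (suc i) (sw i w) → Asc i (sw (suc i) (sw i w)) →
          Asc i (sw (suc i) w) → Asc (suc i) (sw i (sw (suc i) w)) →
          sw i (sw (suc i) (sw i w)) ≡ sw (suc i) (sw i (sw (suc i) w)) → Braid i w

asc-near : ∀ {i w} → Asc i w → Asc (suc i) w → Braid i w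
asc-near (here a<b) (there (here b<c)) =
  braid (there (here a<c)) (here b<c) (here a<c) (there (here a<b)) refl
  where a<c = ℕP.<-trans a<b b<c
asc-near {w = a ∷ w} (there h) (there k) with asc-near h k
... | braid p q r s e = braid (there p) (there q) (there r) (there s) (cong (a ∷_) e)

-- Compare i with the first ascent a, by induction towards w₀. If i = a this is the definition; if i
-- = a + 1, both sides continue to the common end of the two braid paths and `∂-braid` applies;
-- otherwise the two swaps commute and `∂-comm` applies. The induction hypothesis is used only at
-- longer permutations.
𝔖-asc : ∀ {n} i w → 1 ≤ n → length w ≡ n → Asc i w → 𝔖 n w ≋ ∂ i (𝔖 n (sw i w))
𝔖-asc {n} i w 1≤n = go (n ℕ.* n) i w (ℕP.m≤m+n _ _)
  where
  open ≋-Reasoning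
  go : ∀ f i w → n ℕ.* n ≤ f ℕ.+ len w → length w ≡ n → Asc i w → 𝔖 n w ≋ ∂ i (𝔖 n (sw i w))
  go zero    i w N l _   = ⊥-elim (ℕP.<⇒≱ (len<n² w 1≤n l) N)
  go (suc f) i w N l asc with firstAscent w in eq
  ... | nothing = ⊥-elim (firstAscent-nothing w eq asc)
  ... | just a = main (ℕP.m≤n⇒∃[o]m+o≡n (firstAscent-min w eq asc))
    where
    asc-a : Asc a w
    asc-a = firstAscent-just w eq
    ih : ∀ j {v} → len w < len v → length v ≡ n → Asc j v → 𝔖 n v ≋ ∂ j (𝔖 n (sw j v))
    ih j {v} w<v = go f j v (ℕP.≤-trans (fuel-step N) (ℕP.+-monoʳ-≤ f w<v))
    up : ∀ {j v} → len w < len v → Asc j v → len w < len (sw j v)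
    up w<v h rewrite len-sw h = ℕP.m≤n⇒m≤1+n w<v
    up₀ : ∀ {j} → Asc j w → len w < len (sw j w)
    up₀ h rewrite len-sw h = ℕP.≤-refl
    l₁ : ∀ j → length (sw j w) ≡ n
    l₁ j = trans (length-sw j w) l
    l₂ : ∀ j k → length (sw j (sw k w)) ≡ n
    l₂ j k = trans (length-sw j (sw k w)) (l₁ k)
    main : ∃ (λ d → a ℕ.+ d ≡ i) → 𝔖 n w ≋ ∂ i (𝔖 n (sw i w))
    main (zero , refl) rewrite ℕP.+-identityʳ a = ≡⇒≋ (𝔖-first w 1≤n l eq)
    main (suc zero , e) with trans (sym (trans (ℕP.+-suc a 0) (cong suc (ℕP.+-identityʳ a)))) e
    ... | refl with asc-near asc-a asc
    ...   | braid p q r s e = begin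
      𝔖 n w                                                       ≡⟨ 𝔖-first w 1≤n l eq ⟩
      ∂ a (𝔖 n (sw a w))                                          ≈⟨ ≋-cong (∂-linear a) (ih i (up₀ asc-a) (l₁ a) p) ⟩
      ∂ a (∂ i (𝔖 n (sw i (sw a w))))
        ≈⟨ ≋-cong (∘-linear (∂-linear a) (∂-linear i)) (ih a (up (up₀ asc-a) p) (l₂ i a) q) ⟩
      ∂ a (∂ i (∂ a (𝔖 n (sw a (sw i (sw a w))))))                ≡⟨ cong (λ v → ∂ a (∂ i (∂ a (𝔖 n v)))) e ⟩
      ∂ a (∂ i (∂ a (𝔖 n (sw i (sw a (sw i w))))))
        ≈⟨ ∂-braid a (subst (suc i <_) l (adjacent-< asc)) (𝔖 n (sw i (sw a (sw i w)))) ⟩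
      ∂ i (∂ a (∂ i (𝔖 n (sw i (sw a (sw i w))))))
        ≈⟨ ≋-cong (∘-linear (∂-linear i) (∂-linear a)) (ih i (up (up₀ asc) r) (l₂ a i) s) ⟨
      ∂ i (∂ a (𝔖 n (sw a (sw i w))))                             ≈⟨ ≋-cong (∂-linear i) (ih a (up₀ asc) (l₁ i) r) ⟨
      ∂ i (𝔖 n (sw i w)) ∎
    main (suc (suc d) , e) with trans (sym (trans (ℕP.+-suc a (suc d)) (cong suc (ℕP.+-suc a d)))) e
    ... | refl with asc-far asc-a asc
    ...   | p , q = begin
      𝔖 n w                               ≡⟨ 𝔖-first w 1≤n l eq ⟩
      ∂ a (𝔖 n (sw a w))                  ≈⟨ ≋-cong (∂-linear a) (ih i (up₀ asc-a) (l₁ a) p) ⟩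
      ∂ a (∂ i (𝔖 n (sw i (sw a w))))     ≈⟨ ∂-comm a d (subst (suc i <_) l (adjacent-< asc)) (𝔖 n (sw i (sw a w))) ⟩
      ∂ i (∂ a (𝔖 n (sw i (sw a w))))     ≡⟨ cong (λ v → ∂ i (∂ a (𝔖 n v))) (sw-comm a d w) ⟨
      ∂ i (∂ a (𝔖 n (sw a (sw i w))))     ≈⟨ ≋-cong (∂-linear i) (ih a (up₀ asc) (l₁ i) q) ⟨
      ∂ i (𝔖 n (sw i w)) ∎

∂-𝔖-desc : ∀ {n} i w → 1 ≤ n → length w ≡ n → Desc i w → ∂ i (𝔖 n w) ≋ 𝔖 n (sw i w)
∂-𝔖-desc {n} i w p l h = ≋-sym (≋-trans (𝔖-asc i (sw i w) p (trans (length-sw i w) l) (asc-sw h))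
  (≡⇒≋ (cong (λ v → ∂ i (𝔖 n v)) (sw-involutive i w))))

∂-𝔖-asc : ∀ {n} i w → 1 ≤ n → length w ≡ n → Asc i w → ∂ i (𝔖 n w) ≋ []
∂-𝔖-asc {n} i w p l h = ≋-trans (≋-cong (∂-linear i) (𝔖-asc i w p l h)) (∂-∂ i (𝔖 n (sw i w)))

-- Permutations

record Perm (n : ℕ) (w : List ℕ) : Set where
  constructor perm
  field
    size    : length w ≡ n
    entries : All (_< n) w
    unique  : Unique w
open Perm

cartesianProductWith-concatMap : ∀ {A B C : Set} (f : A → B → C) xs ys →
  concatMap (λ a → map (f a) ys) xs ≡ List.cartesianProductWith f xs ys
cartesianProductWith-concatMap f []       ys = refl
cartesianProductWith-concatMap f (x ∷ xs) ys = cong (map (f x) ys ++_) (cartesianProductWith-concatMap f xs ys)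

words-suc : ∀ n k → words n (suc k) ≡ List.cartesianProductWith _∷_ (upTo n) (words n k)
words-suc n k = cartesianProductWith-concatMap _∷_ (upTo n) (words n k)

words-unique : ∀ n k → Unique (words n k)
words-unique n zero    = [] ∷ []
words-unique n (suc k) = subst Unique (sym (words-suc n k))
  (UniqueP.cartesianProductWith⁺ _∷_ LP.∷-injective (UniqueP.upTo⁺ n) (words-unique n k))

∈-words⁻ : ∀ n k {w} → w ∈ words n k → length w ≡ k × All (_< n) w
∈-words⁻ n zero    (here refl) = refl , []
∈-words⁻ n (suc k) {w} w∈ with ∈P.∈-cartesianProductWith⁻ _∷_ (upTo n) (words n k) (subst (w ∈_) (words-suc n k) w∈)
... | a , v , a∈ , v∈ , refl with ∈-words⁻ n k v∈
...   | l , h = cong suc l , ∈P.∈-upTo⁻ a∈ ∷ h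

∈-words⁺ : ∀ n {w} → All (_< n) w → w ∈ words n (length w)
∈-words⁺ n []       = here refl
∈-words⁺ n {a ∷ w} (h ∷ hs) = subst (a ∷ w ∈_) (sym (words-suc n (length w)))
  (∈P.∈-cartesianProductWith⁺ _∷_ (∈P.∈-upTo⁺ h) (∈-words⁺ n hs))

private
  fresh⁻ : ∀ x xs → any (x ≡ᵇ_) xs ≡ false → All (x ≢_) xs
  fresh⁻ x []       h = []
  fresh⁻ x (y ∷ xs) h with x ≡ᵇ y in eq
  ... | false = (λ e → subst T eq (ℕP.≡⇒≡ᵇ x y e)) ∷ fresh⁻ x xs h

  fresh⁺ : ∀ x {xs} → All (x ≢_) xs → any (x ≡ᵇ_) xs ≡ false
  fresh⁺ x []               = refl
  fresh⁺ x {y ∷ xs} (h ∷ hs) with x ≡ᵇ y in eq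
  ... | false = fresh⁺ x hs
  ... | true  = ⊥-elim (h (ℕP.≡ᵇ⇒≡ x y (subst T (sym eq) _)))

distinct⁻ : ∀ w → T (distinct w) → Unique w
distinct⁻ []      _ = []
distinct⁻ (x ∷ w) h with any (x ≡ᵇ_) w in eq
... | false = fresh⁻ x w eq ∷ distinct⁻ w h

distinct⁺ : ∀ {w} → Unique w → T (distinct w)
distinct⁺ []           = _
distinct⁺ {x ∷ w} (h ∷ u) rewrite fresh⁺ x h = distinct⁺ u

isPerm⁻ : ∀ {n w} → IsPerm n w → Perm n w
isPerm⁻ {n} {w} h with ∈P.∈-filter⁻ (T? ∘ distinct) {xs = words n n} h
... | w∈ , d with ∈-words⁻ n n w∈
...   | l , en = perm l en (distinct⁻ w d)

isPerm⁺ : ∀ {n w} → Perm n w → IsPerm n w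
isPerm⁺ {n} {w} (perm l en u) = ∈P.∈-filter⁺ (T? ∘ distinct) (subst (λ k → w ∈ words n k) l (∈-words⁺ n en)) (distinct⁺ u)

perms-unique : ∀ n → Unique (perms n)
perms-unique n = UniqueP.filter⁺ (T? ∘ distinct) (words-unique n n)

All-sw : ∀ {P : ℕ → Set} i {w} → All P w → All P (sw i w)
All-sw i       []           = []
All-sw zero    (p ∷ [])     = p ∷ []
All-sw zero    (p ∷ q ∷ h)  = q ∷ p ∷ h
All-sw (suc i) (p ∷ h)      = p ∷ All-sw i h

Unique-sw : ∀ i {w} → Unique w → Unique (sw i w)
Unique-sw i       []                 = []
Unique-sw zero    (h ∷ [])           = h ∷ []
Unique-sw zero    ((p ∷ h) ∷ k ∷ u)  = ((p ∘ sym) ∷ k) ∷ h ∷ u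
Unique-sw (suc i) (h ∷ u)            = All-sw i h ∷ Unique-sw i u

perm-sw : ∀ {n} i {w} → Perm n w → Perm n (sw i w)
perm-sw i {w} (perm l en u) = perm (trans (length-sw i w) l) (All-sw i en) (Unique-sw i u)

perm-∷ʳ : ∀ {n w} → Perm n w → Perm (suc n) (w ++ n ∷ [])
perm-∷ʳ {n} {w} (perm l en u) = perm
  (trans (LP.length-++ w) (trans (ℕP.+-comm (length w) 1) (cong suc l)))
  (AllP.++⁺ (All.map ℕP.m≤n⇒m≤1+n en) (ℕP.n<1+n n ∷ []))
  (go en u)
  where
  go : ∀ {w} → All (_< n) w → Unique w → Unique (w ++ n ∷ [])
  go []       []      = [] ∷ []
  go (p ∷ en) (h ∷ u) = AllP.++⁺ h (ℕP.<⇒≢ p ∷ []) ∷ go en u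

perm-downFrom : ∀ n → Perm n (downFrom n)
perm-downFrom n = perm (LP.length-downFrom n) (AllP.applyDownFrom⁺₁ id n id) (UniqueP.downFrom⁺ n)

perm-upTo : ∀ n → Perm n (upTo n)
perm-upTo n = perm (LP.length-upTo n) (AllP.applyUpTo⁺₁ id n id) (UniqueP.upTo⁺ n)

module _ {n : ℕ} where
  private
    rev : ℕ → ℕ
    rev a = n ∸ 1 ∸ a

    rev< : ∀ {a} → a < n → rev a < n
    rev< {a} (s≤s _) = s≤s (ℕP.m∸n≤m _ a)

    rev-rev : ∀ {a} → a < n → rev (rev a) ≡ a
    rev-rev (s≤s h) = ℕP.m∸[m∸n]≡n h

  w₀·-involutive : ∀ {w} → All (_< n) w → w₀· n (w₀· n w) ≡ w
  w₀·-involutive []       = refl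
  w₀·-involutive (p ∷ en) = cong₂ _∷_ (rev-rev p) (w₀·-involutive en)

  perm-w₀· : ∀ {w} → Perm n w → Perm n (w₀· n w)
  perm-w₀· {w} (perm l en u) = perm (trans (LP.length-map rev w) l) (AllP.map⁺ (All.map rev< en)) (go en u)
    where
    go : ∀ {w} → All (_< n) w → Unique w → Unique (w₀· n w)
    go []       []      = []
    go (p ∷ en) (h ∷ u) = AllP.map⁺ (All.zipWith (λ (q , ne) e →
      ne (trans (sym (rev-rev p)) (trans (cong rev e) (rev-rev q)))) (en , h)) ∷ go en u

  w₀·-desc : ∀ {i w} → All (_< n) w → Desc i w → Asc i (w₀· n w)
  w₀·-desc (s≤s p ∷ q ∷ en) (here h) = here (ℕP.∸-monoʳ-< h p)
  w₀·-desc (p ∷ en) (there h)    = there (w₀·-desc en h)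

  w₀·-asc : ∀ {i w} → All (_< n) w → Asc i w → Desc i (w₀· n w)
  w₀·-asc (p ∷ s≤s q ∷ en) (here h) = here (ℕP.∸-monoʳ-< h q)
  w₀·-asc (p ∷ en) (there h)        = there (w₀·-asc en h)

w₀·-sw : ∀ n i w → w₀· n (sw i w) ≡ sw i (w₀· n w)
w₀·-sw n i       []          = refl
w₀·-sw n zero    (a ∷ [])    = refl
w₀·-sw n zero    (a ∷ b ∷ w) = refl
w₀·-sw n (suc i) (a ∷ w)     = cong (_ ∷_) (w₀·-sw n i w)

w₀·-upTo : ∀ n → w₀· n (upTo n) ≡ downFrom n
w₀·-upTo n = trans (LP.map-upTo (λ a → n ∸ 1 ∸ a) n) (go n)
  where
  go : ∀ n → applyUpTo (λ a → n ∸ 1 ∸ a) n ≡ downFrom n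
  go zero    = refl
  go (suc n) = cong (n ∷_) (trans (applyUpTo-cong n (λ k _ → sym (ℕP.∸-+-assoc n 1 k))) (go n))

adjacent-cmp : ∀ {n w} i → Unique w → length w ≡ n → suc i < n → Asc i w ⊎ Desc i w
adjacent-cmp {w = a ∷ []}    zero    _              refl (s≤s ())
adjacent-cmp {w = a ∷ b ∷ w} zero    ((a≢b ∷ _) ∷ _) refl _       with ℕP.<-cmp a b
... | tri< h _ _ = inj₁ (here h)
... | tri≈ _ h _ = ⊥-elim (a≢b h)
... | tri> _ _ h = inj₂ (here h)
adjacent-cmp {w = a ∷ w}     (suc i) (_ ∷ u)        refl (s≤s l) with adjacent-cmp i u refl l
... | inj₁ h = inj₁ (there h)
... | inj₂ h = inj₂ (there h)

monotone⇒AllPairs : ∀ {R : ℕ → ℕ → Set} → (∀ {x y z} → R x y → R y z → R x z) → ∀ w →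
  (∀ i → suc i < length w → Adjacent R i w) → AllPairs R w
monotone⇒AllPairs {R} tr w h = Linked⇒AllPairs tr (linked w h)
  where
  head : ∀ {a b w} → Adjacent R 0 (a ∷ b ∷ w) → R a b
  head (here k) = k
  tail : ∀ {i a w} → Adjacent R (suc i) (a ∷ w) → Adjacent R i w
  tail (there k) = k
  linked : ∀ w → (∀ i → suc i < length w → Adjacent R i w) → Linked R w
  linked []          h = []
  linked (a ∷ [])    h = [-]
  linked (a ∷ b ∷ w) h = head (h 0 (s≤s (s≤s z≤n))) ∷ linked (b ∷ w) (λ i l → tail (h (suc i) (s≤s l)))

descending-bound : ∀ {m w} → AllPairs _>_ w → All (_< m) w → length w ≤ m
descending-bound []      []       = z≤n
descending-bound (h ∷ u) (p ∷ en) = ℕP.≤-trans (s≤s (descending-bound u h)) p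

-- The tail consists of n decreasing numbers below the head, so the head is at least n; being an
-- entry of the word, it is at most n.
descending⇒downFrom : ∀ n {w} → AllPairs _>_ w → All (_< n) w → length w ≡ n → w ≡ downFrom n
descending⇒downFrom zero    {[]}    _       _              _    = refl
descending⇒downFrom (suc n) {x ∷ w} (h ∷ u) (s≤s x≤n ∷ en) l with ℕP.≤-antisym x≤n
  (ℕP.≤-trans (ℕP.≤-reflexive (sym (ℕP.suc-injective l))) (descending-bound u h))
... | refl = cong (x ∷_) (descending⇒downFrom x u h (ℕP.suc-injective l))

perm-no-asc : ∀ {n w} → Perm n w → (∀ i → ¬ Asc i w) → w ≡ downFrom n
perm-no-asc {n} {w} (perm l en u) h = descending⇒downFrom n (monotone⇒AllPairs (λ p q → ℕP.<-trans q p) w desc) en l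
  where
  desc : ∀ i → suc i < length w → Desc i w
  desc i k with adjacent-cmp i u refl k
  ... | inj₁ a = ⊥-elim (h i a)
  ... | inj₂ d = d

perm-no-desc : ∀ {n w} → Perm n w → (∀ i → ¬ Desc i w) → w ≡ upTo n
perm-no-desc {n} {w} p h = begin
  w                        ≡⟨ w₀·-involutive (entries p) ⟨
  w₀· n (w₀· n w)          ≡⟨ cong (w₀· n) (perm-no-asc (perm-w₀· p) no-asc) ⟩
  w₀· n (downFrom n)       ≡⟨ cong (w₀· n) (w₀·-upTo n) ⟨
  w₀· n (w₀· n (upTo n))   ≡⟨ w₀·-involutive (entries (perm-upTo n)) ⟩
  upTo n ∎
  where
  open ≡-Reasoning
  no-asc : ∀ i → ¬ Asc i (w₀· n w)
  no-asc i a with adjacent-cmp i (unique p) (size p) (subst (suc i <_) (size (perm-w₀· p)) (adjacent-< a))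
  ... | inj₂ d = h i d
  ... | inj₁ a′ = asc-desc a (w₀·-asc (entries p) a′)

findDesc : ∀ w → (∃[ i ] Desc i w) ⊎ (∀ i → ¬ Desc i w)
findDesc []          = inj₂ λ _ ()
findDesc (a ∷ [])    = inj₂ λ { _ (there ()) }
findDesc (a ∷ b ∷ w) with b ℕP.<? a | findDesc (b ∷ w)
... | yes h | _            = inj₁ (0 , here h)
... | no _  | inj₁ (i , h) = inj₁ (suc i , there h)
... | no h  | inj₂ k       = inj₂ λ { _ (here l) → h l ; (suc i) (there l) → k i l }

desc-downFrom : ∀ {n} i → suc i < n → Desc i (downFrom n)
desc-downFrom {suc (suc n)} zero    _       = here (ℕP.n<1+n n)
desc-downFrom {suc zero}    zero    (s≤s ())
desc-downFrom {suc n}       (suc i) (s≤s h) = there (desc-downFrom i h)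

firstAscent-downFrom : ∀ n → firstAscent (downFrom n) ≡ nothing
firstAscent-downFrom n = no-asc⇒nothing (downFrom n) λ i h →
  asc-desc h (desc-downFrom i (subst (suc i <_) (LP.length-downFrom n) (adjacent-< h)))

𝔖-downFrom : ∀ {n} → 1 ≤ n → 𝔖 n (downFrom n) ≡ mono (stair n)
𝔖-downFrom {n} p = 𝔖-top (downFrom n) p (firstAscent-downFrom n)

perm-top : ∀ {n w} → Perm n w → firstAscent w ≡ nothing → w ≡ downFrom n
perm-top {w = w} p eq = perm-no-asc p (λ i → firstAscent-nothing w eq)

All-· : ∀ {n} {P : Mono n → Set} c {p : Poly n} → All (P ∘ proj₂) p → All (P ∘ proj₂) (c · p)
All-· c = AllP.map⁺

-- Properties are tracked for all listed terms, including terms that cancel. This is stronger than a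
-- statement about nonzero coefficients and passes through concatenation without examining
-- cancellation.
All-∂ : ∀ {n} {P Q : Mono n → Set} i → (∀ {m} → P m → All (Q ∘ proj₂) (ddMono i m)) →
  ∀ {p : Poly n} → All (P ∘ proj₂) p → All (Q ∘ proj₂) (∂ i p)
All-∂         i h []       = []
All-∂ {Q = Q} i h {(c , m) ∷ p} (k ∷ ks) = AllP.++⁺ (All-· {P = Q} c (h k)) (All-∂ {Q = Q} i h ks)

ddMono-sum : ∀ {n} i (m : Mono n) → All (λ t → suc (Vec.sum (proj₂ t)) ≡ Vec.sum m) (ddMono i m)
ddMono-sum zero    []          = []
ddMono-sum zero    (a ∷ [])    = []
ddMono-sum zero    (a ∷ b ∷ r) = AllP.++⁺
  (AllP.map⁺ (AllP.applyUpTo⁺₁ id (a ∸ b) λ {j} → term a b j))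
  (AllP.map⁺ (AllP.applyUpTo⁺₁ id (b ∸ a) λ {j} j< → trans (term b a j j<) (rearrange b a (Vec.sum r))))
  where
  rearrange : ∀ b a s → b ℕ.+ (a ℕ.+ s) ≡ a ℕ.+ (b ℕ.+ s)
  rearrange = ℕSolver.solve-∀
  collect : ∀ b j c s → suc (b ℕ.+ j ℕ.+ (c ℕ.+ s)) ≡ suc (j ℕ.+ c) ℕ.+ (b ℕ.+ s)
  collect = ℕSolver.solve-∀
  term : ∀ a b j → j < a ∸ b → suc (b ℕ.+ j ℕ.+ (a ∸ 1 ∸ j ℕ.+ Vec.sum r)) ≡ a ℕ.+ (b ℕ.+ Vec.sum r)
  term a b j j< = trans (collect b j (a ∸ 1 ∸ j) (Vec.sum r)) (cong (ℕ._+ (b ℕ.+ Vec.sum r))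
    (trans (cong (suc j ℕ.+_) (ℕP.∸-+-assoc a 1 j)) (ℕP.m+[n∸m]≡n (ℕP.≤-trans j< (ℕP.m∸n≤m a b)))))
ddMono-sum (suc i) []      = []
ddMono-sum (suc i) (a ∷ m) = AllP.map⁺ (All.map (λ {t} h → trans (sym (ℕP.+-suc a _)) (cong (a ℕ.+_) h)) (ddMono-sum i m))

-- Stability and duality

len-downFrom : ∀ n → len (downFrom n) ≡ Vec.sum (stair n)
len-downFrom zero    = refl
len-downFrom (suc n) = cong₂ ℕ._+_
  (trans (cong length (LP.filter-all (T? ∘ (_<ᵇ n)) (AllP.applyDownFrom⁺₁ id n ℕP.<⇒<ᵇ))) (LP.length-downFrom n))
  (len-downFrom n)

𝔖-degree : ∀ {n w} → Perm n w → All (λ t → Vec.sum (proj₂ t) ≡ len w) (𝔖 n w)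
𝔖-degree {n} = go (n ℕ.* n)
  where
  go : ∀ f {w} → Perm n w → All (λ t → Vec.sum (proj₂ t) ≡ len w) (schubAux f n w)
  go zero    p = []
  go (suc f) {w} p with firstAscent w in eq
  ... | nothing rewrite perm-top p eq | staircase-stair n = sym (len-downFrom n) ∷ []
  ... | just i rewrite sw-swapAt (firstAscent-just w eq) =
    All-∂ {P = λ m → Vec.sum m ≡ len (sw i w)} {λ m → Vec.sum m ≡ len w} i
      (λ {m} h → All.map (λ k → ℕP.suc-injective (trans k (trans h (len-sw (firstAscent-just w eq))))) (ddMono-sum i m))
      (go f (perm-sw i p))

-- Passing to one more variable

pad : ∀ {n} → Poly n → Poly (suc n)
pad = mapM (_∷ʳ 0)

pad-linear : ∀ {n} → Linear (pad {n})
pad-linear = mapM-linear (_∷ʳ 0)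

ddMono-pad : ∀ {n} i (m : Mono n) → suc i < n → ddMono i (m ∷ʳ 0) ≡ pad (ddMono i m)
ddMono-pad zero    (a ∷ [])    (s≤s ())
ddMono-pad zero    (a ∷ b ∷ r) _ = sym (trans (LP.map-++ _ (map _ (upTo (a ∸ b))) (map _ (upTo (b ∸ a))))
  (cong₂ _++_ (sym (LP.map-∘ (upTo (a ∸ b)))) (sym (LP.map-∘ (upTo (b ∸ a))))))
ddMono-pad (suc i) (a ∷ m) (s≤s h) = begin
  ddMono (suc i) (a ∷ (m ∷ʳ 0))      ≡⟨ ddMono-suc i a (m ∷ʳ 0) ⟩
  mapM (a ∷_) (ddMono i (m ∷ʳ 0))    ≡⟨ cong (mapM (a ∷_)) (ddMono-pad i m h) ⟩
  mapM (a ∷_) (pad (ddMono i m))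
    ≡⟨ trans (mapM-∘ (a ∷_) (_∷ʳ 0) (ddMono i m)) (sym (mapM-∘ (_∷ʳ 0) (a ∷_) (ddMono i m))) ⟩
  pad (mapM (a ∷_) (ddMono i m))     ≡⟨ cong pad (ddMono-suc i a m) ⟨
  pad (ddMono (suc i) (a ∷ m)) ∎
  where open ≡-Reasoning

∂-pad : ∀ {n} i → suc i < n → (p : Poly n) → ∂ i (pad p) ≋ pad (∂ i p)
∂-pad i h = linear-ext (∘-linear (∂-linear i) pad-linear) (∘-linear pad-linear (∂-linear i))
  λ m → ≋-trans (∂-mono i (m ∷ʳ 0)) (≋-trans (≡⇒≋ (ddMono-pad i m h)) (≋-cong pad-linear (≋-sym (∂-mono i m))))

𝟏-∷ʳ : ∀ n → 𝟏 {n} ∷ʳ 0 ≡ 𝟏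
𝟏-∷ʳ zero    = refl
𝟏-∷ʳ (suc n) = cong (0 ∷_) (𝟏-∷ʳ n)

inc-∷ʳ : ∀ {n} j (m : Mono n) → j < n → inc j m ∷ʳ 0 ≡ inc j (m ∷ʳ 0)
inc-∷ʳ zero    (a ∷ m) _       = refl
inc-∷ʳ (suc j) (a ∷ m) (s≤s h) = cong (a ∷_) (inc-∷ʳ j m h)

pad-X : ∀ {n} j → j < n → (p : Poly n) → pad (X j p) ≡ X j (pad p)
pad-X j h p = trans (mapM-∘ (_∷ʳ 0) (inc j) p) (trans (mapM-cong (λ m → inc-∷ʳ j m h) p) (sym (mapM-∘ (inc j) (_∷ʳ 0) p)))

pad-⊗ : ∀ {n} (p q : Poly n) → pad (p ⊗ q) ≋ pad p ⊗ pad q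
pad-⊗ {n} p q = linear-ind (∘-linear pad-linear (⊗-linearˡ q)) (∘-linear (⊗-linearˡ (pad q)) pad-linear)
  (begin
    pad (mono 𝟏 ⊗ q)          ≈⟨ ≋-cong pad-linear (1-⊗ q) ⟩
    pad q                     ≈⟨ 1-⊗ (pad q) ⟨
    mono 𝟏 ⊗ pad q            ≡⟨ cong (λ m → mono m ⊗ pad q) (𝟏-∷ʳ n) ⟨
    pad (mono 𝟏) ⊗ pad q      ∎)
  (λ j p h ih → begin
    pad (X j p ⊗ q)           ≈⟨ ≋-cong pad-linear (X-⊗ j p q) ⟩
    pad (X j (p ⊗ q))         ≡⟨ pad-X j h (p ⊗ q) ⟩
    X j (pad (p ⊗ q))         ≈⟨ ≋-cong (X-linear j) ih ⟩
    X j (pad p ⊗ pad q)       ≈⟨ X-⊗ j (pad p) (pad q) ⟨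
    X j (pad p) ⊗ pad q       ≡⟨ cong (_⊗ pad q) (pad-X j h p) ⟨
    pad (X j p) ⊗ pad q       ∎) p
  where open ≋-Reasoning

constant-pad : ∀ {n} (p : Poly n) → constant (pad p) ≡ constant p
constant-pad [] = refl
constant-pad {n} ((c , m) ∷ p) with m ≟M 𝟏 | (m ∷ʳ 0) ≟M 𝟏
... | yes _ | yes _ = cong (ℤ._+_ c) (constant-pad p)
... | no _  | no _  = constant-pad p
... | yes e | no ne = ⊥-elim (ne (trans (cong (_∷ʳ 0) e) (𝟏-∷ʳ n)))
... | no ne | yes e = ⊥-elim (ne (VecP.∷ʳ-injectiveˡ m 𝟏 (trans e (sym (𝟏-∷ʳ n)))))

-- The chain from w₀ ∈ Σ_{n+1} (p = 0) to w₀ ∈ Σ_n extended by a fixed point (p = n); each of these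
-- permutations is dominant, and its Schubert polynomial is the monomial given by its code.
insertMax : ℕ → ℕ → ℕ → List ℕ
insertMax t n       zero    = t ∷ downFrom n
insertMax t zero    (suc p) = t ∷ []
insertMax t (suc n) (suc p) = n ∷ insertMax t n p

insertMax-code : ∀ n → ℕ → Mono (suc n)
insertMax-code n       zero    = n ∷ stair n
insertMax-code zero    (suc p) = 0 ∷ []
insertMax-code (suc n) (suc p) = n ∷ insertMax-code n p

insertMax-asc : ∀ {t} n p → n ≤ t → p < n → Asc p (insertMax t n (suc p))
insertMax-asc (suc n) zero    h _       = here h
insertMax-asc (suc n) (suc p) h (s≤s l) = there (insertMax-asc n p (ℕP.<⇒≤ h) l)

insertMax-sw : ∀ t n p → p < n → sw p (insertMax t n (suc p)) ≡ insertMax t n p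
insertMax-sw t (suc n) zero    _       = refl
insertMax-sw t (suc n) (suc p) (s≤s h) = cong (n ∷_) (insertMax-sw t n p h)

insertMax-inc : ∀ n p → p < n → inc p (insertMax-code n (suc p)) ≡ insertMax-code n p
insertMax-inc (suc n) zero    _       = refl
insertMax-inc (suc n) (suc p) (s≤s h) = cong (n ∷_) (insertMax-inc n p h)

insertMax-level : ∀ n p → p < n → Level p (insertMax-code n (suc p))
insertMax-level (suc n) zero    _       = here
insertMax-level (suc n) (suc p) (s≤s h) = there (insertMax-level n p h)

insertMax-length : ∀ t n p → p ≤ n → length (insertMax t n p) ≡ suc n
insertMax-length t n       zero    _       = cong suc (LP.length-downFrom n)
insertMax-length t (suc n) (suc p) (s≤s h) = cong suc (insertMax-length t n p h)

insertMax-end : ∀ t n → insertMax t n n ≡ downFrom n ++ t ∷ []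
insertMax-end t zero    = refl
insertMax-end t (suc n) = cong (n ∷_) (insertMax-end t n)

insertMax-code-end : ∀ n → insertMax-code n n ≡ stair n ∷ʳ 0
insertMax-code-end zero    = refl
insertMax-code-end (suc n) = cong (n ∷_) (insertMax-code-end n)

-- By `insertMax-inc` and `insertMax-level`, each step applies ∂_p to x_p times an s_p-invariant
-- monomial, and so merely divides by x_p.
𝔖-insertMax : ∀ n p → p ≤ n → 𝔖 (suc n) (insertMax n n p) ≋ mono (insertMax-code n p)
𝔖-insertMax n zero    _ = ≡⇒≋ (𝔖-downFrom {suc n} (s≤s z≤n))
𝔖-insertMax n (suc p) h = begin
  𝔖 (suc n) (insertMax n n (suc p))
    ≈⟨ 𝔖-asc p _ (s≤s z≤n) (insertMax-length n n (suc p) h) (insertMax-asc n p ℕP.≤-refl h) ⟩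
  ∂ p (𝔖 (suc n) (sw p (insertMax n n (suc p)))) ≡⟨ cong (λ w → ∂ p (𝔖 (suc n) w)) (insertMax-sw n n p h) ⟩
  ∂ p (𝔖 (suc n) (insertMax n n p))              ≈⟨ ≋-cong (∂-linear p) (𝔖-insertMax n p (ℕP.<⇒≤ h)) ⟩
  ∂ p (mono (insertMax-code n p))                ≡⟨ cong (∂ p ∘ mono) (insertMax-inc n p h) ⟨
  ∂ p (mono (inc p (insertMax-code n (suc p))))  ≈⟨ ∂-X-level (s≤s h) (insertMax-level n p h) ⟩
  mono (insertMax-code n (suc p)) ∎
  where open ≋-Reasoning

adjacent-∷ʳ : ∀ {R i w a} → Adjacent R i w → Adjacent R i (w ++ a ∷ [])
adjacent-∷ʳ (here h)  = here h
adjacent-∷ʳ (there h) = there (adjacent-∷ʳ h)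

sw-∷ʳ : ∀ i w a → suc i < length w → sw i (w ++ a ∷ []) ≡ sw i w ++ a ∷ []
sw-∷ʳ zero    (b ∷ c ∷ w) a _       = refl
sw-∷ʳ zero    (b ∷ [])    a (s≤s ())
sw-∷ʳ (suc i) (b ∷ w)     a (s≤s h) = cong (b ∷_) (sw-∷ʳ i w a h)

-- For w = w₀ the chain `insertMax` reaches the extended permutation, and its monomial is the
-- staircase of Σ_n with a zero exponent appended. Below w₀, an ascent of w is still an ascent after
-- the new maximum is appended, and ∂ᵢ commutes with `pad`.
𝔖-stable : ∀ {n w} → 1 ≤ n → Perm n w → 𝔖 (suc n) (w ++ n ∷ []) ≋ pad (𝔖 n w)
𝔖-stable {n} {w} 1≤n pw = go (n ℕ.* n) w (ℕP.m≤m+n _ _) pw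
  where
  open ≋-Reasoning
  go : ∀ f w → n ℕ.* n ≤ f ℕ.+ len w → Perm n w → 𝔖 (suc n) (w ++ n ∷ []) ≋ pad (𝔖 n w)
  go zero    w h p = ⊥-elim (ℕP.<⇒≱ (len<n² w 1≤n (size p)) h)
  go (suc f) w h p with firstAscent w in eq
  ... | nothing rewrite perm-top p eq = begin
    𝔖 (suc n) (downFrom n ++ n ∷ [])    ≡⟨ cong (𝔖 (suc n)) (insertMax-end n n) ⟨
    𝔖 (suc n) (insertMax n n n)         ≈⟨ 𝔖-insertMax n n ℕP.≤-refl ⟩
    mono (insertMax-code n n)           ≡⟨ cong mono (insertMax-code-end n) ⟩
    pad (mono (stair n))                ≡⟨ cong pad (𝔖-downFrom 1≤n) ⟨
    pad (𝔖 n (downFrom n)) ∎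
  ... | just i = begin
    𝔖 (suc n) (w ++ n ∷ [])             ≈⟨ 𝔖-asc i _ (s≤s z≤n) (size (perm-∷ʳ p)) (adjacent-∷ʳ asc) ⟩
    ∂ i (𝔖 (suc n) (sw i (w ++ n ∷ []))) ≡⟨ cong (λ v → ∂ i (𝔖 (suc n) v)) (sw-∷ʳ i w n (adjacent-< asc)) ⟩
    ∂ i (𝔖 (suc n) (sw i w ++ n ∷ []))  ≈⟨ ≋-cong (∂-linear i) (go f (sw i w) h′ (perm-sw i p)) ⟩
    ∂ i (pad (𝔖 n (sw i w)))            ≈⟨ ∂-pad i (subst (suc i <_) (size p) (adjacent-< asc)) (𝔖 n (sw i w)) ⟩
    pad (∂ i (𝔖 n (sw i w)))            ≡⟨ cong pad (𝔖-first w 1≤n (size p) eq) ⟨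
    pad (𝔖 n w) ∎
    where
    asc = firstAscent-just w eq
    h′ : n ℕ.* n ≤ f ℕ.+ len (sw i w)
    h′ rewrite len-sw asc | ℕP.+-suc f (len w) = h

-- The identity of Σ_n is the identity of Σ₁ with fixed points added, and in Σ₁ the staircase
-- monomial is 1.
𝔖-id : ∀ {n} → 1 ≤ n → 𝔖 n (upTo n) ≋ mono 𝟏
𝔖-id {suc zero}    _ = ≋-refl
𝔖-id {suc (suc n)} _ = begin
  𝔖 (suc (suc n)) (upTo (suc (suc n)))             ≡⟨ cong (𝔖 (suc (suc n))) (LP.upTo-∷ʳ (suc n)) ⟨
  𝔖 (suc (suc n)) (upTo (suc n) ++ suc n ∷ [])     ≈⟨ 𝔖-stable (s≤s z≤n) (perm-upTo (suc n)) ⟩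
  pad (𝔖 (suc n) (upTo (suc n)))                   ≈⟨ ≋-cong pad-linear (𝔖-id (s≤s z≤n)) ⟩
  pad (mono 𝟏)                                     ≡⟨ cong mono (𝟏-∷ʳ (suc n)) ⟩
  mono 𝟏 ∎
  where open ≋-Reasoning

-- Functionals given by reduced words

∂* : ∀ {n} → List ℕ → Poly n → Poly n
∂* []      p = p
∂* (i ∷ s) p = ∂* s (∂ i p)

∂*-linear : ∀ {n} s → Linear {n} (∂* s)
∂*-linear []      = id-linear
∂*-linear (i ∷ s) = ∘-linear (∂*-linear s) (∂-linear i)

ideal-∂* : ∀ {n} s {p : Poly n} → Ideal p → Ideal (∂* s p)
ideal-∂* []      h = h
ideal-∂* (i ∷ s) h = ideal-∂* s (ideal-∂ i h)

Λ : ∀ {n} → List ℕ → Poly n → ℤ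
Λ s p = constant (∂* s p)

Λ-cong : ∀ {n} s {p q : Poly n} → p ≋ q → Λ s p ≡ Λ s q
Λ-cong s h = at (≋-cong (∂*-linear s) h) 𝟏

Λ-⊕ : ∀ {n} s (p q : Poly n) → Λ s (p ⊕ q) ≡ Λ s p ℤ.+ Λ s q
Λ-⊕ s p q = trans (at (⊕-homo (∂*-linear s) p q) 𝟏) (coeff-⊕ (∂* s p) _ 𝟏)

Λ-· : ∀ {n} s c (p : Poly n) → Λ s (c · p) ≡ c ℤ.* Λ s p
Λ-· s c p = trans (at (·-homo (∂*-linear s) c p) 𝟏) (coeff-· c (∂* s p) 𝟏)

Λ-⊝ : ∀ {n} s (p q : Poly n) → Λ s (p ⊝ q) ≡ Λ s p ℤ.- Λ s q
Λ-⊝ s p q = trans (at (⊝-homo (∂*-linear s) p q) 𝟏) (coeff-⊝ (∂* s p) (∂* s q) 𝟏)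

Λ-0 : ∀ {n} s {p : Poly n} → p ≋ [] → Λ s p ≡ 0ℤ
Λ-0 s h = trans (Λ-cong s h) (at (0-homo (∂*-linear s)) 𝟏)

Λ-ideal : ∀ {n} s {p : Poly n} → Ideal p → Λ s p ≡ 0ℤ
Λ-ideal s h = constant-ideal (ideal-∂* s h)

-- The word records how `x` is sorted to the identity through descents, so its letters stand in the
-- order in which `∂*` applies them, and each of them shortens the permutation indexing 𝔖_x.
data Reduced (n : ℕ) : List ℕ → List ℕ → Set where
  done : ∀ {x} → x ≡ upTo n → Reduced n x []
  step : ∀ {i x s} → Desc i x → Reduced n (sw i x) s → Reduced n x (i ∷ s)

word : ℕ → List ℕ → List ℕ
word zero    x = []
word (suc f) x with findDesc x
... | inj₁ (i , _) = i ∷ word f (sw i x)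
... | inj₂ _       = []

word-reduced : ∀ {n} f {x} → len x ≤ f → Perm n x → Reduced n x (word f x)
word-reduced zero    {x} h p = done (perm-no-desc p λ i d → ℕP.1+n≰n (ℕP.≤-trans (s≤s z≤n) (subst (_≤ 0) (len-desc d) h)))
word-reduced (suc f) {x} h p with findDesc x
... | inj₂ k       = done (perm-no-desc p k)
... | inj₁ (i , d) = step d (word-reduced f (ℕ.s≤s⁻¹ (subst (_≤ suc f) (len-desc d) h)) (perm-sw i p))

redWord : List ℕ → List ℕ
redWord x = word (len x) x

redWord-reduced : ∀ {n x} → Perm n x → Reduced n x (redWord x)
redWord-reduced p = word-reduced _ ℕP.≤-refl p

module _ {n} (1≤n : 1 ≤ n) where

  Λ-𝔖-same : ∀ {x s} → Reduced n x s → Perm n x → Λ s (𝔖 n x) ≡ 1ℤ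
  Λ-𝔖-same (done refl) p = trans (at (𝔖-id 1≤n) 𝟏) one
    where
    one : constant (mono {n} 𝟏) ≡ 1ℤ
    one with 𝟏 {n} ≟M 𝟏
    ... | yes _ = refl
    ... | no ne = ⊥-elim (ne refl)
  Λ-𝔖-same {x} (step {i} {s = s} d r) p = trans (Λ-cong s (∂-𝔖-desc i x 1≤n (size p) d)) (Λ-𝔖-same r (perm-sw i p))

  -- Each letter is a descent of x. If it is an ascent of y, then ∂ᵢ kills 𝔖_y; if it is a descent
  -- of both, the swapped permutations are still distinct. When x has become the identity, y has a
  -- descent, so 𝔖_y is homogeneous of positive degree and has no constant term.
  Λ-𝔖-diff : ∀ {x s y} → Reduced n x s → Perm n x → Perm n y → x ≢ y → Λ s (𝔖 n y) ≡ 0ℤ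
  Λ-𝔖-diff {y = y} (done e) p q x≢y with findDesc y
  ... | inj₂ k       = ⊥-elim (x≢y (trans e (sym (perm-no-desc q k))))
  ... | inj₁ (i , d) = coeff-absent (All.map (λ {t} → positive {t}) (𝔖-degree q))
    where
    positive : ∀ {t : ℤ × Mono n} → Vec.sum (proj₂ t) ≡ len y → proj₂ t ≢ 𝟏
    positive h refl with trans (sym (sum-𝟏 n)) (trans h (len-desc d))
    ... | ()
  Λ-𝔖-diff {x} {y = y} (step {i} {s = s} d r) p q x≢y
    with adjacent-cmp i (unique q) (size q) (subst (suc i <_) (size p) (adjacent-< d))
  ... | inj₁ a  = Λ-0 s (∂-𝔖-asc i y 1≤n (size q) a)
  ... | inj₂ d′ = trans (Λ-cong s (∂-𝔖-desc i y 1≤n (size q) d′)) (Λ-𝔖-diff r (perm-sw i p) (perm-sw i q)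
    λ e → x≢y (trans (sym (sw-involutive i x)) (trans (cong (sw i) e) (sw-involutive i y))))

  -- The involution g is the identity for the expansion in Σ_N and v ↦ w₀v for the claimed sum; only
  -- the summand with g v = x survives.
  Λ-ΣP : ∀ {x s} → Reduced n x s → Perm n x → (f : List ℕ → ℤ) (g : List ℕ → List ℕ) →
    (∀ {v} → Perm n v → Perm n (g v)) → (∀ {v} → Perm n v → g (g v) ≡ v) →
    Λ s (ΣP (map (λ v → f v · 𝔖 n (g v)) (perms n))) ≡ f (g x)
  Λ-ΣP {x} {s} r p f g perm-g gg = begin
    Λ s (ΣP (map (λ v → f v · 𝔖 n (g v)) (perms n)))               ≡⟨ at (linear-ΣP (∂*-linear s) _ (perms n)) 𝟏 ⟩
    constant (ΣP (map (λ v → ∂* s (f v · 𝔖 n (g v))) (perms n)))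
      ≡⟨ coeff-ΣP-single _ 𝟏 (perms-unique n) (isPerm⁺ (perm-g p)) off ⟩
    Λ s (f (g x) · 𝔖 n (g (g x)))                                  ≡⟨ Λ-· s (f (g x)) _ ⟩
    f (g x) ℤ.* Λ s (𝔖 n (g (g x)))                                ≡⟨ cong (λ v → f (g x) ℤ.* Λ s (𝔖 n v)) (gg p) ⟩
    f (g x) ℤ.* Λ s (𝔖 n x)                                        ≡⟨ cong (f (g x) ℤ.*_) (Λ-𝔖-same r p) ⟩
    f (g x) ℤ.* 1ℤ                                                 ≡⟨ ℤP.*-identityʳ _ ⟩
    f (g x) ∎
    where
    open ≡-Reasoning
    off : ∀ v → IsPerm n v → v ≢ g x → Λ s (f v · 𝔖 n (g v)) ≡ 0ℤ
    off v v∈ ne = trans (Λ-· s (f v) _) (trans (cong (f v ℤ.*_)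
      (Λ-𝔖-diff r p (perm-g (isPerm⁻ v∈)) (λ e → ne (trans (sym (gg (isPerm⁻ v∈))) (sym (cong g e)))))) (ℤP.*-zeroʳ (f v)))

reduced-∷ʳ : ∀ {n x s} → Perm n x → Reduced n x s → Reduced (suc n) (x ++ n ∷ []) s
reduced-∷ʳ {n} p (done refl) = done (LP.upTo-∷ʳ n)
reduced-∷ʳ {n} {x} p (step {i} {s = s} d r) = step (adjacent-∷ʳ d)
  (subst (λ y → Reduced (suc n) y s) (sym (sw-∷ʳ i x n (adjacent-< d))) (reduced-∷ʳ (perm-sw i p) r))

∂*-pad : ∀ {n x s} → Perm n x → Reduced n x s → (f : Poly n) → ∂* s (pad f) ≋ pad (∂* s f)
∂*-pad p (done _) f = ≋-refl
∂*-pad p (step {i} {s = s} d r) f = ≋-trans (≋-cong (∂*-linear s) (∂-pad i (subst (suc i <_) (size p) (adjacent-< d)) f))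
  (∂*-pad (perm-sw i p) r (∂ i f))

ι-suc : ∀ {n N} w → n ≤ N → ι n (suc N) w ≡ ι n N w ++ N ∷ []
ι-suc {n} {N} w h = begin
  w ++ map (n ℕ.+_) (upTo (suc N ∸ n))                ≡⟨ cong (λ k → w ++ map (n ℕ.+_) (upTo k)) (ℕP.+-∸-assoc 1 h) ⟩
  w ++ map (n ℕ.+_) (upTo (suc (N ∸ n)))              ≡⟨ cong (λ l → w ++ map (n ℕ.+_) l) (LP.upTo-∷ʳ (N ∸ n)) ⟨
  w ++ map (n ℕ.+_) (upTo (N ∸ n) ++ (N ∸ n) ∷ [])    ≡⟨ cong (w ++_) (LP.map-++ (n ℕ.+_) (upTo (N ∸ n)) _) ⟩
  w ++ (map (n ℕ.+_) (upTo (N ∸ n)) ++ (n ℕ.+ (N ∸ n)) ∷ []) ≡⟨ LP.++-assoc w _ _ ⟨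
  ι n N w ++ (n ℕ.+ (N ∸ n)) ∷ []                     ≡⟨ cong (λ k → ι n N w ++ k ∷ []) (ℕP.m+[n∸m]≡n h) ⟩
  ι n N w ++ N ∷ [] ∎
  where open ≡-Reasoning

ι-refl : ∀ n w → ι n n w ≡ w
ι-refl n w rewrite ℕP.n∸n≡0 n = LP.++-identityʳ w

perm-ι : ∀ {n N w} → n ≤′ N → Perm n w → Perm N (ι n N w)
perm-ι {n} {w = w} ≤′-refl p rewrite ι-refl n w = p
perm-ι {n} {w = w} (≤′-step h) p rewrite ι-suc w (ℕP.≤′⇒≤ h) = perm-∷ʳ (perm-ι h p)

reduced-ι : ∀ {n N w s} → n ≤′ N → Perm n w → Reduced n w s → Reduced N (ι n N w) s
reduced-ι {n} {w = w} ≤′-refl p r rewrite ι-refl n w = r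
reduced-ι {n} {w = w} (≤′-step h) p r rewrite ι-suc w (ℕP.≤′⇒≤ h) = reduced-∷ʳ (perm-ι h p) (reduced-ι h p r)

-- The letters of `s` act inside the first n variables, so `∂*` commutes with padding, and padding
-- keeps constant terms. The order `≤′` adds the fixed points one at a time.
Λ-stable : ∀ {n N u v w s} → 1 ≤ n → n ≤′ N → Perm n u → Perm n v → Perm n w → Reduced n w s →
  Λ s (𝔖 N (ι n N u) ⊗ 𝔖 N (ι n N v)) ≡ Λ s (𝔖 n u ⊗ 𝔖 n v)
Λ-stable {n} {u = u} {v} 1≤n ≤′-refl pu pv pw r rewrite ι-refl n u | ι-refl n v = refl
Λ-stable {n} {suc N} {u} {v} {w} {s} 1≤n (≤′-step h) pu pv pw r rewrite ι-suc u (ℕP.≤′⇒≤ h) | ι-suc v (ℕP.≤′⇒≤ h) = begin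
  Λ s (𝔖 (suc N) (U ++ N ∷ []) ⊗ 𝔖 (suc N) (V ++ N ∷ []))
    ≡⟨ Λ-cong s (≋-trans (≋-cong (⊗-linearˡ (𝔖 (suc N) (V ++ N ∷ []))) (𝔖-stable 1≤N (perm-ι h pu)))
                         (≋-cong (⊗-linearʳ (pad (𝔖 N U))) (𝔖-stable 1≤N (perm-ι h pv)))) ⟩
  Λ s (pad (𝔖 N U) ⊗ pad (𝔖 N V))   ≡⟨ Λ-cong s (pad-⊗ (𝔖 N U) (𝔖 N V)) ⟨
  Λ s (pad (𝔖 N U ⊗ 𝔖 N V))         ≡⟨ at (∂*-pad (perm-ι h pw) (reduced-ι h pw r) (𝔖 N U ⊗ 𝔖 N V)) 𝟏 ⟩
  constant (pad (∂* s (𝔖 N U ⊗ 𝔖 N V))) ≡⟨ constant-pad (∂* s (𝔖 N U ⊗ 𝔖 N V)) ⟩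
  Λ s (𝔖 N U ⊗ 𝔖 N V)               ≡⟨ Λ-stable 1≤n h pu pv pw r ⟩
  Λ s (𝔖 n u ⊗ 𝔖 n v) ∎
  where
  open ≡-Reasoning
  U = ι n N u
  V = ι n N v
  1≤N : 1 ≤ N
  1≤N = ℕP.≤-trans 1≤n (ℕP.≤′⇒≤ h)

-- Schubert polynomials modulo the ideal

-- An inductive presentation of I plus the span of the Schubert polynomials: stability under
-- operators and equality of functionals are then proved by recursion on how an element was
-- obtained.
data Span {n} : Poly n → Set where
  ideal : ∀ {p} → Ideal p → Span p
  schub : ∀ {w} → Perm n w → Span (𝔖 n w)
  _⊞_   : ∀ {p q} → Span p → Span q → Span (p ⊕ q)
  scale : ∀ c {p} → Span p → Span (c · p)
  respects  : ∀ {p q} → p ≋ q → Span p → Span q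

ideal-⊗ : ∀ {n} {p : Poly n} q → Ideal p → Ideal (p ⊗ q)
ideal-⊗ {n} q = ideal-map (⊗-linearˡ q) λ k r → ⊗-right-comm r (e n (suc k)) q

Λ-·-linear : ∀ {n k} s (q : Poly k) → Linear {n} (λ p → Λ s p · q)
Λ-·-linear s q = record
  { ≋-cong = λ h → ·-congˡ q (Λ-cong s h)
  ; ⊕-homo = λ p p′ → mk λ m → trans (coeff-· (Λ s (p ⊕ p′)) q m) (trans (cong (ℤ._* coeff q m) (Λ-⊕ s p p′))
      (trans (ℤP.*-distribʳ-+ (coeff q m) (Λ s p) (Λ s p′))
      (trans (cong₂ ℤ._+_ (sym (coeff-· (Λ s p) q m)) (sym (coeff-· (Λ s p′) q m))) (sym (coeff-⊕ (Λ s p · q) _ m)))))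
  ; ·-homo = λ c p → ≋-trans (·-congˡ q (Λ-· s c p)) (≋-sym (·-assoc c (Λ s p) q))
  }

-- `linear-ind` compares operators with polynomial values, so the two scalars are carried as
-- multiples of 1 in the polynomial ring in no variables.
Λ-ind : ∀ {n k} s t {L : Poly n → Poly k} → Linear L → Λ s (mono {n} 𝟏) ≡ Λ t (L (mono 𝟏)) →
  (∀ j p → j < n → Λ s p ≡ Λ t (L p) → Λ s (X j p) ≡ Λ t (L (X j p))) → ∀ p → Λ s p ≡ Λ t (L p)
Λ-ind {n} s t {L} l b st p = extract (at (linear-ind (Λ-·-linear s one) (∘-linear (Λ-·-linear t one) l) (·-congˡ one b)
  (λ j p h ih → ·-congˡ one (st j p h (extract (at ih 𝟏)))) p) 𝟏)
  where
  one : Poly 0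
  one = mono 𝟏
  extract : ∀ {a b} → coeff (a · one) 𝟏 ≡ coeff (b · one) 𝟏 → a ≡ b
  extract {a} {b} h = trans (sym (lemma a)) (trans h (lemma b))
    where
    lemma : ∀ a → coeff (a · one) 𝟏 ≡ a
    lemma a = trans (coeff-· a one 𝟏) (ℤP.*-identityʳ a)

constant-X : ∀ {n} j (p : Poly n) → j < n → constant (X j p) ≡ 0ℤ
constant-X j p h = coeff-absent (AllP.map⁺ (All.universal (λ t → inc≢𝟏 j (proj₂ t) h) p))
  where
  inc≢𝟏 : ∀ {n} j (m : Mono n) → j < n → inc j m ≢ 𝟏
  inc≢𝟏 zero    (a ∷ m) _       ()
  inc≢𝟏 (suc j) (a ∷ m) (s≤s h) eq = inc≢𝟏 j m h (VecP.∷-injectiveʳ eq)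

⊗-X : ∀ {n} j (p q : Poly n) → X j p ⊗ q ≋ p ⊗ X j q
⊗-X j p q = begin
  X j p ⊗ q     ≈⟨ X-⊗ j p q ⟩
  X j (p ⊗ q)   ≈⟨ ≋-cong (X-linear j) (⊗-comm p q) ⟩
  X j (q ⊗ p)   ≈⟨ X-⊗ j q p ⟨
  X j q ⊗ p     ≈⟨ ⊗-comm (X j q) p ⟩
  p ⊗ X j q     ∎
  where open ≋-Reasoning

module Duality {n} (1≤n : 1 ≤ n) where

  span-∂ : ∀ i {p : Poly n} → Span p → Span (∂ i p)
  span-∂ i (ideal h) = ideal (ideal-∂ i h)
  span-∂ i (schub {w} p) with suc i ℕP.<? n
  ... | no h  = respects (≡⇒≋ (sym (∂-out i (𝔖 n w) h))) (ideal ideal-0)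
  ... | yes h with adjacent-cmp i (unique p) (size p) h
  ...   | inj₁ a = respects (≋-sym (∂-𝔖-asc i w 1≤n (size p) a)) (ideal ideal-0)
  ...   | inj₂ d = respects (≋-sym (∂-𝔖-desc i w 1≤n (size p) d)) (schub (perm-sw i p))
  span-∂ i (_⊞_ {p} {q} h k) = respects (≋-sym (⊕-homo (∂-linear i) p q)) (span-∂ i h ⊞ span-∂ i k)
  span-∂ i (scale c {p} h)   = respects (≋-sym (·-homo (∂-linear i) c p)) (scale c (span-∂ i h))
  span-∂ i (respects e h)        = respects (≋-cong (∂-linear i) e) (span-∂ i h)

  span-X-𝔖 : ∀ f j w → j < n → n ℕ.* n ≤ f ℕ.+ len w → Perm n w → Span (X j (𝔖 n w))
  span-X-𝔖 zero    j w j<n h p = ⊥-elim (ℕP.<⇒≱ (len<n² w 1≤n (size p)) h)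
  span-X-𝔖 (suc f) j w j<n h p with firstAscent w in eq
  ... | nothing = respects (≡⇒≋ (cong (X j) (sym (𝔖-top w 1≤n eq)))) (ideal (ideal-X-stair j j<n))
  ... | just i  = respects (≋-sym leibniz)
      (span-∂ i (span-X-𝔖 f (σ i j) (sw i w) (σ-< i j i<n j<n) h′ (perm-sw i p)) ⊞ scale (κ i j) (schub (perm-sw i p)))
    where
    open ≋-Reasoning
    asc = firstAscent-just w eq
    i<n : suc i < n
    i<n = subst (suc i <_) (size p) (adjacent-< asc)
    h′ : n ℕ.* n ≤ f ℕ.+ len (sw i w)
    h′ rewrite len-sw asc | ℕP.+-suc f (len w) = h
    S = 𝔖 n (sw i w)
    cancel : ∀ (c : ℤ) (q r : Poly n) → r ≋ (ℤ.- c · q ⊕ r) ⊕ c · q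
    cancel c q r = mk λ m → lemma m
      where
      solve : ∀ c a b → b ≡ (ℤ.- c ℤ.* a ℤ.+ b) ℤ.+ c ℤ.* a
      solve = ℤSolver.solve-∀
      lemma : ∀ m → coeff r m ≡ coeff ((ℤ.- c · q ⊕ r) ⊕ c · q) m
      lemma m rewrite coeff-⊕ (ℤ.- c · q ⊕ r) (c · q) m | coeff-⊕ (ℤ.- c · q) r m | coeff-· (ℤ.- c) q m | coeff-· c q m
        = solve c (coeff q m) (coeff r m)
    -- The rule for ∂ᵢ(x_k S) at k = sᵢ(j), solved for x_j ∂ᵢS; the sign of the constant changes by
    -- `κ-σ`. On the right S belongs to a longer permutation, so the induction applies to it.
    leibniz : X j (𝔖 n w) ≋ ∂ i (X (σ i j) S) ⊕ κ i j · S
    leibniz = begin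
      X j (𝔖 n w)                                                ≡⟨ cong (X j) (𝔖-first w 1≤n (size p) eq) ⟩
      X j (∂ i S)                                                ≈⟨ cancel (κ i j) S (X j (∂ i S)) ⟩
      (ℤ.- κ i j · S ⊕ X j (∂ i S)) ⊕ κ i j · S
        ≈⟨ ⊕-cong (⊕-cong (·-congˡ S (sym (κ-σ i j))) (X-≡ (∂ i S) (sym (σ-involutive i j)))) ≋-refl ⟩
      (κ i (σ i j) · S ⊕ X (σ i (σ i j)) (∂ i S)) ⊕ κ i j · S    ≈⟨ ⊕-cong (∂-X i i<n (σ i j) S) ≋-refl ⟨
      ∂ i (X (σ i j) S) ⊕ κ i j · S ∎

  span-X : ∀ j {p : Poly n} → j < n → Span p → Span (X j p)
  span-X j h (ideal k)          = ideal (ideal-X j k)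
  span-X j h (schub {w} p)      = span-X-𝔖 (n ℕ.* n) j w h (ℕP.m≤m+n _ _) p
  span-X j h (_⊞_ {p} {q} k l)  = respects (≋-sym (⊕-homo (X-linear j) p q)) (span-X j h k ⊞ span-X j h l)
  span-X j h (scale c {p} k)    = respects (≋-sym (·-homo (X-linear j) c p)) (scale c (span-X j h k))
  span-X j h (respects e k)         = respects (≋-cong (X-linear j) e) (span-X j h k)

  span-all : ∀ p → Span p
  span-all []            = ideal ideal-0
  span-all ((c , m) ∷ p) = respects (≡⇒≋ (cong (λ a → (a , m) ∷ p) (ℤP.*-identityʳ c)))
    (scale c (mono-ind (Span ∘ mono) (respects (𝔖-id 1≤n) (schub (perm-upTo n))) (λ j m h → span-X j h) m) ⊞ span-all p)

  -- Two reduced words of x give functionals that both kill the ideal and both take the value δ_{xy}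
  -- on 𝔖_y; since these elements span, the functionals agree.
  Λ-unique : ∀ {x s t} → Reduced n x s → Reduced n x t → Perm n x → ∀ p → Λ s p ≡ Λ t p
  Λ-unique {x} {s} {t} r r′ px p = go (span-all p)
    where
    go : ∀ {p} → Span p → Λ s p ≡ Λ t p
    go (ideal h) = trans (Λ-ideal s h) (sym (Λ-ideal t h))
    go (schub {w} pw) with LP.≡-dec ℕP._≟_ x w
    ... | yes refl = trans (Λ-𝔖-same 1≤n r px) (sym (Λ-𝔖-same 1≤n r′ px))
    ... | no ne    = trans (Λ-𝔖-diff 1≤n r px pw ne) (sym (Λ-𝔖-diff 1≤n r′ px pw ne))
    go (_⊞_ {p} {q} h k) = trans (Λ-⊕ s p q) (trans (cong₂ ℤ._+_ (go h) (go k)) (sym (Λ-⊕ t p q)))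
    go (scale c {p} h)   = trans (Λ-· s c p) (trans (cong (c ℤ.*_) (go h)) (sym (Λ-· t c p)))
    go (respects e h)        = trans (sym (Λ-cong s e)) (trans (go h) (Λ-cong t e))

  expand : Poly n → Poly n
  expand p = ΣP (map (λ v → Λ (redWord v) p · 𝔖 n v) (perms n))

  expand-linear : Linear expand
  expand-linear = ΣP-linear (λ v → Λ-·-linear (redWord v) (𝔖 n v)) (perms n)

  -- `expand` is zero on the ideal and, by duality, fixes each Schubert polynomial; the difference
  -- from the identity therefore lands in the ideal on generators of `Span`, hence everywhere.
  expand-correct : ∀ p → Ideal (p ⊝ expand p)
  expand-correct p = go (span-all p)
    where
    d : Poly n → Poly n
    d p = p ⊝ expand p
    d-linear : Linear d
    d-linear = ⊝-linear id-linear expand-linear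
    go : ∀ {p} → Span p → Ideal (d p)
    go {p} (ideal h) = ideal-⊝ h (ideal-resp (≋-sym (mk λ m → coeff-ΣP-zero _ (perms n) m
      (All.universal (λ v → trans (coeff-· (Λ (redWord v) p) (𝔖 n v) m)
        (cong (ℤ._* coeff (𝔖 n v) m) (Λ-ideal (redWord v) h))) _))) ideal-0)
    go (schub {w} pw) = ideal-resp (≋-sym (mk λ m → trans (coeff-⊝ (𝔖 n w) (expand (𝔖 n w)) m)
      (trans (cong (λ c → coeff (𝔖 n w) m ℤ.- c) (picks m)) (ℤP.+-inverseʳ (coeff (𝔖 n w) m))))) ideal-0
      where
      off : ∀ m v → IsPerm n v → v ≢ w → coeff (Λ (redWord v) (𝔖 n w) · 𝔖 n v) m ≡ 0ℤ
      off m v v∈ ne = trans (coeff-· (Λ (redWord v) (𝔖 n w)) (𝔖 n v) m)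
        (cong (ℤ._* coeff (𝔖 n v) m) (Λ-𝔖-diff 1≤n (redWord-reduced (isPerm⁻ v∈)) (isPerm⁻ v∈) pw ne))
      picks : ∀ m → coeff (expand (𝔖 n w)) m ≡ coeff (𝔖 n w) m
      picks m = trans (coeff-ΣP-single _ m (perms-unique n) (isPerm⁺ pw) (off m))
        (trans (coeff-· (Λ (redWord w) (𝔖 n w)) (𝔖 n w) m)
        (trans (cong (ℤ._* coeff (𝔖 n w) m) (Λ-𝔖-same 1≤n (redWord-reduced pw) pw)) (ℤP.*-identityˡ _)))
    go (_⊞_ {p} {q} h k) = ideal-resp (≋-sym (⊕-homo d-linear p q)) (ideal-⊕ (go h) (go k))
    go (scale c {p} h)   = ideal-resp (≋-sym (·-homo d-linear c p)) (ideal-· c (go h))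
    go (respects e h)        = ideal-resp (≋-cong d-linear e) (go h)

  nondegenerate : ∀ p → (∀ x → Perm n x → Λ (redWord x) p ≡ 0ℤ) → Ideal p
  nondegenerate p h = ideal-resp (mk λ m → trans (coeff-⊝ p (expand p) m)
    (trans (cong (λ c → coeff p m ℤ.- c) (vanish m)) (ℤP.+-identityʳ _))) (expand-correct p)
    where
    vanish : ∀ m → coeff (expand p) m ≡ 0ℤ
    vanish m = coeff-ΣP-zero _ (perms n) m (All.tabulate λ {v} v∈ →
      trans (coeff-· (Λ (redWord v) p) (𝔖 n v) m) (cong (ℤ._* coeff (𝔖 n v) m) (h v (isPerm⁻ v∈))))

  top : List ℕ
  top = redWord (downFrom n)

  -- Every i is a descent of w₀, so by `Λ-unique` the functional can be computed with ∂ᵢ applied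
  -- first. As ∂ᵢp and ∂ᵢq are sᵢ-invariant, ∂ᵢ sends both products to ∂ᵢp ∂ᵢq.
  Λ-top-adjoint : ∀ i → suc i < n → ∀ p q → Λ top (∂ i p ⊗ q) ≡ Λ top (p ⊗ ∂ i q)
  Λ-top-adjoint i h p q = begin
    Λ top (∂ i p ⊗ q)               ≡⟨ through (∂ i p ⊗ q) ⟩
    Λ t (∂ i (∂ i p ⊗ q))           ≡⟨ Λ-cong t both ⟩
    Λ t (∂ i (p ⊗ ∂ i q))           ≡⟨ through (p ⊗ ∂ i q) ⟨
    Λ top (p ⊗ ∂ i q) ∎
    where
    open ≡-Reasoning
    t = redWord (sw i (downFrom n))
    through : ∀ f → Λ top f ≡ Λ t (∂ i f)
    through = Λ-unique (redWord-reduced (perm-downFrom n))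
      (step (desc-downFrom i h) (redWord-reduced (perm-sw i (perm-downFrom n)))) (perm-downFrom n)
    both : ∂ i (∂ i p ⊗ q) ≋ ∂ i (p ⊗ ∂ i q)
    both = ≋-trans (≋-cong (∂-linear i) (⊗-comm (∂ i p) q)) (≋-trans (∂-⊗ i (∂-∂ i p) q)
      (≋-trans (⊗-comm (∂ i q) (∂ i p)) (≋-sym (∂-⊗ i (∂-∂ i q) p))))

  -- For x = id it says that the constant term of p is Λ_{w₀}(p x^δ): at p = 1 both are 1, and a
  -- factor x_j makes the left side zero and puts the product on the right into the ideal. Each
  -- further letter moves across by adjointness and turns 𝔖_{w₀xsᵢ} into 𝔖_{w₀x}, because left
  -- multiplication by w₀ exchanges ascents and descents.
  Λ-as-pairing : ∀ {x s} → Reduced n x s → Perm n x → ∀ p → Λ s p ≡ Λ top (p ⊗ 𝔖 n (w₀· n x))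
  Λ-as-pairing (done refl) px rewrite w₀·-upTo n | 𝔖-downFrom 1≤n = Λ-ind [] top (⊗-linearˡ D)
    (trans (trans (sym (at (𝔖-id 1≤n) 𝟏)) (Λ-𝔖-same 1≤n (done refl) (perm-upTo n)))
      (trans (sym (Λ-𝔖-same 1≤n (redWord-reduced (perm-downFrom n)) (perm-downFrom n)))
        (Λ-cong top (≋-trans (≡⇒≋ (𝔖-downFrom 1≤n)) (≋-sym (1-⊗ D))))))
    (λ j p h _ → trans (constant-X j p h) (sym (trans
      (Λ-cong top (≋-trans (⊗-X j p D) (⊗-comm p (X j D))))
      (Λ-ideal top (ideal-⊗ p (ideal-X-stair j h))))))
    where
    D = mono (stair n)
  Λ-as-pairing {x} (step {i} {s = s} d r) px p = begin
    Λ s (∂ i p)                                   ≡⟨ Λ-as-pairing r (perm-sw i px) (∂ i p) ⟩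
    Λ top (∂ i p ⊗ 𝔖 n (w₀· n (sw i x)))          ≡⟨ Λ-top-adjoint i (subst (suc i <_) (size px) (adjacent-< d)) p _ ⟩
    Λ top (p ⊗ ∂ i (𝔖 n (w₀· n (sw i x))))        ≡⟨ Λ-cong top (≋-cong (⊗-linearʳ p) lower) ⟩
    Λ top (p ⊗ 𝔖 n (w₀· n x)) ∎
    where
    open ≡-Reasoning
    y = w₀· n x
    lower : ∂ i (𝔖 n (w₀· n (sw i x))) ≋ 𝔖 n y
    lower rewrite w₀·-sw n i x = ≋-sym (𝔖-asc i y 1≤n (size (perm-w₀· px)) (w₀·-desc (entries px) d))

  -- Both sides are `Λ top` of one triple product, with factors p, 𝔖_{w₀w} and 𝔖_{w₀x}.
  Λ-exchange : ∀ {x w s t} → Perm n x → Perm n w → Reduced n x s → Reduced n w t → ∀ p →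
    Λ s (p ⊗ 𝔖 n (w₀· n w)) ≡ Λ t (p ⊗ 𝔖 n (w₀· n x))
  Λ-exchange {x} {w} {s} {t} px pw r r′ p = begin
    Λ s (p ⊗ 𝔖 n (w₀· n w))                          ≡⟨ Λ-as-pairing r px _ ⟩
    Λ top ((p ⊗ 𝔖 n (w₀· n w)) ⊗ 𝔖 n (w₀· n x))      ≡⟨ Λ-cong top (⊗-right-comm p (𝔖 n (w₀· n w)) (𝔖 n (w₀· n x))) ⟩
    Λ top ((p ⊗ 𝔖 n (w₀· n x)) ⊗ 𝔖 n (w₀· n w))      ≡⟨ Λ-as-pairing r′ pw _ ⟨
    Λ t (p ⊗ 𝔖 n (w₀· n x)) ∎
    where open ≡-Reasoning

-- The congruence modulo the ideal

skewSum : (n N : ℕ) → (List ℕ → List ℕ → ℤ) → List ℕ → Poly n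
skewSum n N c w = ΣP (map (λ v → c v (ι n N w) · 𝔖 n (w₀· n v)) (perms n))

skew-congruence : ∀ {n N u w} c → 1 ≤ n → n ≤ N → Perm n u → Perm n w → IsLRExpansion n N u c →
  Ideal (𝔖 n u ⊗ 𝔖 n (w₀· n w) ⊝ skewSum n N c w)
skew-congruence {n} {N} {u} {w} c 1≤n n≤N pu pw lr = nondegenerate _ vanish
  where
  open Duality 1≤n
  open ≡-Reasoning
  n≤′N = ℕP.≤⇒≤′ n≤N
  r = redWord-reduced pw
  coefficient : ∀ {v} → Perm n v → c v (ι n N w) ≡ Λ (redWord w) (𝔖 n u ⊗ 𝔖 n v)
  coefficient {v} pv = begin
    c v (ι n N w)
      -- The chosen reduced word of `w` is also one of its image in Σ_N, so the same functional, now
      -- on N variables, reads the coefficient off the given expansion.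
      ≡⟨ Λ-ΣP (ℕP.≤-trans 1≤n n≤N) (reduced-ι n≤′N pw r) (perm-ι n≤′N pw) (c v) id id (λ _ → refl) ⟨
    Λ (redWord w) (ΣP (map (λ w′ → c v w′ · 𝔖 N w′) (perms N)))
      ≡⟨ Λ-cong (redWord w) (mk (lr v (isPerm⁺ pv))) ⟨
    Λ (redWord w) (𝔖 N (ι n N u) ⊗ 𝔖 N (ι n N v))
      ≡⟨ Λ-stable 1≤n n≤′N pu pv pw r ⟩
    Λ (redWord w) (𝔖 n u ⊗ 𝔖 n v) ∎
  vanish : ∀ x → Perm n x → Λ (redWord x) (𝔖 n u ⊗ 𝔖 n (w₀· n w) ⊝ skewSum n N c w) ≡ 0ℤ
  vanish x px = trans (Λ-⊝ s _ (skewSum n N c w)) (ℤP.i≡j⇒i-j≡0 (begin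
    Λ s (𝔖 n u ⊗ 𝔖 n (w₀· n w))                ≡⟨ Λ-exchange px pw (redWord-reduced px) r (𝔖 n u) ⟩
    Λ (redWord w) (𝔖 n u ⊗ 𝔖 n (w₀· n x))      ≡⟨ coefficient (perm-w₀· px) ⟨
    c (w₀· n x) (ι n N w)
      ≡⟨ Λ-ΣP 1≤n (redWord-reduced px) px (λ v → c v (ι n N w)) (w₀· n) perm-w₀·
                                                     (λ p → w₀·-involutive (entries p)) ⟨
    Λ s (skewSum n N c w) ∎))
    where
    s = redWord x

-- Normal forms

Substaircase : ∀ {n} → Mono n → Set
Substaircase {zero}  []      = ⊤
Substaircase {suc n} (a ∷ m) = a ≤ n × Substaircase m

stair-substaircase : ∀ n → Substaircase (stair n)
stair-substaircase zero    = _
stair-substaircase (suc n) = ℕP.≤-refl , stair-substaircase n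

-- All new exponents are at most the larger of the two old ones minus one, while the bound on the
-- second variable is just one less than the bound on the first.
ddMono-substaircase : ∀ {n} i (m : Mono n) → Substaircase m → All (Substaircase ∘ proj₂) (ddMono i m)
ddMono-substaircase zero    []          _ = []
ddMono-substaircase zero    (a ∷ [])    _ = []
ddMono-substaircase {suc (suc n)} zero (a ∷ b ∷ r) (a≤ , b≤ , h) = AllP.++⁺
  (AllP.map⁺ (AllP.applyUpTo⁺₁ id (a ∸ b) λ {j} j< →
    ℕP.≤-trans (ℕP.<⇒≤ (bound a b j j<)) a≤ , ℕP.≤-trans (ℕP.m∸n≤m (a ∸ 1) j) (ℕP.∸-monoˡ-≤ 1 a≤) , h))
  (AllP.map⁺ (AllP.applyUpTo⁺₁ id (b ∸ a) λ {j} j< →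
    ℕP.≤-trans (ℕP.<⇒≤ (bound b a j j<)) (ℕP.m≤n⇒m≤1+n b≤) , ℕP.≤-trans (ℕP.m∸n≤m (b ∸ 1) j) (ℕP.≤-trans (ℕP.m∸n≤m b 1) b≤) , h))
  where
  bound : ∀ a b j → j < a ∸ b → b ℕ.+ j < a
  bound a b j h = ℕP.<-≤-trans (ℕP.+-monoʳ-< b h) (ℕP.≤-reflexive (ℕP.m+[n∸m]≡n (ℕP.<⇒≤ (ℕP.m∸n≢0⇒n<m {a} {b} (ℕP.m<n⇒n≢0 h)))))
ddMono-substaircase (suc i) []      _        = []
ddMono-substaircase (suc i) (a ∷ m) (a≤ , h) = AllP.map⁺ (All.map (a≤ ,_) (ddMono-substaircase i m h))

𝔖-substaircase : ∀ n w → All (Substaircase ∘ proj₂) (𝔖 n w)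
𝔖-substaircase n = go (n ℕ.* n)
  where
  go : ∀ f w → All (Substaircase ∘ proj₂) (schubAux f n w)
  go zero    w = []
  go (suc f) w with firstAscent w
  ... | nothing = subst Substaircase (sym (staircase-stair n)) (stair-substaircase n) ∷ []
  ... | just i  = All-∂ {P = Substaircase} {Substaircase} i (λ {m} → ddMono-substaircase i m) (go f (swapAt i (suc i) w))

skewSum-substaircase : ∀ n N c w → All (Substaircase ∘ proj₂) (skewSum n N c w)
skewSum-substaircase n N c w = go (perms n)
  where
  go : ∀ vs → All (Substaircase ∘ proj₂) (ΣP (map (λ v → c v (ι n N w) · 𝔖 n (w₀· n v)) vs))
  go []       = []
  go (v ∷ vs) = AllP.++⁺ (All-· {P = Substaircase} (c v (ι n N w)) (𝔖-substaircase n (w₀· n v))) (go vs)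

coeff-support : ∀ {n} {P : Mono n → Set} {p : Poly n} {m} → All (P ∘ proj₂) p → coeff p m ≢ 0ℤ → P m
coeff-support []       h = ⊥-elim (h refl)
coeff-support {p = (c , m′) ∷ p} {m} (k ∷ ks) h with m′ ≟M m
... | yes refl = k
... | no _     = coeff-support ks h

substaircase-∣M : ∀ {n} (a b : Mono n) → a ∣M b → Substaircase b → Substaircase a
substaircase-∣M []      []      (_ , _)         _        = _
substaircase-∣M (x ∷ a) (y ∷ b) (z ∷ c , eq)    (h , hs) with VecP.∷-injective eq
... | refl , eq′ = ℕP.≤-trans (ℕP.m≤m+n x z) h , substaircase-∣M a b (c , eq′) hs

-- The operators on the last variables act first: if b first differs from a in a larger exponent, the rest of
-- x^b has too small a degree to survive them.
run : ℕ → List ℕ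
run zero    = []
run (suc a) = 0 ∷ map suc (run a)

-- For a substaircase `m` this is a reduced word of the permutation with Lehmer code `m`: the tail
-- is sorted first, and then the first entry, of value a, is carried a places to the right by
-- `run a`.
codeWord : ∀ {n} → Mono n → List ℕ
codeWord []      = []
codeWord (a ∷ m) = map suc (codeWord m) ++ run a

length-run : ∀ a → length (run a) ≡ a
length-run zero    = refl
length-run (suc a) = cong suc (trans (LP.length-map suc (run a)) (length-run a))

length-codeWord : ∀ {n} (m : Mono n) → length (codeWord m) ≡ Vec.sum m
length-codeWord []      = refl
length-codeWord (a ∷ m) = trans (LP.length-++ (map suc (codeWord m))) (trans
  (cong₂ ℕ._+_ (trans (LP.length-map suc (codeWord m)) (length-codeWord m)) (length-run a)) (ℕP.+-comm (Vec.sum m) a))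

∂*-++ : ∀ {n} s t (p : Poly n) → ∂* (s ++ t) p ≡ ∂* t (∂* s p)
∂*-++ []      t p = refl
∂*-++ (i ∷ s) t p = ∂*-++ s t (∂ i p)

∂*-map-suc : ∀ {n} s a (p : Poly n) → ∂* (map suc s) (mapM (a ∷_) p) ≋ mapM (a ∷_) (∂* s p)
∂*-map-suc []      a p = ≋-refl
∂*-map-suc (i ∷ s) a p = ≋-trans (≋-cong (∂*-linear (map suc s)) (∂-mapM-∷ i a p)) (∂*-map-suc s a (∂ i p))

∂-X₀ : ∀ {n} i (p : Poly n) → ∂ (suc i) (X 0 p) ≋ X 0 (∂ (suc i) p)
∂-X₀ {n} i p with suc (suc i) ℕP.<? n
... | yes h = ≋-trans (∂-X (suc i) h 0 p) (⊕-cong (0· p) ≋-refl)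
... | no h  = ≋-trans (≡⇒≋ (∂-out (suc i) (X 0 p) h)) (≡⇒≋ (sym (cong (X 0) (∂-out (suc i) p h))))

∂*-X₀ : ∀ {n} s (p : Poly n) → ∂* (map suc s) (X 0 p) ≋ X 0 (∂* (map suc s) p)
∂*-X₀ []      p = ≋-refl
∂*-X₀ (i ∷ s) p = ≋-trans (≋-cong (∂*-linear (map suc s)) (∂-X₀ i p)) (∂*-X₀ s (∂ (suc i) p))

-- `k` counts the operators already applied, so that `k` plus the degree stays equal to `d` and no
-- truncated subtraction enters.
∂*-degree : ∀ {n} s k d {p : Poly n} → All (λ t → k ℕ.+ Vec.sum (proj₂ t) ≡ d) p →
  All (λ t → length s ℕ.+ (k ℕ.+ Vec.sum (proj₂ t)) ≡ d) (∂* s p)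
∂*-degree []      k d h = h
∂*-degree (i ∷ s) k d h = All.map (λ e → trans (sym (ℕP.+-suc (length s) _)) e)
  (∂*-degree s (suc k) d (All-∂ {P = λ m → k ℕ.+ Vec.sum m ≡ d} {λ m → suc k ℕ.+ Vec.sum m ≡ d} i
    (λ {m} e → All.map (λ {t} l → trans (sym (ℕP.+-suc k _)) (trans (cong (k ℕ.+_) l) e)) (ddMono-sum i m)) h))

∂*-vanish : ∀ {n} s k d {p : Poly n} → All (λ t → k ℕ.+ Vec.sum (proj₂ t) ≡ d) p → d < length s ℕ.+ k → ∂* s p ≋ []
∂*-vanish s k d h d< = mk λ m → coeff-absent (All.map
  (λ {t} e _ → ℕP.<⇒≱ d< (ℕP.≤-trans (ℕP.+-monoʳ-≤ (length s) (ℕP.m≤m+n k _)) (ℕP.≤-reflexive e))) (∂*-degree s k d h))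

codeWord-step : ∀ {n} a (m : Mono n) b (m′ : Mono n) →
  ∂* (codeWord (a ∷ m)) (mono (b ∷ m′)) ≋ ∂* (run a) (mapM (b ∷_) (∂* (codeWord m) (mono m′)))
codeWord-step a m b m′ = ≋-trans (≡⇒≋ (∂*-++ (map suc (codeWord m)) (run a) (mono (b ∷ m′))))
  (≋-cong (∂*-linear (run a)) (∂*-map-suc (codeWord m) b (mono m′)))

codeWord-short : ∀ {n} (a b : Mono n) → Vec.sum b < Vec.sum a → ∂* (codeWord a) (mono b) ≋ []
codeWord-short a b h = ∂*-vanish (codeWord a) 0 (Vec.sum b) (refl ∷ [])
  (subst (Vec.sum b <_) (trans (sym (length-codeWord a)) (sym (ℕP.+-identityʳ _))) h)

codeWord-below : ∀ {n} (a b : Mono n) → b ≺ a → ∂* (codeWord a) (mono b) ≋ []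
codeWord-below a b (inj₁ h)       = codeWord-short a b h
codeWord-below a b (inj₂ (s , h)) = go a b s h
  where
  go : ∀ {n} (a b : Mono n) → Vec.sum b ≡ Vec.sum a → FirstGt b a → ∂* (codeWord a) (mono b) ≋ []
  go []      []      s ()
  go {suc n} (x ∷ a) (y ∷ b) s h = ≋-trans (codeWord-step x a y b)
    (≋-trans (≋-cong (∘-linear (∂*-linear (run x)) (mapM-linear {n} (y ∷_))) (inner s h)) (0-homo (∂*-linear (run x))))
    where
    inner : y ℕ.+ Vec.sum b ≡ x ℕ.+ Vec.sum a → FirstGt (y ∷ b) (x ∷ a) → ∂* (codeWord a) (mono b) ≋ []
    inner s (inj₁ x<y)        = codeWord-short a b (ℕP.≰⇒> λ le → ℕP.<-irrefl (sym s) (ℕP.+-mono-<-≤ x<y le))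
    inner s (inj₂ (refl , h)) = go a b (ℕP.+-cancelˡ-≡ y _ _ s) h

geo-degree : ∀ n k p q → All (λ t → 1 ℕ.+ Vec.sum (proj₂ t) ≡ k ℕ.+ (p ℕ.+ q)) (geo (𝟏 {n}) k p q)
geo-degree n zero    p q = []
geo-degree n (suc k) p q = cong suc (trans (cong (λ s → p ℕ.+ (q ℕ.+ k ℕ.+ s)) (sum-𝟏 n)) (rearrange p q k)) ∷
  All.map (λ e → trans e (ℕP.+-suc k (p ℕ.+ q))) (geo-degree n k (suc p) q)
  where
  rearrange : ∀ p q k → p ℕ.+ (q ℕ.+ k ℕ.+ 0) ≡ k ℕ.+ (p ℕ.+ q)
  rearrange = ℕSolver.solve-∀

-- ∂₁ of x₁^{a+1} is the complete homogeneous polynomial h_a(x₁,x₂) = x₂^a + x₁ h_{a-1}(x₁,x₂). The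
-- a operators still to come commute with multiplication by x₁, and h_{a-1} has degree less than a,
-- so they kill the second part; on x₂^a they repeat the problem one variable further on.
run-power : ∀ n a → a ≤ n → ∂* (run a) (mono (a ∷ 𝟏 {n})) ≋ mono 𝟏
run-power n       zero    _       = ≋-refl
run-power (suc n) (suc a) (s≤s h) = begin
  ∂* s (∂ 0 (mono (suc a ∷ 0 ∷ 𝟏)))
    ≈⟨ ≋-cong (∂*-linear s) (≋-trans (∂-mono 0 (suc a ∷ 0 ∷ 𝟏))
       (≋-trans (ddMono-≥ 𝟏 0 (suc a)) (geo-suc₀ 𝟏 a 0 0))) ⟩
  ∂* s (mono (0 ∷ a ∷ 𝟏) ⊕ X 0 g)                 ≈⟨ ⊕-homo (∂*-linear s) (mono (0 ∷ a ∷ 𝟏)) (X 0 g) ⟩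
  ∂* s (mono (0 ∷ a ∷ 𝟏)) ⊕ ∂* s (X 0 g)          ≈⟨ ⊕-cong (∂*-map-suc (run a) 0 (mono (a ∷ 𝟏))) (∂*-X₀ (run a) g) ⟩
  mapM (0 ∷_) (∂* (run a) (mono (a ∷ 𝟏))) ⊕ X 0 (∂* s g)
    ≈⟨ ⊕-cong (≋-cong (mapM-linear (0 ∷_)) (run-power n a h)) (X-zero 0 (∂*-vanish s 1 (a ℕ.+ 0) (geo-degree n a 0 0) shorter)) ⟩
  mono 𝟏 ⊕ []                                     ≈⟨ ⊕-identityʳ (mono 𝟏) ⟩
  mono 𝟏 ∎
  where
  open ≋-Reasoning
  s = map suc (run a)
  g = geo (𝟏 {n}) a 0 0
  shorter : a ℕ.+ 0 < length s ℕ.+ 1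
  shorter rewrite LP.length-map suc (run a) | length-run a = ℕP.+-monoʳ-< a (s≤s z≤n)

codeWord-diagonal : ∀ {n} (a : Mono n) → Substaircase a → ∂* (codeWord a) (mono a) ≋ mono 𝟏
codeWord-diagonal []                  _        = ≋-refl
codeWord-diagonal {suc n} (a ∷ m) (a≤ , h) = ≋-trans (codeWord-step a m a m)
  (≋-trans (≋-cong (∘-linear (∂*-linear (run a)) (mapM-linear {n} (a ∷_))) (codeWord-diagonal m h)) (run-power n a a≤))

Λ-lin : ∀ {n} s (p : Poly n) → Λ s p ≡ lin (Λ s ∘ mono) p
Λ-lin s []            = Λ-0 s ≋-refl
Λ-lin s ((c , m) ∷ p) = trans (Λ-cong s (≡⇒≋ (cong (λ a → (a , m) ∷ p) (sym (ℤP.*-identityʳ c)))))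
  (trans (Λ-⊕ s (c · mono m) p) (cong₂ ℤ._+_ (Λ-· s c (mono m)) (Λ-lin s p)))

≺-cmp : ∀ {n} (a b : Mono n) → a ≢ b → a ≺ b ⊎ b ≺ a
≺-cmp a b a≢b with ℕP.<-cmp (Vec.sum a) (Vec.sum b)
... | tri< h _ _ = inj₁ (inj₁ h)
... | tri> _ _ h = inj₂ (inj₁ h)
... | tri≈ _ s _ with first a b a≢b
  where
  first : ∀ {n} (a b : Mono n) → a ≢ b → FirstGt a b ⊎ FirstGt b a
  first []      []      ne = ⊥-elim (ne refl)
  first (x ∷ a) (y ∷ b) ne with ℕP.<-cmp x y
  ... | tri< h _ _ = inj₂ (inj₁ h)
  ... | tri> _ _ h = inj₁ (inj₁ h)
  ... | tri≈ _ refl _ with first a b (ne ∘ cong (x ∷_))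
  ...   | inj₁ h = inj₁ (inj₂ (refl , h))
  ...   | inj₂ h = inj₂ (inj₂ (refl , h))
...   | inj₁ h = inj₁ (inj₂ (s , h))
...   | inj₂ h = inj₂ (inj₂ (sym s , h))

δ-refl : ∀ {n} (a : Mono n) → δ a a ≡ 1ℤ
δ-refl a with a ≟M a
... | yes _ = refl
... | no ne = ⊥-elim (ne refl)

-- The difference between the functional and the coefficient at `a` vanishes on x^a and on every
-- smaller monomial, and `p` has no larger ones.
Λ-leading : ∀ {n} (p : Poly n) a → IsLeadingMonomial p a → Substaircase a → Λ (codeWord a) p ≡ coeff p a
Λ-leading {n} p a (_ , above) h = ℤP.i-j≡0⇒i≡j _ _ (begin
  Λ s p ℤ.- coeff p a                                       ≡⟨ cong₂ (λ x y → x ℤ.- y) (Λ-lin s p) (coeff-lin p a) ⟩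
  lin φ p ℤ.- lin (λ b → δ b a) p
    ≡⟨ cong (ℤ._+_ (lin φ p)) (trans (sym (ℤP.-1*i≡-i _)) (sym (lin-*φ -1ℤ _ p))) ⟩
  lin φ p ℤ.+ lin (λ b → -1ℤ ℤ.* δ b a) p                   ≡⟨ lin-+φ φ _ p ⟨
  lin (λ b → φ b ℤ.+ -1ℤ ℤ.* δ b a) p                       ≡⟨ lin-vanish _ p vanish ⟩
  0ℤ ∎)
  where
  open ≡-Reasoning
  s = codeWord a
  φ : Mono _ → ℤ
  φ = Λ s ∘ mono
  vanish : ∀ b → coeff p b ≡ 0ℤ ⊎ φ b ℤ.+ -1ℤ ℤ.* δ b a ≡ 0ℤ
  vanish b with b ≟M a
  ... | yes refl = inj₂ (cong (ℤ._+ -1ℤ) (trans (at (codeWord-diagonal b h) 𝟏) (δ-refl (𝟏 {n}))))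
  ... | no ne with ≺-cmp b a ne
  ...   | inj₂ a≺b = inj₁ (above b a≺b)
  ...   | inj₁ b≺a = inj₂ (cong (ℤ._+ 0ℤ) (at (codeWord-below a b b≺a) 𝟏))

-- A divisor of a substaircase monomial is again substaircase, so the leading monomial `m₀` has its
-- own functional; this is zero on the ideal and yet equals the leading coefficient.
substaircase-standard : ∀ {n} (m : Mono n) → Substaircase m → ¬ InInitialIdeal m
substaircase-standard m h (f , m₀ , f∈ , lead , m₀∣m) =
  proj₁ lead (trans (sym (Λ-leading f m₀ lead (substaircase-∣M m₀ m m₀∣m h))) (Λ-ideal (codeWord m₀) (fromInIdeal f f∈)))

theorem1p1 : (n : ℕ) → 1 ≤ n → (u w : List ℕ) → IsPerm n u → IsPerm n w →
    u ≤[ n ]B w →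
    (N : ℕ) → n ≤ N → (c : List ℕ → List ℕ → ℤ) → IsLRExpansion n N u c →
    IsSkewSchubert n w u (ΣP (map (λ v → c v (ι n N w) · 𝔖 n (w₀· n v)) (perms n)))
theorem1p1 n 1≤n u w pu pw _ N n≤N c lr =
  toInIdeal (skew-congruence c 1≤n n≤N (isPerm⁻ pu) (isPerm⁻ pw) lr) ,
  λ m nz → substaircase-standard m (coeff-support (skewSum-substaircase n N c w) nz)
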